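{- Let $\mathcal{D}$ be a quasi-symmetric $2$-$(v,k,\lambda)$ design with replication number $r$, $b$ blocks and two block intersection sizes $x\neq y$ (with no assumption on which is larger), and let $\Gamma_2$ be its block graph in which two blocks are adjacent if they intersect in $y$ points, a strongly regular graph with parameters $(b,a,c,d)$. Let $\Gamma$ be the graph whose vertex set is the disjoint union of the set $V_1$ of points and the set $V_2$ of blocks of $\mathcal{D}$, where any two distinct points are adjacent (the induced subgraph on $V_1$ is complete), a point is adjacent to a block if and only if they are incident, and the induced subgraph on $V_2$ is $\Gamma_2$. Suppose that $\Gamma$ is biregular with valency partition $(V_1,V_2)$. Let $\theta_1,\theta_2$ be real numbers. Then $\Gamma$ has three distinct $\mathcal{L}$-eigenvalues $0,\theta_1,\theta_2$ if and only if $$\begin{array}{rcl} \frac{v-1}{v-1+r}+\frac{r}{k+a}&=&t(v-1+r)^2-(\theta_1-1)(\theta_2-1)(v-1+r),\\ \frac{v-2}{v-1+r}+\frac{\lambda}{k+a}&=&t(v-1+r)^2+2-\theta_1-\theta_2,\\ \frac k{v-1+r}+\frac{a}{k+a}&=&t(k+a)^2-(\theta_1-1)(\theta_2-1)(k+a),\\ \frac{x}{v-1+r}+\frac{d}{k+a}&=&t(k+a)^2,\\ \frac{y}{v-1+r}+\frac{c}{k+a}&=&t(k+a)^2+2-\theta_1-\theta_2,\\ \frac{k}{v-1+r}+\frac{\lambda k-xr}{(y-x)(k+a)}&=&t(v-1+r)(k+a),\\ \frac{k-1}{v-1+r}+\frac{(\lambda-1)(k-1)-(x-1)(r-1)}{(y-x)(k+a)}&=&t(v-1+r)(k+a)+2-\theta_1-\theta_2,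 \end{array}$$ where $t=\frac{\theta_1\theta_2}{v(v-1+r)+b(k+a)}$.
   Context: All graphs are finite, simple and undirected. $d_u$ denotes the valency (degree) of vertex $u$. The normalized Laplacian of a graph is the matrix $\mathcal{L}=[\ell_{uv}]$ indexed by the vertices with $\ell_{uu}=1$ if $d_u\neq 0$, $\ell_{uv}=-1/\sqrt{d_ud_v}$ if $u$ and $v$ are adjacent, and $\ell_{uv}=0$ otherwise. Its eigenvalues are called the $\mathcal{L}$-eigenvalues of the graph. A graph is biregular if exactly two distinct valencies occur; the valency partition is the partition of the vertex set according to valencies. A $2$-$(v,k,\lambda)$ design ($2\le k<v$, $\lambda\ge1$) has $v$ points and a collection of $b$ blocks (repeated blocks allowed), each block incident with $k$ points, such that any two distinct points are in exactly $\lambda$ common blocks; each point is then in $r=\lambda\frac{v-1}{k-1}$ blocks and $b=\frac{vr}{k}$. It is quasi-symmetric with block intersection sizes $x\neq y$ if any two distinct blocks meet in $x$ or $y$ points, both sizes occurring. A graph is strongly regular with parameters $(n,k',\lambda',\mu')$ if it has $n$ vertices, is $k'$-regular with $0<k'<n-1$, and any two distinct vertices have $\lambda'$ common neighbors if adjacent and $\mu'$ otherwise. The block graph $\Gamma_2$ of a quasi-symmetric design (blocks adjacent when they meet in $y$ points) is strongly regular with parameters $(b,a,c,d)$, where $a=\frac{(r-1)k-x(b-1)}{y-x}$, $d=a+\rho_1\rho_2$, $c=d+\rho_1+\rho_2$, with $\rho_1=\frac{r-\lambda-k+x}{y-x}$ and $\rho_2=\frac{x-k}{y-x}$. For a point-block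 pair $(P,B)$, the number of blocks $B'\neq B$ incident with $P$ and meeting $B$ in $y$ points equals $\frac{(\lambda-1)(k-1)-(x-1)(r-1)}{y-x}$ if $P$ is incident with $B$, and $\frac{\lambda k-xr}{y-x}$ otherwise. -}

module Defs where

open import Algebra.Bundles using (CommutativeRing; Semiring)
import Algebra.Definitions.RawSemiring as RawSemiringDefinitions
open import Data.Bool.Base using (Bool; true; false)
open import Data.Fin.Base using (Fin; splitAt)
open import Data.Fin.Properties using (_≟_)
open import Data.Fin.Subset using (Subset; _∈_; _∩_; ∣_∣)
open import Data.Fin.Subset.Properties using (_∈?_; ∩-comm)
open import Data.Nat.Base as ℕ using (ℕ; suc)
import Data.Nat.Properties as ℕ
open import Data.Product.Base using (∃; ∃₂; _×_; _,_)
open import Data.Sum.Base using (_⊎_; inj₁; inj₂; [_,_]′)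
open import Data.Vec.Base using (tabulate)
open import Function.Base using (_∘_; const)
open import Function.Bundles using (_⇔_)
open import Level using (0ℓ) renaming (suc to lsuc)
open import Relation.Binary.Core using (Rel)
open import Relation.Binary.Definitions using (Decidable; Irreflexive; Symmetric)
open import Relation.Binary.PropositionalEquality
  using (_≡_; _≢_; ≢-sym; refl; sym; trans; cong)
open import Relation.Binary.Structures using (IsStrictTotalOrder)
open import Relation.Nullary using (¬_; yes; no; does)
open import Relation.Nullary.Decidable using (¬?; _×-dec_)

-- The real numbers, characterised (classically, up to isomorphism) as a
-- complete ordered field.  The operations _⁻¹ and √ are total; their values
-- outside the nonzero, respectively nonnegative, elements are unspecified.
-- √ could be recovered from `sup`; it is uniquely determined by its laws.
record Reals : Set (lsuc 0ℓ) where
  infix  4 _<_ _≤_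
  infix  9 _⁻¹
  infixl 7 _/_
  infix  9 _²
  field
    commutativeRing : CommutativeRing 0ℓ 0ℓ
  open CommutativeRing commutativeRing public
    renaming (Carrier to ℝ; refl to ≈-refl; sym to ≈-sym; trans to ≈-trans)

  field
    1≉0       : 1# ≉ 0#
    _⁻¹       : ℝ → ℝ
    ⁻¹-cong   : ∀ {p q} → p ≈ q → p ⁻¹ ≈ q ⁻¹
    *-inverse : ∀ {p} → p ≉ 0# → p * p ⁻¹ ≈ 1#

    _<_                : Rel ℝ 0ℓ
    isStrictTotalOrder : IsStrictTotalOrder _≈_ _<_
    +-monoʳ-<          : ∀ p {q s} → q < s → p + q < p + s
    *-pos              : ∀ {p q} → 0# < p → 0# < q → 0# < p * q

  _≤_ : Rel ℝ 0ℓ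
  p ≤ q = ¬ q < p

  UpperBound : (ℝ → Set) → ℝ → Set
  UpperBound P u = ∀ p → P p → p ≤ u

  field
    sup : (P : ℝ → Set) → ∃ P → ∃ (UpperBound P) →
          ∃ λ s → UpperBound P s × (∀ u → UpperBound P u → s ≤ u)

    √           : ℝ → ℝ
    √-cong      : ∀ {p q} → p ≈ q → √ p ≈ √ q
    √-nonneg    : ∀ {p} → 0# ≤ p → 0# ≤ √ p
    √-square    : ∀ {p} → 0# ≤ p → √ p * √ p ≈ p

  open RawSemiringDefinitions (Semiring.rawSemiring semiring) public
    using (sum) renaming (_×_ to _·_)

  _/_ : ℝ → ℝ → ℝ
  p / q = p * q ⁻¹

  _² : ℝ → ℝ
  p ² = p * p

  fromℕ : ℕ → ℝ
  fromℕ n = n · 1#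

  2# : ℝ
  2# = fromℕ 2

record Graph (n : ℕ) : Set₁ where
  field
    Adj    : Rel (Fin n) 0ℓ
    adj?   : Decidable Adj
    symm   : Symmetric Adj
    irrefl : Irreflexive _≡_ Adj

  neighbours : Fin n → Subset n
  neighbours u = tabulate λ w → does (adj? u w)

  valency : Fin n → ℕ
  valency u = ∣ neighbours u ∣

record IsStronglyRegular {n} (G : Graph n) (κ ƛ μ : ℕ) : Set where
  open Graph G
  field
    0<κ         : 0 ℕ.< κ
    κ<n-1       : suc κ ℕ.< n
    regular     : ∀ u → valency u ≡ κ
    adjacent    : ∀ {u w} → Adj u w → ∣ neighbours u ∩ neighbours w ∣ ≡ ƛ
    nonadjacent : ∀ {u w} → u ≢ w → ¬ Adj u w →
                  ∣ neighbours u ∩ neighbours w ∣ ≡ μ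

IsBiregular : ∀ {n} → Graph n → Set
IsBiregular G = ∃₂ λ d₁ d₂ → d₁ ≢ d₂
  × (∃ λ u → valency u ≡ d₁)
  × (∃ λ u → valency u ≡ d₂)
  × (∀ u → valency u ≡ d₁ ⊎ valency u ≡ d₂)
  where open Graph G

-- A partition is given by a labelling of the vertices; its parts are the
-- nonempty fibres.
IsValencyPartition : ∀ {n} {A : Set} → Graph n → (Fin n → A) → Set
IsValencyPartition G label =
  ∀ u w → valency u ≡ valency w ⇔ label u ≡ label w
  where open Graph G

-- A 2-(v,k,ƛ) design with b blocks; blocks are indexed, so they may repeat.
record Design (v b k ƛ : ℕ) : Set where
  field
    block : Fin b → Subset v

  blocksThrough : Fin v → Subset b
  blocksThrough P = tabulate λ B → does (P ∈? block B)

  meet : Fin b → Fin b → ℕ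
  meet B B′ = ∣ block B ∩ block B′ ∣

  field
    2≤k       : 2 ℕ.≤ k
    k<v       : k ℕ.< v
    1≤ƛ       : 1 ℕ.≤ ƛ
    blockSize : ∀ B → ∣ block B ∣ ≡ k
    balanced  : ∀ {P Q} → P ≢ Q → ∣ blocksThrough P ∩ blocksThrough Q ∣ ≡ ƛ

module _ {v b k ƛ : ℕ} (D : Design v b k ƛ) where
  open Design D

  HasReplicationNumber : ℕ → Set
  HasReplicationNumber r = ∀ P → ∣ blocksThrough P ∣ ≡ r

  record IsQuasiSymmetric (x y : ℕ) : Set where
    field
      x≢y      : x ≢ y
      meets    : ∀ {B B′} → B ≢ B′ → meet B B′ ≡ x ⊎ meet B B′ ≡ y
      x-occurs : ∃₂ λ B B′ → B ≢ B′ × meet B B′ ≡ x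
      y-occurs : ∃₂ λ B B′ → B ≢ B′ × meet B B′ ≡ y

  blockGraph : ℕ → Graph b
  blockGraph y = record
    { Adj    = λ B B′ → B ≢ B′ × meet B B′ ≡ y
    ; adj?   = λ B B′ → ¬? (B ≟ B′) ×-dec (meet B B′ ℕ.≟ y)
    ; symm   = λ {B} {B′} (B≢B′ , eq) →
        ≢-sym B≢B′ , trans (cong ∣_∣ (∩-comm (block B′) (block B))) eq
    ; irrefl = λ B≡B′ (B≢B′ , _) → B≢B′ B≡B′
    }

  -- Complete graph on the points, a given graph on the blocks, and incidence
  -- between them.  Points come first in Fin (v + b), then blocks.
  module _ (Γ₂ : Graph b) where
    private module Γ₂ = Graph Γ₂

    PBAdj : Rel (Fin v ⊎ Fin b) 0ℓ
    PBAdj (inj₁ P) (inj₁ Q)  = P ≢ Q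
    PBAdj (inj₁ P) (inj₂ B)  = P ∈ block B
    PBAdj (inj₂ B) (inj₁ P)  = P ∈ block B
    PBAdj (inj₂ B) (inj₂ B′) = Γ₂.Adj B B′

    pbAdj? : Decidable PBAdj
    pbAdj? (inj₁ P) (inj₁ Q)  = ¬? (P ≟ Q)
    pbAdj? (inj₁ P) (inj₂ B)  = P ∈? block B
    pbAdj? (inj₂ B) (inj₁ P)  = P ∈? block B
    pbAdj? (inj₂ B) (inj₂ B′) = Γ₂.adj? B B′

    pbSymm : Symmetric PBAdj
    pbSymm {inj₁ _} {inj₁ _} P≢Q = ≢-sym P≢Q
    pbSymm {inj₁ _} {inj₂ _} P∈B = P∈B
    pbSymm {inj₂ _} {inj₁ _} P∈B = P∈B
    pbSymm {inj₂ _} {inj₂ _} adj = Γ₂.symm adj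

    pbIrrefl : ∀ s → ¬ PBAdj s s
    pbIrrefl (inj₁ P) P≢P = P≢P refl
    pbIrrefl (inj₂ B) adj = Γ₂.irrefl refl adj

    pointBlockGraph : Graph (v ℕ.+ b)
    pointBlockGraph = record
      { Adj    = λ u w → PBAdj (splitAt v u) (splitAt v w)
      ; adj?   = λ u w → pbAdj? (splitAt v u) (splitAt v w)
      ; symm   = λ {u} {w} → pbSymm {splitAt v u} {splitAt v w}
      ; irrefl = λ { {u} refl → pbIrrefl (splitAt v u) }
      }

-- The partition of Fin (v + b) into points (true) and blocks (false).
isPoint : ∀ v {b} → Fin (v ℕ.+ b) → Bool
isPoint v = [ const true , const false ]′ ∘ splitAt v

module _ (R : Reals) where
  open Reals R

  Matrix : ℕ → Set
  Matrix n = Fin n → Fin n → ℝ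

  diagonal : ℕ → ℝ
  diagonal 0       = 0#
  diagonal (suc _) = 1#

  normalizedLaplacian : ∀ {n} → Graph n → Matrix n
  normalizedLaplacian G u w with u ≟ w | Graph.adj? G u w
  ... | yes _ | _     = diagonal (Graph.valency G u)
  ... | no _  | yes _ =
    - (1# / √ (fromℕ (Graph.valency G u) * fromℕ (Graph.valency G w)))
  ... | no _  | no _  = 0#

  IsEigenvalue : ∀ {n} → Matrix n → ℝ → Set
  IsEigenvalue {n} M θ = ∃ λ (z : Fin n → ℝ) →
    (∃ λ i → z i ≉ 0#) × (∀ i → sum (λ j → M i j * z j) ≈ θ * z i)

  -- The set of ℒ-eigenvalues is exactly {θ₀, θ₁, θ₂}, with θ₀, θ₁, θ₂ distinct.
  HasThreeDistinctℒ-Eigenvalues : ∀ {n} → Graph n → ℝ → ℝ → ℝ → Set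
  HasThreeDistinctℒ-Eigenvalues G θ₀ θ₁ θ₂ =
    θ₀ ≉ θ₁ × θ₀ ≉ θ₂ × θ₁ ≉ θ₂ ×
    (∀ θ → IsEigenvalue (normalizedLaplacian G) θ ⇔ (θ ≈ θ₀ ⊎ θ ≈ θ₁ ⊎ θ ≈ θ₂))

  record DesignEquations (v b k ƛ r x y a c d θ₁ θ₂ : ℝ) : Set where
    t : ℝ
    t = (θ₁ * θ₂) / (v * (v - 1# + r) + b * (k + a))
    field
      point-point :
        (v - 1#) / (v - 1# + r) + r / (k + a)
          ≈ t * (v - 1# + r) ² - (θ₁ - 1#) * (θ₂ - 1#) * (v - 1# + r)
      distinct-points :
        (v - 2#) / (v - 1# + r) + ƛ / (k + a)
          ≈ t * (v - 1# + r) ² + 2# - θ₁ - θ₂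
      block-block :
        k / (v - 1# + r) + a / (k + a)
          ≈ t * (k + a) ² - (θ₁ - 1#) * (θ₂ - 1#) * (k + a)
      nonadjacent-blocks :
        x / (v - 1# + r) + d / (k + a)
          ≈ t * (k + a) ²
      adjacent-blocks :
        y / (v - 1# + r) + c / (k + a)
          ≈ t * (k + a) ² + 2# - θ₁ - θ₂
      nonincident :
        k / (v - 1# + r) + (ƛ * k - x * r) / ((y - x) * (k + a))
          ≈ t * (v - 1# + r) * (k + a)
      incident :
        (k - 1#) / (v - 1# + r)
          + ((ƛ - 1#) * (k - 1#) - (x - 1#) * (r - 1#)) / ((y - x) * (k + a))
          ≈ t * (v - 1# + r) * (k + a) + 2# - θ₁ - θ₂

{-# OPTIONS --safe #-}

-- Let δ be the vertex valencies and M = δ⁻¹ A.  Substituting f = δ^(-1/2) z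
-- turns ℒ z = θ z into M f = (1 − θ) f, where M is self-adjoint for the inner
-- product with weights δ and M 𝟏 = 𝟏.  The equations are the entries of
--   (M − μ)(M − ν) = t 𝟏 δᵀ,  μ = 1 − θ₁, ν = 1 − θ₂.
-- If this identity holds, every eigenvector orthogonal to 𝟏 has eigenvalue μ or
-- ν, and a vector g orthogonal to 𝟏 with (M − ρ) g ≠ 0 for all ρ shows that
-- μ ≠ ν and that both occur.
-- Conversely, no spectral theorem is needed to see that
-- K = (M − 1)(M − μ)(M − ν) vanishes if 1, μ, ν are the only eigenvalues: the
-- identities for NNᵀ and NᵀN make every vector vanish under a product of factors
-- M − ρ with real ρ, and these can be removed one at a time, because
-- K ((M − ρ) f) = 0 implies K f = 0.  Then (M − μ)(M − ν) maps into ker (M − 1),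
-- which consists of the constants as the graph is connected.
module Submission where

open import Defs
import Algebra.Properties.Ring as RingProperties
import Algebra.Properties.Semiring.Mult as SemiringMult
import Algebra.Properties.Semiring.Sum as SemiringSum
import Algebra.Solver.Ring as RingSolver
open import Algebra.Solver.Ring.AlmostCommutativeRing
  using (fromCommutativeRing; _-Raw-AlmostCommutative⟶_)
open import Data.Bool.Base using (Bool; true; false; _∧_)
open import Data.Empty using (⊥-elim)
open import Data.Fin.Base using (Fin; zero; suc; splitAt; join; _↑ˡ_; _↑ʳ_)
open import Data.Fin.Properties using (_≟_; any?; join-splitAt; splitAt-join)
open import Data.Fin.Subset using (Subset; _∩_; ∣_∣)
open import Data.Fin.Subset.Properties using (_∈?_; ∣p∩q∣≤∣p∣)
open import Data.Integer.Base as ℤ using (ℤ; -[1+_]; +_)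
import Data.Integer.Properties as ℤ
open import Data.Maybe.Base using (Maybe; just; nothing)
open import Data.Nat.Base as ℕ using (ℕ; zero; suc)
import Data.Nat.Properties as ℕ
open import Data.Product.Base using (∃; ∃₂; _×_; _,_; proj₁; proj₂)
open import Data.Sum.Base as Sum using (_⊎_; inj₁; inj₂; [_,_]′)
open import Data.Sum.Properties using (inj₁-injective)
open import Data.Vec.Base using (_∷_; []; lookup; tabulate)
open import Data.Vec.Properties using (lookup∘tabulate; lookup-zipWith)
open import Function.Base using (_∘_; const)
open import Function.Bundles using (_⇔_; mk⇔; Equivalence)
open import Relation.Binary.Definitions using (tri<; tri≈; tri>)
open import Relation.Binary.PropositionalEquality as ≡ using (_≡_; _≢_)
open import Relation.Binary.Structures using (IsStrictTotalOrder)
open import Relation.Nullary using (¬_; yes; no; does; Dec)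
open import Relation.Nullary.Decidable using (¬?; decidable-stable; dec-true; dec-false)

-- The annihilating factors must have real roots, as nothing here diagonalises `M`. Write d₁ = v - 1
-- + r and d₂ = k + a. For a vector p on the points, `M` preserves, up to constants on points and on
-- blocks, the plane of (p, 0) and (0, Nᵀp). The product of its off-diagonal entries is (r -
-- λ)/(d₁d₂) ≥ 0, so its characteristic polynomial splits. For a vector g on the blocks, NᵀN
-- expresses A through incidence, and the shift by ρ₂/d₂ with ρ₂ = (x - k)/(y - x) leaves only
-- vectors already treated. The constants come from the 2×2 quotient of the partition into points
-- and blocks. There are seven equations because an entry of the identity depends on its position
-- only through equality, incidence and adjacency: seven cases up to transposition. The equations do
-- not state that θ₁ and θ₂ are nonzero; this follows from t ≠ 0, since a point outside a block has
-- at least k common neighbours with it. The different valencies provide g: the indicators of a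
-- point and a block, each divided by its valency, are subtracted and tested at a common neighbour.

-- Ordered-field arithmetic, finite sums, and counting by 0/1-valued functions.

module RealProperties (R : Reals) where
  open Reals R public hiding (zero)
  open SemiringMult semiring using (×-homo-+; ×1-homo-*)
  open RingProperties ring using (-‿distribˡ-*; -‿distribʳ-*; -‿involutive; -0#≈0#; -‿+-comm)

  open import Relation.Binary.Reasoning.Setoid setoid public

  private
    ⟦_⟧₀ : ℤ → ℝ
    ⟦ + n ⟧₀      = fromℕ n
    ⟦ -[1+ n ] ⟧₀ = - fromℕ (suc n)

    -- Differs from ⟦_⟧₀ only in sending + 1 to 1# instead of 1# + 0#, so that
    -- the solver's constant 1 is definitionally 1#.
    ⟦_⟧ : ℤ → ℝ
    ⟦ + 1 ⟧ = 1#
    ⟦ i ⟧   = ⟦ i ⟧₀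

    ⟦⟧≈⟦⟧₀ : ∀ i → ⟦ i ⟧ ≈ ⟦ i ⟧₀
    ⟦⟧≈⟦⟧₀ (+ 0)             = ≈-refl
    ⟦⟧≈⟦⟧₀ (+ 1)             = ≈-sym (+-identityʳ 1#)
    ⟦⟧≈⟦⟧₀ (+ suc (suc n))   = ≈-refl
    ⟦⟧≈⟦⟧₀ -[1+ n ]          = ≈-refl

    ⟦⟧₀-homo-⊖ : ∀ m n → ⟦ m ℤ.⊖ n ⟧₀ ≈ fromℕ m - fromℕ n
    ⟦⟧₀-homo-⊖ m zero = ≈-trans (≈-sym (+-identityʳ _)) (+-congˡ (≈-sym -0#≈0#))
    ⟦⟧₀-homo-⊖ zero (suc n) = ≈-sym (+-identityˡ _)
    ⟦⟧₀-homo-⊖ (suc m) (suc n) = begin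
      ⟦ suc m ℤ.⊖ suc n ⟧₀                  ≡⟨ ≡.cong ⟦_⟧₀ (ℤ.[1+m]⊖[1+n]≡m⊖n m n) ⟩
      ⟦ m ℤ.⊖ n ⟧₀                          ≈⟨ ⟦⟧₀-homo-⊖ m n ⟩
      fromℕ m - fromℕ n                     ≈⟨ +-congʳ (+-identityʳ _) ⟨
      (fromℕ m + 0#) - fromℕ n              ≈⟨ +-congʳ (+-congˡ (-‿inverseʳ 1#)) ⟨
      (fromℕ m + (1# - 1#)) - fromℕ n       ≈⟨ +-congʳ (+-assoc _ _ _) ⟨
      (fromℕ m + 1# - 1#) - fromℕ n         ≈⟨ +-congʳ (+-congʳ (+-comm _ _)) ⟩
      (1# + fromℕ m - 1#) - fromℕ n         ≈⟨ +-assoc _ _ _ ⟩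
      1# + fromℕ m + (- 1# - fromℕ n)       ≈⟨ +-congˡ (-‿+-comm _ _) ⟩
      fromℕ (suc m) - fromℕ (suc n)         ∎

    ⟦⟧₀-homo-+ : ∀ i j → ⟦ i ℤ.+ j ⟧₀ ≈ ⟦ i ⟧₀ + ⟦ j ⟧₀
    ⟦⟧₀-homo-+ (+ m)    (+ n)    = ×-homo-+ 1# m n
    ⟦⟧₀-homo-+ (+ m)    -[1+ n ] = ⟦⟧₀-homo-⊖ m (suc n)
    ⟦⟧₀-homo-+ -[1+ m ] (+ n)    = ≈-trans (⟦⟧₀-homo-⊖ n (suc m)) (+-comm _ _)
    ⟦⟧₀-homo-+ -[1+ m ] -[1+ n ] = begin
      - fromℕ (suc (suc (m ℕ.+ n)))       ≡⟨ ≡.cong (λ j → - fromℕ (suc j)) (ℕ.+-suc m n) ⟨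
      - fromℕ (suc m ℕ.+ suc n)           ≈⟨ -‿cong (×-homo-+ 1# (suc m) (suc n)) ⟩
      - (fromℕ (suc m) + fromℕ (suc n))   ≈⟨ -‿+-comm _ _ ⟨
      - fromℕ (suc m) - fromℕ (suc n)     ∎

    ⟦⟧₀-homo-neg : ∀ i → ⟦ ℤ.- i ⟧₀ ≈ - ⟦ i ⟧₀
    ⟦⟧₀-homo-neg (+ 0)     = ≈-sym -0#≈0#
    ⟦⟧₀-homo-neg (+ suc n) = ≈-refl
    ⟦⟧₀-homo-neg -[1+ n ]  = ≈-sym (-‿involutive _)

    ⟦⟧₀-homo-+* : ∀ m j → ⟦ + m ℤ.* j ⟧₀ ≈ fromℕ m * ⟦ j ⟧₀
    ⟦⟧₀-homo-+* m (+ n) = ≈-trans (reflexive (≡.cong ⟦_⟧₀ (≡.sym (ℤ.pos-* m n)))) (×1-homo-* m n)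
    ⟦⟧₀-homo-+* m -[1+ n ] = begin
      ⟦ + m ℤ.* -[1+ n ] ⟧₀         ≡⟨ ≡.cong ⟦_⟧₀ (ℤ.neg-distribʳ-* (+ m) (+ suc n)) ⟨
      ⟦ ℤ.- (+ m ℤ.* + suc n) ⟧₀    ≈⟨ ⟦⟧₀-homo-neg (+ m ℤ.* + suc n) ⟩
      - ⟦ + m ℤ.* + suc n ⟧₀        ≈⟨ -‿cong (⟦⟧₀-homo-+* m (+ suc n)) ⟩
      - (fromℕ m * fromℕ (suc n))   ≈⟨ -‿distribʳ-* _ _ ⟩
      fromℕ m * - fromℕ (suc n)     ∎
    ⟦⟧₀-homo-* : ∀ i j → ⟦ i ℤ.* j ⟧₀ ≈ ⟦ i ⟧₀ * ⟦ j ⟧₀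
    ⟦⟧₀-homo-* (+ m)    j = ⟦⟧₀-homo-+* m j
    ⟦⟧₀-homo-* -[1+ m ] j = begin
      ⟦ -[1+ m ] ℤ.* j ⟧₀           ≡⟨ ≡.cong ⟦_⟧₀ (ℤ.neg-distribˡ-* (+ suc m) j) ⟨
      ⟦ ℤ.- (+ suc m ℤ.* j) ⟧₀      ≈⟨ ⟦⟧₀-homo-neg (+ suc m ℤ.* j) ⟩
      - ⟦ + suc m ℤ.* j ⟧₀          ≈⟨ -‿cong (⟦⟧₀-homo-+* (suc m) j) ⟩
      - (fromℕ (suc m) * ⟦ j ⟧₀)    ≈⟨ -‿distribˡ-* _ _ ⟩
      - fromℕ (suc m) * ⟦ j ⟧₀      ∎

    morphism : ℤ.+-*-rawRing -Raw-AlmostCommutative⟶ fromCommutativeRing commutativeRing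
    morphism = record
      { ⟦_⟧    = ⟦_⟧
      ; +-homo = λ i j → ≈-trans (⟦⟧≈⟦⟧₀ (i ℤ.+ j)) (≈-trans (⟦⟧₀-homo-+ i j)
                   (+-cong (≈-sym (⟦⟧≈⟦⟧₀ i)) (≈-sym (⟦⟧≈⟦⟧₀ j))))
      ; *-homo = λ i j → ≈-trans (⟦⟧≈⟦⟧₀ (i ℤ.* j)) (≈-trans (⟦⟧₀-homo-* i j)
                   (*-cong (≈-sym (⟦⟧≈⟦⟧₀ i)) (≈-sym (⟦⟧≈⟦⟧₀ j))))
      ; -‿homo = λ i → ≈-trans (⟦⟧≈⟦⟧₀ (ℤ.- i)) (≈-trans (⟦⟧₀-homo-neg i)
                   (-‿cong (≈-sym (⟦⟧≈⟦⟧₀ i))))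
      ; 0-homo = ≈-refl
      ; 1-homo = ≈-refl
      }

    _coeff≟_ : ∀ i j → Maybe (⟦ i ⟧ ≈ ⟦ j ⟧)
    i coeff≟ j with i ℤ.≟ j
    ... | yes i≡j = just (reflexive (≡.cong ⟦_⟧ i≡j))
    ... | no _    = nothing

  open RingSolver ℤ.+-*-rawRing (fromCommutativeRing commutativeRing) morphism _coeff≟_ public
    using (Polynomial; solve; _:+_; _:*_; _:-_; :-_; _:=_; con)

  open SemiringSum semiring public
    using (sum-cong-≋; sum-replicate-zero; ∑-distrib-+; ∑-comm; *-distribˡ-sum; *-distribʳ-sum)
  open IsStrictTotalOrder isStrictTotalOrder public
    using (compare; <-respˡ-≈; <-respʳ-≈) renaming (_≟_ to _≈?_; irrefl to <-irrefl; trans to <-trans; asym to <-asym)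

  :0 :1 :2 : ∀ {n} → Polynomial n
  :0 {n} = con {n} (+ 0)
  :1 {n} = con {n} (+ 1)
  :2 {n} = con {n} (+ 2)

  x-y≈0⇒x≈y : ∀ {x y} → x - y ≈ 0# → x ≈ y
  x-y≈0⇒x≈y {x} {y} h = begin
    x           ≈⟨ solve 2 (λ x y → x := x :- y :+ y) ≈-refl x y ⟩
    x - y + y   ≈⟨ +-congʳ h ⟩
    0# + y      ≈⟨ +-identityˡ y ⟩
    y           ∎

  x≈y⇒x-y≈0 : ∀ {x y} → x ≈ y → x - y ≈ 0#
  x≈y⇒x-y≈0 {x} {y} h = ≈-trans (+-congʳ h) (-‿inverseʳ y)

  *-zero-≈ʳ : ∀ {x y} → y ≈ 0# → x * y ≈ 0#
  *-zero-≈ʳ h = ≈-trans (*-congˡ h) (zeroʳ _)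

  *-zero-≈ˡ : ∀ {x y} → x ≈ 0# → x * y ≈ 0#
  *-zero-≈ˡ h = ≈-trans (*-congʳ h) (zeroˡ _)

  x*y≈0⇒y≈0 : ∀ {x y} → x ≉ 0# → x * y ≈ 0# → y ≈ 0#
  x*y≈0⇒y≈0 {x} {y} x≉0 xy≈0 = begin
    y                    ≈⟨ *-identityˡ y ⟨
    1# * y               ≈⟨ *-congʳ (*-inverse x≉0) ⟨
    x * x ⁻¹ * y         ≈⟨ solve 3 (λ x i y → x :* i :* y := i :* (x :* y)) ≈-refl x (x ⁻¹) y ⟩
    x ⁻¹ * (x * y)       ≈⟨ *-zero-≈ʳ xy≈0 ⟩
    0#                   ∎

  *-≉0 : ∀ {x y} → x ≉ 0# → y ≉ 0# → x * y ≉ 0#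
  *-≉0 x≉0 y≉0 xy≈0 = y≉0 (x*y≈0⇒y≈0 x≉0 xy≈0)

  *-cancelˡ : ∀ {x y z} → x ≉ 0# → x * y ≈ x * z → y ≈ z
  *-cancelˡ {x} {y} {z} x≉0 h = x-y≈0⇒x≈y (x*y≈0⇒y≈0 x≉0 (begin
    x * (y - z)     ≈⟨ solve 3 (λ x y z → x :* (y :- z) := x :* y :- x :* z) ≈-refl x y z ⟩
    x * y - x * z   ≈⟨ x≈y⇒x-y≈0 h ⟩
    0#              ∎))

  ⁻¹-unique : ∀ {x y} → x * y ≈ 1# → x ⁻¹ ≈ y
  ⁻¹-unique {x} {y} h = *-cancelˡ x≉0 (≈-trans (*-inverse x≉0) (≈-sym h))
    where
    x≉0 : x ≉ 0#
    x≉0 x≈0 = 1≉0 (≈-trans (≈-sym h) (*-zero-≈ˡ x≈0))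

  neg-pos : ∀ {x} → x < 0# → 0# < - x
  neg-pos {x} x<0 = <-respˡ-≈ (-‿inverseˡ x) (<-respʳ-≈ (+-identityʳ _) (+-monoʳ-< (- x) x<0))

  x≉0⇒0<x² : ∀ {x} → x ≉ 0# → 0# < x * x
  x≉0⇒0<x² {x} x≉0 with compare x 0#
  ... | tri< x<0 _ _ = <-respʳ-≈ (solve 1 (λ x → (:- x) :* (:- x) := x :* x) ≈-refl x)
                         (*-pos (neg-pos x<0) (neg-pos x<0))
  ... | tri≈ _ x≈0 _ = ⊥-elim (x≉0 x≈0)
  ... | tri> _ _ 0<x = *-pos 0<x 0<x

  x≈1⇒x≉0 : ∀ {x} → x ≈ 1# → x ≉ 0#
  x≈1⇒x≉0 x≈1 x≈0 = 1≉0 (≈-trans (≈-sym x≈1) x≈0)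

  0<1 : 0# < 1#
  0<1 = <-respʳ-≈ (*-identityˡ 1#) (x≉0⇒0<x² 1≉0)

  0<x⇒x≉0 : ∀ {x} → 0# < x → x ≉ 0#
  0<x⇒x≉0 0<x x≈0 = <-irrefl (≈-sym x≈0) 0<x

  0<x⇒0≤x : ∀ {x} → 0# < x → 0# ≤ x
  0<x⇒0≤x = <-asym

  x≈0⇒0≤x : ∀ {x} → x ≈ 0# → 0# ≤ x
  x≈0⇒0≤x x≈0 = <-irrefl x≈0

  0≤x⇒0<x⊎x≈0 : ∀ {x} → 0# ≤ x → 0# < x ⊎ x ≈ 0#
  0≤x⇒0<x⊎x≈0 {x} 0≤x with compare x 0#
  ... | tri< x<0 _ _ = ⊥-elim (0≤x x<0)
  ... | tri≈ _ x≈0 _ = inj₂ x≈0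
  ... | tri> _ _ 0<x = inj₁ 0<x

  0≤x² : ∀ x → 0# ≤ x * x
  0≤x² x with x ≈? 0#
  ... | yes x≈0 = x≈0⇒0≤x (*-zero-≈ˡ x≈0)
  ... | no x≉0  = 0<x⇒0≤x (x≉0⇒0<x² x≉0)

  0≤-resp-≈ : ∀ {x y} → x ≈ y → 0# ≤ x → 0# ≤ y
  0≤-resp-≈ x≈y 0≤x y<0 = 0≤x (<-respˡ-≈ (≈-sym x≈y) y<0)

  0<x∧0≤y⇒0<x+y : ∀ {x y} → 0# < x → 0# ≤ y → 0# < x + y
  0<x∧0≤y⇒0<x+y {x} {y} 0<x 0≤y with 0≤x⇒0<x⊎x≈0 0≤y
  ... | inj₁ 0<y = <-trans 0<x (<-respˡ-≈ (+-identityʳ x) (+-monoʳ-< x 0<y))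
  ... | inj₂ y≈0 = <-respʳ-≈ (≈-trans (≈-sym (+-identityʳ x)) (+-congˡ (≈-sym y≈0))) 0<x

  0≤x∧0≤y⇒0≤x+y : ∀ {x y} → 0# ≤ x → 0# ≤ y → 0# ≤ x + y
  0≤x∧0≤y⇒0≤x+y {x} {y} 0≤x 0≤y with 0≤x⇒0<x⊎x≈0 0≤x
  ... | inj₁ 0<x = 0<x⇒0≤x (0<x∧0≤y⇒0<x+y 0<x 0≤y)
  ... | inj₂ x≈0 = 0≤-resp-≈ (≈-trans (≈-sym (+-identityˡ y)) (+-congʳ (≈-sym x≈0))) 0≤y

  0≤x∧0≤y⇒0≤x*y : ∀ {x y} → 0# ≤ x → 0# ≤ y → 0# ≤ x * y
  0≤x∧0≤y⇒0≤x*y 0≤x 0≤y with 0≤x⇒0<x⊎x≈0 0≤x | 0≤x⇒0<x⊎x≈0 0≤y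
  ... | inj₂ x≈0 | _        = x≈0⇒0≤x (*-zero-≈ˡ x≈0)
  ... | inj₁ _   | inj₂ y≈0 = x≈0⇒0≤x (*-zero-≈ʳ y≈0)
  ... | inj₁ 0<x | inj₁ 0<y = 0<x⇒0≤x (*-pos 0<x 0<y)

  x+y≈0⇒x≈0 : ∀ {x y} → 0# ≤ x → 0# ≤ y → x + y ≈ 0# → x ≈ 0#
  x+y≈0⇒x≈0 0≤x 0≤y h with 0≤x⇒0<x⊎x≈0 0≤x
  ... | inj₁ 0<x = ⊥-elim (0<x⇒x≉0 (0<x∧0≤y⇒0<x+y 0<x 0≤y) h)
  ... | inj₂ x≈0 = x≈0

  -- The inverse equals `x` times its own square, a product of positive factors.
  0<x⇒0<x⁻¹ : ∀ {x} → 0# < x → 0# < x ⁻¹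
  0<x⇒0<x⁻¹ {x} 0<x = <-respʳ-≈ (begin
      x * (x ⁻¹ * x ⁻¹)   ≈⟨ *-assoc _ _ _ ⟨
      x * x ⁻¹ * x ⁻¹     ≈⟨ *-congʳ (*-inverse (0<x⇒x≉0 0<x)) ⟩
      1# * x ⁻¹           ≈⟨ *-identityˡ _ ⟩
      x ⁻¹                ∎)
    (*-pos 0<x (x≉0⇒0<x² x⁻¹≉0))
    where
    x⁻¹≉0 : x ⁻¹ ≉ 0#
    x⁻¹≉0 h = 1≉0 (≈-trans (≈-sym (*-inverse (0<x⇒x≉0 0<x))) (*-zero-≈ʳ h))

  0<√ : ∀ {x} → 0# < x → 0# < √ x
  0<√ {x} 0<x with 0≤x⇒0<x⊎x≈0 (√-nonneg (0<x⇒0≤x 0<x))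
  ... | inj₁ 0<√x = 0<√x
  ... | inj₂ √x≈0 = ⊥-elim (0<x⇒x≉0 0<x (≈-trans (≈-sym (√-square (0<x⇒0≤x 0<x))) (*-zero-≈ˡ √x≈0)))

  -- The difference of the two sides times their sum is `x * y - x * y`, and the sum is positive, so
  -- the difference vanishes.
  √-* : ∀ {x y} → 0# < x → 0# < y → √ (x * y) ≈ √ x * √ y
  √-* {x} {y} 0<x 0<y = x-y≈0⇒x≈y (x*y≈0⇒y≈0 (0<x⇒x≉0 (0<x∧0≤y⇒0<x+y (0<√ 0<xy) (0<x⇒0≤x (*-pos (0<√ 0<x) (0<√ 0<y))))) (begin
    (√ (x * y) + √ x * √ y) * (√ (x * y) - √ x * √ y)
      ≈⟨ solve 3 (λ z x y → (z :+ x :* y) :* (z :- x :* y) := z :* z :- (x :* x) :* (y :* y)) ≈-refl _ _ _ ⟩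
    √ (x * y) * √ (x * y) - √ x * √ x * (√ y * √ y)
      ≈⟨ +-cong (√-square (0<x⇒0≤x 0<xy)) (-‿cong (*-cong (√-square (0<x⇒0≤x 0<x)) (√-square (0<x⇒0≤x 0<y)))) ⟩
    x * y - x * y
      ≈⟨ -‿inverseʳ _ ⟩
    0# ∎))
    where
    0<xy : 0# < x * y
    0<xy = *-pos 0<x 0<y

  0≤fromℕ : ∀ n → 0# ≤ fromℕ n
  0≤fromℕ zero    = <-irrefl ≈-refl
  0≤fromℕ (suc n) = 0<x⇒0≤x (0<x∧0≤y⇒0<x+y 0<1 (0≤fromℕ n))

  0<fromℕ : ∀ {n} → 0 ℕ.< n → 0# < fromℕ n
  0<fromℕ {suc n} _ = 0<x∧0≤y⇒0<x+y 0<1 (0≤fromℕ n)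

  fromℕ-+ : ∀ m n → fromℕ (m ℕ.+ n) ≈ fromℕ m + fromℕ n
  fromℕ-+ = ×-homo-+ 1#

  0≤fromℕ-∸ : ∀ {m n} → m ℕ.≤ n → 0# ≤ fromℕ n - fromℕ m
  0≤fromℕ-∸ {m} {n} m≤n = 0≤-resp-≈ (begin
    fromℕ (n ℕ.∸ m)                       ≈⟨ solve 2 (λ x y → x := x :+ y :- y) ≈-refl (fromℕ (n ℕ.∸ m)) (fromℕ m) ⟩
    fromℕ (n ℕ.∸ m) + fromℕ m - fromℕ m   ≈⟨ +-congʳ (fromℕ-+ (n ℕ.∸ m) m) ⟨
    fromℕ (n ℕ.∸ m ℕ.+ m) - fromℕ m       ≡⟨ ≡.cong (λ j → fromℕ j - fromℕ m) (ℕ.m∸n+n≡m m≤n) ⟩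
    fromℕ n - fromℕ m                     ∎) (0≤fromℕ (n ℕ.∸ m))

  -- An ordered field has characteristic zero: a successor is positive, hence not `0#`.
  fromℕ-injective : ∀ {m n} → fromℕ m ≈ fromℕ n → m ≡ n
  fromℕ-injective {zero}  {zero}  _ = ≡.refl
  fromℕ-injective {zero}  {suc n} h = ⊥-elim (0<x⇒x≉0 (0<fromℕ {suc n} (ℕ.s≤s ℕ.z≤n)) (≈-sym h))
  fromℕ-injective {suc m} {zero}  h = ⊥-elim (0<x⇒x≉0 (0<fromℕ {suc m} (ℕ.s≤s ℕ.z≤n)) h)
  fromℕ-injective {suc m} {suc n} h = ≡.cong suc (fromℕ-injective (x-y≈0⇒x≈y (begin
    fromℕ m - fromℕ n                 ≈⟨ solve 2 (λ x y → x :- y := (:1 :+ x) :- (:1 :+ y)) ≈-refl (fromℕ m) (fromℕ n) ⟩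
    fromℕ (suc m) - fromℕ (suc n)     ≈⟨ x≈y⇒x-y≈0 h ⟩
    0#                                ∎)))

  0≤sum : ∀ {n} {f : Fin n → ℝ} → (∀ i → 0# ≤ f i) → 0# ≤ sum f
  0≤sum {zero}  _   = <-irrefl ≈-refl
  0≤sum {suc n} 0≤f = 0≤x∧0≤y⇒0≤x+y (0≤f zero) (0≤sum (0≤f ∘ suc))

  sum≈0⇒≈0 : ∀ {n} {f : Fin n → ℝ} → (∀ i → 0# ≤ f i) → sum f ≈ 0# → ∀ i → f i ≈ 0#
  sum≈0⇒≈0 0≤f h zero    = x+y≈0⇒x≈0 (0≤f zero) (0≤sum (0≤f ∘ suc)) h
  sum≈0⇒≈0 0≤f h (suc i) = sum≈0⇒≈0 (0≤f ∘ suc)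
    (x+y≈0⇒x≈0 (0≤sum (0≤f ∘ suc)) (0≤f zero) (≈-trans (+-comm _ _) h)) i

  0<sum : ∀ {n} {f : Fin n → ℝ} → (∀ i → 0# < f i) → Fin n → 0# < sum f
  0<sum {suc n} 0<f _ = 0<x∧0≤y⇒0<x+y (0<f zero) (0≤sum λ i → 0<x⇒0≤x (0<f (suc i)))

  sum-zero : ∀ {n} {f : Fin n → ℝ} → (∀ i → f i ≈ 0#) → sum f ≈ 0#
  sum-zero {n} h = ≈-trans (sum-cong-≋ h) (sum-replicate-zero n)

  sum-lin : ∀ {n} c e (f g : Fin n → ℝ) →
            sum (λ i → c * f i + e * g i) ≈ c * sum f + e * sum g
  sum-lin c e f g = ≈-trans (∑-distrib-+ (λ i → c * f i) (λ i → e * g i))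
    (+-cong (≈-sym (*-distribˡ-sum c f)) (≈-sym (*-distribˡ-sum e g)))

  sum-const : ∀ {n} c → sum {n} (const c) ≈ fromℕ n * c
  sum-const {zero}  c = ≈-sym (zeroˡ c)
  sum-const {suc n} c = begin
    c + sum {n} (const c)   ≈⟨ +-congˡ (sum-const {n} c) ⟩
    c + fromℕ n * c         ≈⟨ solve 2 (λ x y → x :+ y :* x := (:1 :+ y) :* x) ≈-refl c (fromℕ n) ⟩
    fromℕ (suc n) * c       ∎

  -- Associativity of row vector times matrix times column vector; the content is the exchange of
  -- the two sums.
  sum-sum-assoc : ∀ {m n} (f : Fin m → ℝ) (h : Fin m → Fin n → ℝ) (g : Fin n → ℝ) →
    sum (λ i → f i * sum (λ j → h i j * g j)) ≈ sum (λ j → sum (λ i → f i * h i j) * g j)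
  sum-sum-assoc f h g = begin
    sum (λ i → f i * sum (λ j → h i j * g j))     ≈⟨ sum-cong-≋ (λ i → *-distribˡ-sum (f i) (λ j → h i j * g j)) ⟩
    sum (λ i → sum (λ j → f i * (h i j * g j)))   ≈⟨ ∑-comm (λ i j → f i * (h i j * g j)) ⟩
    sum (λ j → sum (λ i → f i * (h i j * g j)))   ≈⟨ sum-cong-≋ (λ j → sum-cong-≋ λ i → *-assoc (f i) (h i j) (g j)) ⟨
    sum (λ j → sum (λ i → f i * h i j * g j))     ≈⟨ sum-cong-≋ (λ j → *-distribʳ-sum (g j) (λ i → f i * h i j)) ⟨
    sum (λ j → sum (λ i → f i * h i j) * g j)     ∎

  sum-splitAt : ∀ m {n} (f : Fin m ⊎ Fin n → ℝ) →
                sum (f ∘ splitAt m) ≈ sum (f ∘ inj₁) + sum (f ∘ inj₂)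
  sum-splitAt zero    f = ≈-sym (+-identityˡ _)
  sum-splitAt (suc m) {n} f = ≈-trans (+-congˡ (≈-trans (sum-cong-≋ rest) (sum-splitAt m g))) (≈-sym (+-assoc _ _ _))
    where
    g : Fin m ⊎ Fin n → ℝ
    g (inj₁ i) = f (inj₁ (suc i))
    g (inj₂ j) = f (inj₂ j)

    rest : ∀ i → f (splitAt (suc m) (suc i)) ≈ g (splitAt m i)
    rest i with splitAt m i
    ... | inj₁ _ = ≈-refl
    ... | inj₂ _ = ≈-refl

  ι : Bool → ℝ
  ι true  = 1#
  ι false = 0#

  ι-∧ : ∀ p q → ι (p ∧ q) ≈ ι p * ι q
  ι-∧ true  q = ≈-sym (*-identityˡ _)
  ι-∧ false q = ≈-sym (zeroˡ _)

  0≤ι : ∀ p → 0# ≤ ι p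
  0≤ι true  = 0<x⇒0≤x 0<1
  0≤ι false = <-irrefl ≈-refl

  ι-idem : ∀ p → ι p * ι p ≈ ι p
  ι-idem true  = *-identityˡ 1#
  ι-idem false = zeroˡ 0#

  ∣∣≈sum : ∀ {n} (p : Subset n) → fromℕ ∣ p ∣ ≈ sum (λ i → ι (lookup p i))
  ∣∣≈sum []          = ≈-refl
  ∣∣≈sum (true ∷ p)  = +-congˡ (∣∣≈sum p)
  ∣∣≈sum (false ∷ p) = ≈-trans (∣∣≈sum p) (≈-sym (+-identityˡ _))

  ι-true : ∀ {P : Set} (P? : Dec P) → P → ι (does P?) ≈ 1#
  ι-true P? p = reflexive (≡.cong ι (dec-true P? p))

  ι-false : ∀ {P : Set} (P? : Dec P) → ¬ P → ι (does P?) ≈ 0#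
  ι-false P? ¬p = reflexive (≡.cong ι (dec-false P? ¬p))

  ∣tabulate∣≈sum : ∀ {n} (f : Fin n → Bool) → fromℕ ∣ tabulate f ∣ ≈ sum (λ i → ι (f i))
  ∣tabulate∣≈sum f = ≈-trans (∣∣≈sum (tabulate f))
    (sum-cong-≋ λ i → reflexive (≡.cong ι (lookup∘tabulate f i)))

  ∣∩∣≈sum : ∀ {n} (p q : Subset n) → fromℕ ∣ p ∩ q ∣ ≈ sum (λ i → ι (lookup p i) * ι (lookup q i))
  ∣∩∣≈sum p q = ≈-trans (∣∣≈sum (p ∩ q)) (sum-cong-≋ λ i →
    ≈-trans (reflexive (≡.cong ι (lookup-zipWith _∧_ i p q))) (ι-∧ (lookup p i) (lookup q i)))

  ∣tabulate∩tabulate∣≈sum : ∀ {n} (f g : Fin n → Bool) →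
    fromℕ ∣ tabulate f ∩ tabulate g ∣ ≈ sum (λ i → ι (f i) * ι (g i))
  ∣tabulate∩tabulate∣≈sum f g = ≈-trans (∣∩∣≈sum (tabulate f) (tabulate g)) (sum-cong-≋ λ i →
    *-cong (reflexive (≡.cong ι (lookup∘tabulate f i))) (reflexive (≡.cong ι (lookup∘tabulate g i))))

  does-∈? : ∀ {n} (i : Fin n) (p : Subset n) → does (i ∈? p) ≡ lookup p i
  does-∈? zero    (true ∷ p)  = ≡.refl
  does-∈? zero    (false ∷ p) = ≡.refl
  does-∈? (suc i) (_ ∷ p)     = does-∈? i p

  sum≉0⇒∃≉0 : ∀ {n} {f : Fin n → ℝ} → sum f ≉ 0# → ∃ λ i → f i ≉ 0#
  sum≉0⇒∃≉0 {f = f} h with any? (λ i → ¬? (f i ≈? 0#))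
  ... | yes i≉0 = i≉0
  ... | no ¬∃   = ⊥-elim (h (sum-zero λ i → decidable-stable (f i ≈? 0#) λ fi≉0 → ¬∃ (i , fi≉0)))

  -- The Kronecker delta, real-valued so that the identity matrix can take part in ring identities.
  κ : ∀ {n} → Fin n → Fin n → ℝ
  κ i j = ι (does (i ≟ j))

  sum-κ : ∀ {n} (i : Fin n) (f : Fin n → ℝ) → sum (λ j → κ i j * f j) ≈ f i
  sum-κ zero    f = ≈-trans (+-cong (*-identityˡ _) (sum-zero (λ j → zeroˡ (f (suc j))))) (+-identityʳ _)
  sum-κ (suc i) f = ≈-trans (+-cong (zeroˡ _) (sum-κ i (f ∘ suc))) (+-identityˡ _)

  κ-refl : ∀ {n} (i : Fin n) → κ i i ≈ 1#
  κ-refl i = ι-true (i ≟ i) ≡.refl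

  κ-≢ : ∀ {n} {i j : Fin n} → i ≢ j → κ i j ≈ 0#
  κ-≢ {i = i} {j} = ι-false (i ≟ j)

  κ-sym : ∀ {n} (i j : Fin n) → κ i j ≈ κ j i
  κ-sym i j with i ≟ j
  ... | yes ≡.refl = ≈-sym (κ-refl i)
  ... | no i≢j     = ≈-sym (κ-≢ (i≢j ∘ ≡.sym))

  -- The difference of the goal is a combination of the differences of the
  -- hypotheses, which leaves an identity for the ring solver.
  lc₁ : ∀ {x y c a b} → a ≈ b → x - y ≈ c * (a - b) → x ≈ y
  lc₁ h e = x-y≈0⇒x≈y (≈-trans e (*-zero-≈ʳ (x≈y⇒x-y≈0 h)))

  lc₂ : ∀ {x y c a b c′ a′ b′} → a ≈ b → a′ ≈ b′ →
        x - y ≈ c * (a - b) + c′ * (a′ - b′) → x ≈ y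
  lc₂ h h′ e = x-y≈0⇒x≈y (≈-trans e (≈-trans
    (+-cong (*-zero-≈ʳ (x≈y⇒x-y≈0 h)) (*-zero-≈ʳ (x≈y⇒x-y≈0 h′))) (+-identityˡ 0#)))

module OverReals (R : Reals) where
  open RealProperties R

  -- The operator `M` of a weighted graph and its inner product.

  record Weighting (n : ℕ) : Set where
    field
      α     : Fin n → Fin n → ℝ
      δ     : Fin n → ℝ
      α-sym : ∀ u w → α u w ≈ α w u
      0≤α   : ∀ u w → 0# ≤ α u w
      0<δ   : ∀ u → 0# < δ u
      α-row : ∀ u → sum (α u) ≈ δ u

  module WeightedGraph {n : ℕ} (W : Weighting n) where
    open Weighting W

    Vector : Set
    Vector = Fin n → ℝ

    infix 4 _≋_
    _≋_ : Vector → Vector → Set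
    f ≋ g = ∀ u → f u ≈ g u

    𝟎 𝟏 : Vector
    𝟎 = const 0#
    𝟏 = const 1#

    δ⁻¹ : Vector
    δ⁻¹ u = δ u ⁻¹

    δ*δ⁻¹≈1 : ∀ u → δ u * δ⁻¹ u ≈ 1#
    δ*δ⁻¹≈1 u = *-inverse (0<x⇒x≉0 (0<δ u))

    opaque
      M : Vector → Vector
      M f u = δ⁻¹ u * sum λ w → α u w * f w

    opaque
      unfolding M

      M-def : ∀ f u → M f u ≈ δ⁻¹ u * sum λ w → α u w * f w
      M-def f u = ≈-refl

      M-cong : ∀ {f g} → f ≋ g → M f ≋ M g
      M-cong f≋g u = *-congˡ (sum-cong-≋ λ w → *-congˡ (f≋g w))

      M-lin : ∀ c e f g → M (λ w → c * f w + e * g w) ≋ λ u → c * M f u + e * M g u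
      M-lin c e f g u = begin
        δ⁻¹ u * sum (λ w → α u w * (c * f w + e * g w))
          ≈⟨ *-congˡ (sum-cong-≋ λ w → solve 5 (λ a c e f g → a :* (c :* f :+ e :* g) := c :* (a :* f) :+ e :* (a :* g)) ≈-refl (α u w) c e (f w) (g w)) ⟩
        δ⁻¹ u * sum (λ w → c * (α u w * f w) + e * (α u w * g w))
          ≈⟨ *-congˡ (sum-lin c e (λ w → α u w * f w) (λ w → α u w * g w)) ⟩
        δ⁻¹ u * (c * sum (λ w → α u w * f w) + e * sum (λ w → α u w * g w))
          ≈⟨ solve 5 (λ i c e x y → i :* (c :* x :+ e :* y) := c :* (i :* x) :+ e :* (i :* y)) ≈-refl (δ⁻¹ u) c e _ _ ⟩
        c * M f u + e * M g u ∎

      M-𝟏 : M 𝟏 ≋ 𝟏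
      M-𝟏 u = begin
        δ⁻¹ u * sum (λ w → α u w * 1#)   ≈⟨ *-congˡ (≈-trans (sum-cong-≋ λ w → *-identityʳ (α u w)) (α-row u)) ⟩
        δ⁻¹ u * δ u                      ≈⟨ *-comm _ _ ⟩
        δ u * δ⁻¹ u                      ≈⟨ δ*δ⁻¹≈1 u ⟩
        1#                               ∎

    opaque
      Sh : ℝ → Vector → Vector
      Sh μ f u = M f u - μ * f u

    opaque
      unfolding Sh

      Sh-def : ∀ μ f u → Sh μ f u ≈ M f u - μ * f u
      Sh-def μ f u = ≈-refl

      Sh-congˡ : ∀ {μ ν f} → μ ≈ ν → Sh μ f ≋ Sh ν f
      Sh-congˡ μ≈ν u = +-congˡ (-‿cong (*-congʳ μ≈ν))

      Sh-cong : ∀ {μ f g} → f ≋ g → Sh μ f ≋ Sh μ g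
      Sh-cong f≋g u = +-cong (M-cong f≋g u) (-‿cong (*-congˡ (f≋g u)))

      Sh-lin : ∀ μ c e f g → Sh μ (λ w → c * f w + e * g w) ≋ λ u → c * Sh μ f u + e * Sh μ g u
      Sh-lin μ c e f g u = ≈-trans (+-congʳ (M-lin c e f g u))
        (solve 7 (λ μ c e x y f g → c :* x :+ e :* y :- μ :* (c :* f :+ e :* g) := c :* (x :- μ :* f) :+ e :* (y :- μ :* g))
          ≈-refl μ c e (M f u) (M g u) (f u) (g u))

    Sh-scale : ∀ μ c f → Sh μ (λ w → c * f w) ≋ λ u → c * Sh μ f u
    Sh-scale μ c f u = begin
      Sh μ (λ w → c * f w) u              ≈⟨ Sh-cong (λ w → solve 2 (λ c f → c :* f := c :* f :+ :0 :* f) ≈-refl c (f w)) u ⟩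
      Sh μ (λ w → c * f w + 0# * f w) u   ≈⟨ Sh-lin μ c 0# f f u ⟩
      c * Sh μ f u + 0# * Sh μ f u        ≈⟨ solve 2 (λ c x → c :* x :+ :0 :* x := c :* x) ≈-refl c (Sh μ f u) ⟩
      c * Sh μ f u                        ∎

    Sh-𝟎 : ∀ μ {f} → f ≋ 𝟎 → Sh μ f ≋ 𝟎
    Sh-𝟎 μ {f} f≋𝟎 u = begin
      Sh μ f u                  ≈⟨ Sh-cong (λ w → ≈-trans (f≋𝟎 w) (≈-sym (zeroˡ (f w)))) u ⟩
      Sh μ (λ w → 0# * f w) u   ≈⟨ Sh-scale μ 0# f u ⟩
      0# * Sh μ f u             ≈⟨ zeroˡ _ ⟩
      0#                        ∎

    opaque
      unfolding Sh

      Sh-Sh : ∀ μ ν f → Sh μ (Sh ν f) ≋ λ u → M (M f) u - (μ + ν) * M f u + μ * ν * f u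
      Sh-Sh μ ν f u = begin
        M (Sh ν f) u - μ * Sh ν f u
          ≈⟨ +-congʳ (M-cong (λ w → solve 3 (λ ν x f → x :- ν :* f := :1 :* x :+ (:- ν) :* f) ≈-refl ν (M f w) (f w)) u) ⟩
        M (λ w → 1# * M f w + - ν * f w) u - μ * Sh ν f u
          ≈⟨ +-congʳ (M-lin 1# (- ν) (M f) f u) ⟩
        1# * M (M f) u + - ν * M f u - μ * (M f u - ν * f u)
          ≈⟨ solve 5 (λ μ ν z x f → :1 :* z :+ (:- ν) :* x :- μ :* (x :- ν :* f) := z :- (μ :+ ν) :* x :+ μ :* ν :* f)
               ≈-refl μ ν (M (M f) u) (M f u) (f u) ⟩
        M (M f) u - (μ + ν) * M f u + μ * ν * f u ∎

    Sh-comm : ∀ μ ν f → Sh μ (Sh ν f) ≋ Sh ν (Sh μ f)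
    Sh-comm μ ν f u = begin
      Sh μ (Sh ν f) u                              ≈⟨ Sh-Sh μ ν f u ⟩
      M (M f) u - (μ + ν) * M f u + μ * ν * f u    ≈⟨ +-cong (+-congˡ (-‿cong (*-congʳ (+-comm μ ν)))) (*-congʳ (*-comm μ ν)) ⟩
      M (M f) u - (ν + μ) * M f u + ν * μ * f u    ≈⟨ Sh-Sh ν μ f u ⟨
      Sh ν (Sh μ f) u                              ∎

    opaque
      unfolding Sh

      Sh-eigen : ∀ {λ′ f} μ → M f ≋ (λ u → λ′ * f u) → Sh μ f ≋ λ u → (λ′ - μ) * f u
      Sh-eigen {λ′} {f} μ h u = ≈-trans (+-congʳ (h u))
        (solve 3 (λ l m f → l :* f :- m :* f := (l :- m) :* f) ≈-refl λ′ μ (f u))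

    Sh-Sh-eigen : ∀ {λ′ f} μ ν → M f ≋ (λ u → λ′ * f u) → Sh μ (Sh ν f) ≋ λ u → (λ′ - ν) * ((λ′ - μ) * f u)
    Sh-Sh-eigen {λ′} {f} μ ν h u = begin
      Sh μ (Sh ν f) u                    ≈⟨ Sh-cong (Sh-eigen ν h) u ⟩
      Sh μ (λ w → (λ′ - ν) * f w) u      ≈⟨ Sh-scale μ (λ′ - ν) f u ⟩
      (λ′ - ν) * Sh μ f u                ≈⟨ *-congˡ (Sh-eigen μ h u) ⟩
      (λ′ - ν) * ((λ′ - μ) * f u)        ∎

    opaque
      ⟪_,_⟫ : Vector → Vector → ℝ
      ⟪ f , g ⟫ = sum λ u → δ u * (f u * g u)

    opaque
      unfolding ⟪_,_⟫

      ⟪⟫-cong : ∀ {f f′ g g′} → f ≋ f′ → g ≋ g′ → ⟪ f , g ⟫ ≈ ⟪ f′ , g′ ⟫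
      ⟪⟫-cong h h′ = sum-cong-≋ λ u → *-congˡ (*-cong (h u) (h′ u))

      ⟪⟫-𝟎ʳ : ∀ f {g} → g ≋ 𝟎 → ⟪ f , g ⟫ ≈ 0#
      ⟪⟫-𝟎ʳ f g≋𝟎 = sum-zero λ u → *-zero-≈ʳ (*-zero-≈ʳ (g≋𝟎 u))

      ⟪⟫-sym : ∀ f g → ⟪ f , g ⟫ ≈ ⟪ g , f ⟫
      ⟪⟫-sym f g = sum-cong-≋ λ u → *-congˡ (*-comm (f u) (g u))

      ⟪⟫-linʳ : ∀ c e f g h → ⟪ f , (λ u → c * g u + e * h u) ⟫ ≈ c * ⟪ f , g ⟫ + e * ⟪ f , h ⟫
      ⟪⟫-linʳ c e f g h = ≈-trans
        (sum-cong-≋ λ u → solve 6 (λ d c e f g h → d :* (f :* (c :* g :+ e :* h)) := c :* (d :* (f :* g)) :+ e :* (d :* (f :* h)))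
          ≈-refl (δ u) c e (f u) (g u) (h u))
        (sum-lin c e (λ u → δ u * (f u * g u)) (λ u → δ u * (f u * h u)))

      ⟪⟫-scaleʳ : ∀ c f g → ⟪ f , (λ u → c * g u) ⟫ ≈ c * ⟪ f , g ⟫
      ⟪⟫-scaleʳ c f g = begin
        ⟪ f , (λ u → c * g u) ⟫              ≈⟨ sum-cong-≋ (λ u → solve 4 (λ d c f g → d :* (f :* (c :* g)) := c :* (d :* (f :* g))) ≈-refl (δ u) c (f u) (g u)) ⟩
        sum (λ u → c * (δ u * (f u * g u)))  ≈⟨ *-distribˡ-sum c (λ u → δ u * (f u * g u)) ⟨
        c * ⟪ f , g ⟫                        ∎

    opaque
      unfolding ⟪_,_⟫ M

      -- The weight `δ u` of the inner product cancels the `δ⁻¹ u` in `M`. What remains is the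
      -- bilinear form of `α`, so symmetry of `α` makes `M` self-adjoint.
      M-formʳ : ∀ f g → ⟪ f , M g ⟫ ≈ sum λ u → sum λ w → α u w * (f u * g w)
      M-formʳ f g = sum-cong-≋ λ u → begin
        δ u * (f u * (δ⁻¹ u * sum (λ w → α u w * g w)))
          ≈⟨ solve 4 (λ d f i s → d :* (f :* (i :* s)) := (d :* i) :* (f :* s)) ≈-refl (δ u) (f u) (δ⁻¹ u) _ ⟩
        δ u * δ⁻¹ u * (f u * sum (λ w → α u w * g w))
          ≈⟨ *-congʳ (δ*δ⁻¹≈1 u) ⟩
        1# * (f u * sum (λ w → α u w * g w))
          ≈⟨ *-identityˡ _ ⟩
        f u * sum (λ w → α u w * g w)
          ≈⟨ *-distribˡ-sum (f u) (λ w → α u w * g w) ⟩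
        sum (λ w → f u * (α u w * g w))
          ≈⟨ sum-cong-≋ (λ w → solve 3 (λ f a g → f :* (a :* g) := a :* (f :* g)) ≈-refl (f u) (α u w) (g w)) ⟩
        sum (λ w → α u w * (f u * g w)) ∎

    M-adjoint : ∀ f g → ⟪ M f , g ⟫ ≈ ⟪ f , M g ⟫
    M-adjoint f g = begin
      ⟪ M f , g ⟫                                       ≈⟨ ⟪⟫-sym (M f) g ⟩
      ⟪ g , M f ⟫                                       ≈⟨ M-formʳ g f ⟩
      sum (λ u → sum λ w → α u w * (g u * f w))         ≈⟨ ∑-comm (λ u w → α u w * (g u * f w)) ⟩
      sum (λ w → sum λ u → α u w * (g u * f w))         ≈⟨ sum-cong-≋ (λ w → sum-cong-≋ λ u → *-cong (α-sym u w) (*-comm (g u) (f w))) ⟩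
      sum (λ w → sum λ u → α w u * (f w * g u))         ≈⟨ M-formʳ f g ⟨
      ⟪ f , M g ⟫                                       ∎

    opaque
      unfolding Sh

      Sh-adjoint : ∀ μ f g → ⟪ Sh μ f , g ⟫ ≈ ⟪ f , Sh μ g ⟫
      Sh-adjoint μ f g = begin
        ⟪ Sh μ f , g ⟫                       ≈⟨ ⟪⟫-sym (Sh μ f) g ⟩
        ⟪ g , Sh μ f ⟫                       ≈⟨ expand g f ⟩
        1# * ⟪ g , M f ⟫ + - μ * ⟪ g , f ⟫   ≈⟨ +-cong (*-congˡ (≈-trans (⟪⟫-sym g (M f)) (M-adjoint f g))) (*-congˡ (⟪⟫-sym g f)) ⟩
        1# * ⟪ f , M g ⟫ + - μ * ⟪ f , g ⟫   ≈⟨ expand f g ⟨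
        ⟪ f , Sh μ g ⟫                       ∎
        where
        expand : ∀ f g → ⟪ f , Sh μ g ⟫ ≈ 1# * ⟪ f , M g ⟫ + - μ * ⟪ f , g ⟫
        expand f g = ≈-trans
          (⟪⟫-cong {f} (λ _ → ≈-refl) λ u → solve 3 (λ μ x g → x :- μ :* g := :1 :* x :+ (:- μ) :* g) ≈-refl μ (M g u) (g u))
          (⟪⟫-linʳ 1# (- μ) f (M g) g)

    opaque
      unfolding ⟪_,_⟫

      ⟪f,f⟫≈0⇒f≋𝟎 : ∀ {f} → ⟪ f , f ⟫ ≈ 0# → f ≋ 𝟎
      ⟪f,f⟫≈0⇒f≋𝟎 {f} h u with f u ≈? 0#
      ... | yes fu≈0 = fu≈0
      ... | no fu≉0  = ⊥-elim (*-≉0 (0<x⇒x≉0 (0<δ u)) (*-≉0 fu≉0 fu≉0)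
            (sum≈0⇒≈0 (λ w → 0≤x∧0≤y⇒0≤x*y (0<x⇒0≤x (0<δ w)) (0≤x² (f w))) h u))

    Sh≋𝟎⇒eigen : ∀ {μ f} → Sh μ f ≋ 𝟎 → M f ≋ λ u → μ * f u
    Sh≋𝟎⇒eigen {μ} {f} h u = x-y≈0⇒x≈y (≈-trans (≈-sym (Sh-def μ f u)) (h u))

    𝟎-or-nonzero : ∀ f → f ≋ 𝟎 ⊎ ∃ λ u → f u ≉ 0#
    𝟎-or-nonzero f with any? (λ u → ¬? (f u ≈? 0#))
    ... | yes nonzero = inj₂ nonzero
    ... | no ¬nonzero = inj₁ λ u → decidable-stable (f u ≈? 0#) λ fu≉0 → ¬nonzero (u , fu≉0)

    total : ℝ
    total = sum δ

    opaque
      unfolding ⟪_,_⟫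

      ⟪𝟏,f⟫ : ∀ f → ⟪ 𝟏 , f ⟫ ≈ sum λ u → δ u * f u
      ⟪𝟏,f⟫ f = sum-cong-≋ λ u → *-congˡ (*-identityˡ (f u))

    ⟪𝟏,𝟏⟫ : ⟪ 𝟏 , 𝟏 ⟫ ≈ total
    ⟪𝟏,𝟏⟫ = ≈-trans (⟪𝟏,f⟫ 𝟏) (sum-cong-≋ λ u → *-identityʳ (δ u))

    ⟪𝟏,M⟫ : ∀ f → ⟪ 𝟏 , M f ⟫ ≈ ⟪ 𝟏 , f ⟫
    ⟪𝟏,M⟫ f = ≈-trans (≈-sym (M-adjoint 𝟏 f)) (⟪⟫-cong {g = f} M-𝟏 (λ _ → ≈-refl))

    ⟪𝟏,Sh⟫ : ∀ μ f → ⟪ 𝟏 , Sh μ f ⟫ ≈ (1# - μ) * ⟪ 𝟏 , f ⟫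
    ⟪𝟏,Sh⟫ μ f = begin
      ⟪ 𝟏 , Sh μ f ⟫               ≈⟨ Sh-adjoint μ 𝟏 f ⟨
      ⟪ Sh μ 𝟏 , f ⟫               ≈⟨ ⟪⟫-sym (Sh μ 𝟏) f ⟩
      ⟪ f , Sh μ 𝟏 ⟫               ≈⟨ ⟪⟫-cong {f} (λ _ → ≈-refl) (Sh-eigen μ λ u → ≈-trans (M-𝟏 u) (≈-sym (*-identityˡ _))) ⟩
      ⟪ f , (λ _ → (1# - μ) * 1#) ⟫ ≈⟨ ⟪⟫-scaleʳ (1# - μ) f 𝟏 ⟩
      (1# - μ) * ⟪ f , 𝟏 ⟫         ≈⟨ *-congˡ (⟪⟫-sym f 𝟏) ⟩
      (1# - μ) * ⟪ 𝟏 , f ⟫         ∎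

    opaque
      unfolding ⟪_,_⟫

      -- The Dirichlet form, with every edge counted in both directions. Expanding the square gives
      -- a cross term and two diagonal terms; each of the latter is the norm of `f`, because the
      -- rows of `α`, and by symmetry its columns, sum to `δ`.
      energy : ∀ f → sum (λ u → sum λ w → α u w * ((f u - f w) * (f u - f w))) ≈ 2# * (⟪ f , f ⟫ - ⟪ f , M f ⟫)
      energy f = begin
        sum (λ u → sum λ w → α u w * ((f u - f w) * (f u - f w)))
          ≈⟨ sum-cong-≋ (λ u → ≈-trans (sum-cong-≋ λ w → solve 3 (λ a x y → a :* ((x :- y) :* (x :- y))
               := :1 :* (:1 :* (a :* (x :* x)) :+ :1 :* (a :* (y :* y))) :+ (:- :2) :* (a :* (x :* y))) ≈-refl (α u w) (f u) (f w))
               (sum-lin 1# (- 2#) _ (λ w → α u w * (f u * f w)))) ⟩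
        sum (λ u → 1# * sum (λ w → 1# * (α u w * (f u * f u)) + 1# * (α u w * (f w * f w))) + - 2# * sum (λ w → α u w * (f u * f w)))
          ≈⟨ sum-lin 1# (- 2#) _ (λ u → sum (λ w → α u w * (f u * f w))) ⟩
        1# * sum (λ u → sum (λ w → 1# * (α u w * (f u * f u)) + 1# * (α u w * (f w * f w)))) + - 2# * sum (λ u → sum (λ w → α u w * (f u * f w)))
          ≈⟨ +-cong (*-congˡ (≈-trans (sum-cong-≋ λ u → sum-lin 1# 1# (λ w → α u w * (f u * f u)) (λ w → α u w * (f w * f w)))
               (sum-lin 1# 1# (λ u → sum (λ w → α u w * (f u * f u))) (λ u → sum (λ w → α u w * (f w * f w))))))
             (*-congˡ (≈-sym (M-formʳ f f))) ⟩
        1# * (1# * sum (λ u → sum λ w → α u w * (f u * f u)) + 1# * sum (λ u → sum λ w → α u w * (f w * f w))) + - 2# * ⟪ f , M f ⟫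
          ≈⟨ +-congʳ (*-congˡ (+-cong (*-congˡ diag) (*-congˡ
               (≈-trans (∑-comm (λ u w → α u w * (f w * f w)))
               (≈-trans (sum-cong-≋ λ w → sum-cong-≋ λ u → *-congʳ (α-sym u w)) diag))))) ⟩
        1# * (1# * ⟪ f , f ⟫ + 1# * ⟪ f , f ⟫) + - 2# * ⟪ f , M f ⟫
          ≈⟨ solve 2 (λ x y → :1 :* (:1 :* x :+ :1 :* x) :+ (:- :2) :* y := :2 :* (x :- y)) ≈-refl ⟪ f , f ⟫ ⟪ f , M f ⟫ ⟩
        2# * (⟪ f , f ⟫ - ⟪ f , M f ⟫) ∎
        where
        diag : sum (λ u → sum λ w → α u w * (f u * f u)) ≈ ⟪ f , f ⟫
        diag = sum-cong-≋ λ u → ≈-trans (≈-sym (*-distribʳ-sum (f u * f u) (α u))) (*-congʳ (α-row u))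

    -- A fixed vector has energy zero, and the energy is a sum of nonnegative terms, one for each
    -- ordered pair of vertices.
    M-fixed⇒constant-along-edges : ∀ {f} → M f ≋ f → ∀ u w → α u w ≉ 0# → f u ≈ f w
    M-fixed⇒constant-along-edges {f} Mf≋f u w αuw≉0 with f u - f w ≈? 0#
    ... | yes h = x-y≈0⇒x≈y h
    ... | no h  = ⊥-elim (*-≉0 αuw≉0 (*-≉0 h h) (sum≈0⇒≈0 (λ w → nonneg u w)
          (sum≈0⇒≈0 (λ u → 0≤sum (nonneg u)) energy≈0 u) w))
      where
      nonneg : ∀ u w → 0# ≤ α u w * ((f u - f w) * (f u - f w))
      nonneg u w = 0≤x∧0≤y⇒0≤x*y (0≤α u w) (0≤x² _)

      energy≈0 = ≈-trans (energy f) (*-zero-≈ʳ (x≈y⇒x-y≈0 (⟪⟫-cong {f} (λ _ → ≈-refl) (λ u → ≈-sym (Mf≋f u)))))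

    -- (M − μ)(M − ν) = t 𝟏 δᵀ, in coordinates and multiplied by the row weight.
    QuadraticIdentity : ℝ → ℝ → ℝ → Set
    QuadraticIdentity μ ν t = ∀ u w →
      sum (λ z → α u z * (δ⁻¹ z * α z w)) - (μ + ν) * α u w + μ * ν * (δ u * κ u w) ≈ t * (δ u * δ w)

    indicator : Fin n → Vector
    indicator w u = κ w u

    opaque
      unfolding M

      M-indicator : ∀ w → M (indicator w) ≋ λ u → δ⁻¹ u * α u w
      M-indicator w u = *-congˡ (≈-trans (sum-cong-≋ λ z → *-comm (α u z) (κ w z)) (sum-κ w (α u)))

    -- Applied to `indicator w`, an operator yields its column `w`. This is the bridge between
    -- statements on operators and the coordinates of `QuadraticIdentity`.
    δ*Sh-Sh-indicator : ∀ μ ν w u → δ u * Sh μ (Sh ν (indicator w)) u ≈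
      sum (λ z → α u z * (δ⁻¹ z * α z w)) - (μ + ν) * α u w + μ * ν * (δ u * κ u w)
    δ*Sh-Sh-indicator μ ν w u = begin
      δ u * Sh μ (Sh ν (indicator w)) u
        ≈⟨ *-congˡ (Sh-Sh μ ν (indicator w) u) ⟩
      δ u * (M (M (indicator w)) u - (μ + ν) * M (indicator w) u + μ * ν * κ w u)
        ≈⟨ *-congˡ (+-cong (+-cong (≈-trans (M-cong (M-indicator w) u) (M-def (λ z → δ⁻¹ z * α z w) u)) (-‿cong (*-congˡ (M-indicator w u)))) (*-congˡ (κ-sym w u))) ⟩
      δ u * (δ⁻¹ u * S - (μ + ν) * (δ⁻¹ u * α u w) + μ * ν * κ u w)
        ≈⟨ lc₁ {c = S - (μ + ν) * α u w} (δ*δ⁻¹≈1 u)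
             (solve 7 (λ d i s m n a k → d :* (i :* s :- (m :+ n) :* (i :* a) :+ m :* n :* k) :- (s :- (m :+ n) :* a :+ m :* n :* (d :* k))
               := (s :- (m :+ n) :* a) :* (d :* i :- :1)) ≈-refl (δ u) (δ⁻¹ u) S μ ν (α u w) (κ u w)) ⟩
      S - (μ + ν) * α u w + μ * ν * (δ u * κ u w) ∎
      where S = sum (λ z → α u z * (δ⁻¹ z * α z w))

    ⟪𝟏,indicator⟫ : ∀ w → ⟪ 𝟏 , indicator w ⟫ ≈ δ w
    ⟪𝟏,indicator⟫ w = ≈-trans (⟪𝟏,f⟫ (indicator w)) (≈-trans (sum-cong-≋ λ z → *-comm (δ z) (κ w z)) (sum-κ w δ))

    -- Two vertices of different weight with a common neighbour w give a vector
    -- orthogonal to 𝟏 whose every shift is nonzero at w.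
    balanced : Fin n → Fin n → Vector
    balanced u₁ u₂ z = δ⁻¹ u₁ * indicator u₁ z + - δ⁻¹ u₂ * indicator u₂ z

    ⟪𝟏,balanced⟫≈0 : ∀ u₁ u₂ → ⟪ 𝟏 , balanced u₁ u₂ ⟫ ≈ 0#
    ⟪𝟏,balanced⟫≈0 u₁ u₂ = begin
      ⟪ 𝟏 , balanced u₁ u₂ ⟫
        ≈⟨ ⟪⟫-linʳ (δ⁻¹ u₁) (- δ⁻¹ u₂) 𝟏 (indicator u₁) (indicator u₂) ⟩
      δ⁻¹ u₁ * ⟪ 𝟏 , indicator u₁ ⟫ + - δ⁻¹ u₂ * ⟪ 𝟏 , indicator u₂ ⟫
        ≈⟨ +-cong (*-congˡ (⟪𝟏,indicator⟫ u₁)) (*-congˡ (⟪𝟏,indicator⟫ u₂)) ⟩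
      δ⁻¹ u₁ * δ u₁ + - δ⁻¹ u₂ * δ u₂
        ≈⟨ lc₂ {c = 1#} {c′ = - 1#} (δ*δ⁻¹≈1 u₁) (δ*δ⁻¹≈1 u₂)
             (solve 4 (λ i d j e → i :* d :+ (:- j) :* e :- :0 := :1 :* (d :* i :- :1) :+ (:- :1) :* (e :* j :- :1))
               ≈-refl (δ⁻¹ u₁) (δ u₁) (δ⁻¹ u₂) (δ u₂)) ⟩
      0# ∎

    -- Both indicators vanish at `w`, so `μ` drops out there and the value is
    -- `δ⁻¹ w * (δ⁻¹ u₁ - δ⁻¹ u₂)`.
    Sh-balanced≉0 : ∀ {u₁ u₂ w} → u₁ ≢ w → u₂ ≢ w → α w u₁ ≈ 1# → α w u₂ ≈ 1# → δ u₁ ≉ δ u₂ →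
                    ∀ μ → Sh μ (balanced u₁ u₂) w ≉ 0#
    Sh-balanced≉0 {u₁} {u₂} {w} u₁≢w u₂≢w αwu₁ αwu₂ δu₁≉δu₂ μ h = δu₁≉δu₂ (lc₂ {c = - δ u₁} {c′ = δ u₂} (δ*δ⁻¹≈1 u₂) (δ*δ⁻¹≈1 u₁)
      (≈-trans (solve 4 (λ d i e j → d :- e := (:- d) :* (e :* j :- :1) :+ e :* (d :* i :- :1) :+ (:- (d :* e)) :* (i :- j))
        ≈-refl (δ u₁) (δ⁻¹ u₁) (δ u₂) (δ⁻¹ u₂)) (≈-trans (+-congˡ (*-zero-≈ʳ δ⁻¹-≈)) (+-identityʳ _))))
      where
      at-w : ∀ {u} → u ≢ w → α w u ≈ 1# → Sh μ (indicator u) w ≈ δ⁻¹ w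
      at-w {u} u≢w αwu = begin
        Sh μ (indicator u) w                ≈⟨ Sh-def μ (indicator u) w ⟩
        M (indicator u) w - μ * κ u w       ≈⟨ +-cong (M-indicator u w) (-‿cong (*-congˡ (κ-≢ u≢w))) ⟩
        δ⁻¹ w * α w u - μ * 0#              ≈⟨ +-congʳ (*-congˡ αwu) ⟩
        δ⁻¹ w * 1# - μ * 0#                 ≈⟨ solve 2 (λ i m → i :* :1 :- m :* :0 := i) ≈-refl (δ⁻¹ w) μ ⟩
        δ⁻¹ w                               ∎

      δ⁻¹-≈ : δ⁻¹ u₁ - δ⁻¹ u₂ ≈ 0#
      δ⁻¹-≈ = x*y≈0⇒y≈0 (0<x⇒x≉0 (0<x⇒0<x⁻¹ (0<δ w))) (begin
        δ⁻¹ w * (δ⁻¹ u₁ - δ⁻¹ u₂)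
          ≈⟨ solve 3 (λ w i j → w :* (i :- j) := i :* w :+ (:- j) :* w) ≈-refl (δ⁻¹ w) (δ⁻¹ u₁) (δ⁻¹ u₂) ⟩
        δ⁻¹ u₁ * δ⁻¹ w + - δ⁻¹ u₂ * δ⁻¹ w
          ≈⟨ +-cong (*-congˡ (at-w u₁≢w αwu₁)) (*-congˡ (at-w u₂≢w αwu₂)) ⟨
        δ⁻¹ u₁ * Sh μ (indicator u₁) w + - δ⁻¹ u₂ * Sh μ (indicator u₂) w
          ≈⟨ Sh-lin μ (δ⁻¹ u₁) (- δ⁻¹ u₂) (indicator u₁) (indicator u₂) w ⟨
        Sh μ (balanced u₁ u₂) w
          ≈⟨ h ⟩
        0# ∎)

    IsM-Eigenvalue : ℝ → Set
    IsM-Eigenvalue μ = ∃ λ (f : Vector) → (∃ λ u → f u ≉ 0#) × M f ≋ λ u → μ * f u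

    IsM-Eigenvalue-resp : ∀ {p q} → p ≈ q → IsM-Eigenvalue p → IsM-Eigenvalue q
    IsM-Eigenvalue-resp p≈q (f , nz , h) = f , nz , λ u → ≈-trans (h u) (*-congʳ p≈q)

    -- From the spectrum to the quadratic identity.

    module FromSpectrum (μ ν : ℝ)
      (spectrum : ∀ λ′ → IsM-Eigenvalue λ′ → λ′ ≈ 1# ⊎ λ′ ≈ μ ⊎ λ′ ≈ ν)
      where

      K : Vector → Vector
      K f = Sh 1# (Sh μ (Sh ν f))

      -- The factors stand in the order opposite to `K`, which is how they appear in `Killed-unSh`
      -- after being moved across the inner product one by one.
      K-eigen : ∀ {λ′ f} → M f ≋ (λ u → λ′ * f u) → Sh ν (Sh μ (Sh 1# f)) ≋ λ u → (λ′ - 1#) * ((λ′ - μ) * ((λ′ - ν) * f u))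
      K-eigen {λ′} {f} h u = begin
        Sh ν (Sh μ (Sh 1# f)) u                         ≈⟨ Sh-cong (Sh-Sh-eigen μ 1# h) u ⟩
        Sh ν (λ w → (λ′ - 1#) * ((λ′ - μ) * f w)) u     ≈⟨ Sh-scale ν (λ′ - 1#) (λ w → (λ′ - μ) * f w) u ⟩
        (λ′ - 1#) * Sh ν (λ w → (λ′ - μ) * f w) u       ≈⟨ *-congˡ (Sh-scale ν (λ′ - μ) f u) ⟩
        (λ′ - 1#) * ((λ′ - μ) * Sh ν f u)               ≈⟨ *-congˡ (*-congˡ (Sh-eigen ν h u)) ⟩
        (λ′ - 1#) * ((λ′ - μ) * ((λ′ - ν) * f u))       ∎

      -- The kernel of `K`: an `M`-invariant subspace which, by `Killed-unSh`, also contains every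
      -- preimage of its members under a shift of `M`.
      Killed : Vector → Set
      Killed f = K f ≋ 𝟎

      K-lin : ∀ c e f g → K (λ u → c * f u + e * g u) ≋ λ u → c * K f u + e * K g u
      K-lin c e f g u = begin
        K (λ w → c * f w + e * g w) u
          ≈⟨ Sh-cong (Sh-cong (Sh-lin ν c e f g)) u ⟩
        Sh 1# (Sh μ (λ w → c * Sh ν f w + e * Sh ν g w)) u
          ≈⟨ Sh-cong (Sh-lin μ c e (Sh ν f) (Sh ν g)) u ⟩
        Sh 1# (λ w → c * Sh μ (Sh ν f) w + e * Sh μ (Sh ν g) w) u
          ≈⟨ Sh-lin 1# c e (Sh μ (Sh ν f)) (Sh μ (Sh ν g)) u ⟩
        c * K f u + e * K g u ∎

      K-Sh : ∀ λ′ f → K (Sh λ′ f) ≋ Sh λ′ (K f)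
      K-Sh λ′ f u = begin
        Sh 1# (Sh μ (Sh ν (Sh λ′ f))) u   ≈⟨ Sh-cong (Sh-cong (Sh-comm ν λ′ f)) u ⟩
        Sh 1# (Sh μ (Sh λ′ (Sh ν f))) u   ≈⟨ Sh-cong (Sh-comm μ λ′ (Sh ν f)) u ⟩
        Sh 1# (Sh λ′ (Sh μ (Sh ν f))) u   ≈⟨ Sh-comm 1# λ′ (Sh μ (Sh ν f)) u ⟩
        Sh λ′ (K f) u                     ∎

      Killed-cong : ∀ {f g} → f ≋ g → Killed f → Killed g
      Killed-cong f≋g Kf u = ≈-trans (Sh-cong (Sh-cong (Sh-cong (λ w → ≈-sym (f≋g w)))) u) (Kf u)

      Killed-lin : ∀ c e {f g} → Killed f → Killed g → Killed λ u → c * f u + e * g u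
      Killed-lin c e {f} {g} Kf Kg u = ≈-trans (K-lin c e f g u)
        (≈-trans (+-cong (*-zero-≈ʳ (Kf u)) (*-zero-≈ʳ (Kg u))) (+-identityˡ 0#))

      Killed-Sh : ∀ λ′ {f} → Killed f → Killed (Sh λ′ f)
      Killed-Sh λ′ {f} Kf u = ≈-trans (K-Sh λ′ f u) (Sh-𝟎 λ′ Kf u)

      -- K f is zero or an eigenvector for λ′; in the second case λ′ is a root of
      -- K, so K (K f) = 0, and K f = 0 as K is self-adjoint.
      Killed-unSh : ∀ λ′ {f} → Killed (Sh λ′ f) → Killed f
      Killed-unSh λ′ {f} KSh with 𝟎-or-nonzero (K f)
      ... | inj₁ Kf≋𝟎    = Kf≋𝟎
      ... | inj₂ nonzero = ⟪f,f⟫≈0⇒f≋𝟎 (begin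
        ⟪ K f , K f ⟫                          ≈⟨ Sh-adjoint 1# (Sh μ (Sh ν f)) (K f) ⟩
        ⟪ Sh μ (Sh ν f) , Sh 1# (K f) ⟫        ≈⟨ Sh-adjoint μ (Sh ν f) (Sh 1# (K f)) ⟩
        ⟪ Sh ν f , Sh μ (Sh 1# (K f)) ⟫        ≈⟨ Sh-adjoint ν f (Sh μ (Sh 1# (K f))) ⟩
        ⟪ f , Sh ν (Sh μ (Sh 1# (K f))) ⟫      ≈⟨ ⟪⟫-𝟎ʳ f (λ u → ≈-trans (K-eigen eigen u) (root u)) ⟩
        0#                                     ∎)
        where
        eigen : M (K f) ≋ λ u → λ′ * K f u
        eigen = Sh≋𝟎⇒eigen λ u → ≈-trans (≈-sym (K-Sh λ′ f u)) (KSh u)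

        root : ∀ u → (λ′ - 1#) * ((λ′ - μ) * ((λ′ - ν) * K f u)) ≈ 0#
        root u with spectrum λ′ (K f , nonzero , eigen)
        ... | inj₁ h        = *-zero-≈ˡ (x≈y⇒x-y≈0 h)
        ... | inj₂ (inj₁ h) = *-zero-≈ʳ (*-zero-≈ˡ (x≈y⇒x-y≈0 h))
        ... | inj₂ (inj₂ h) = *-zero-≈ʳ (*-zero-≈ʳ (*-zero-≈ˡ (x≈y⇒x-y≈0 h)))

      -- `Killed-unSh` removes real linear factors only. The nonnegative discriminant supplies the
      -- real square root in the quadratic formula, and the two factors are then removed in turn.
      Killed-quadratic : ∀ {p q f} → 0# ≤ p * p - 2# * 2# * q →
        Killed (λ u → M (M f) u - p * M f u + q * f u) → Killed f
      Killed-quadratic {p} {q} {f} 0≤Δ h = Killed-unSh s (Killed-unSh r (Killed-cong (λ u → ≈-sym (begin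
          Sh r (Sh s f) u                             ≈⟨ Sh-Sh r s f u ⟩
          M (M f) u - (r + s) * M f u + r * s * f u   ≈⟨ +-cong (+-congˡ (-‿cong (*-congʳ r+s))) (*-congʳ rs) ⟩
          M (M f) u - p * M f u + q * f u             ∎)) h))
        where
        h2 = 2# ⁻¹
        D = √ (p * p - 2# * 2# * q)
        r = h2 * (p + D)
        s = h2 * (p - D)
        half : 2# * h2 ≈ 1#
        half = *-inverse (0<x⇒x≉0 (0<fromℕ {2} (ℕ.s≤s ℕ.z≤n)))
        r+s : r + s ≈ p
        r+s = lc₁ {c = p} half (solve 3 (λ h p d → h :* (p :+ d) :+ h :* (p :- d) :- p := p :* (:2 :* h :- :1)) ≈-refl h2 p D)
        -- Replacing `D * D` leaves the error `(4 * h2 * h2 - 1) * q`, and 4h² - 1 = (2h + 1)(2h -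
        -- 1) explains the coefficient of `half`.
        rs : r * s ≈ q
        rs = lc₂ {c = - (h2 * h2)} {c′ = q * (2# * h2 + 1#)} (√-square 0≤Δ) half
          (solve 4 (λ h p d q → h :* (p :+ d) :* (h :* (p :- d)) :- q
            := (:- (h :* h)) :* (d :* d :- (p :* p :- :2 :* :2 :* q)) :+ q :* (:2 :* h :+ :1) :* (:2 :* h :- :1)) ≈-refl h2 p D q)

      -- Cayley-Hamilton modulo killed vectors: `M` acts on the span of `f` and `g` by the 2×2
      -- matrix with diagonal `a`, `e` and off-diagonal entries `b`, `c`. Its discriminant is (a -
      -- e)² + 4bc, so `0# ≤ b * c` makes both roots real.
      Killed-plane : ∀ {a b c e f g} → 0# ≤ b * c →
        Killed (λ u → Sh a f u - b * g u) → Killed (λ u → Sh e g u - c * f u) → Killed f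
      Killed-plane {a} {b} {c} {e} {f} {g} 0≤bc X Y = Killed-quadratic {a + e} {a * e - b * c}
        (0≤-resp-≈ (solve 3 (λ a e m → (a :- e) :* (a :- e) :+ :2 :* :2 :* m := (a :+ e) :* (a :+ e) :- :2 :* :2 :* (a :* e :- m)) ≈-refl a e (b * c))
          (0≤x∧0≤y⇒0≤x+y (0≤x² (a - e)) (0≤x∧0≤y⇒0≤x*y (0≤x∧0≤y⇒0≤x*y (0≤fromℕ 2) (0≤fromℕ 2)) 0≤bc)))
        -- Apply `Sh e` to the first relation and add `b` times the second: the terms with `Sh e g`
        -- cancel, and the characteristic polynomial applied to `f` remains.
        (Killed-cong (λ u → begin
          1# * Sh e (λ w → Sh a f w - b * g w) u + b * (Sh e g u - c * f u)
            ≈⟨ +-congʳ (*-congˡ (≈-trans (Sh-cong (λ w → solve 3 (λ x b g → x :- b :* g := :1 :* x :+ (:- b) :* g) ≈-refl (Sh a f w) b (g w)) u)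
                 (Sh-lin e 1# (- b) (Sh a f) g u))) ⟩
          1# * (1# * Sh e (Sh a f) u + - b * Sh e g u) + b * (Sh e g u - c * f u)
            ≈⟨ +-congʳ (*-congˡ (+-congʳ (*-congˡ (Sh-Sh e a f u)))) ⟩
          1# * (1# * (M (M f) u - (e + a) * M f u + e * a * f u) + - b * Sh e g u) + b * (Sh e g u - c * f u)
            ≈⟨ solve 8 (λ a b c e m n f s → :1 :* (:1 :* (m :- (e :+ a) :* n :+ e :* a :* f) :+ (:- b) :* s) :+ b :* (s :- c :* f)
                 := m :- (a :+ e) :* n :+ (a :* e :- b :* c) :* f) ≈-refl a b c e (M (M f) u) (M f u) (f u) (Sh e g u) ⟩
          M (M f) u - (a + e) * M f u + (a * e - b * c) * f u ∎)
        (Killed-lin 1# b (Killed-Sh e X) Y))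

      quadraticIdentity : 0# < total → (∀ f → Killed f) →
        (∀ {f} → (∀ u w → α u w ≉ 0# → f u ≈ f w) → ∀ u w → f u ≈ f w) →
        QuadraticIdentity μ ν ((1# - μ) * (1# - ν) / total)
      quadraticIdentity 0<total killed connected u w = ≈-trans (≈-sym (δ*Sh-Sh-indicator μ ν w u)) (begin
        δ u * q u                                          ≈⟨ lc₂ {c = δ u * total ⁻¹} {c′ = - (δ u * q u)} avg (*-inverse (0<x⇒x≉0 0<total))
               (solve 6 (λ d q c w t i → d :* q :- c :* i :* (d :* w) := d :* i :* (q :* t :- c :* w) :+ (:- (d :* q)) :* (t :* i :- :1))
                 ≈-refl (δ u) (q u) ((1# - μ) * (1# - ν)) (δ w) total (total ⁻¹)) ⟩
        (1# - μ) * (1# - ν) / total * (δ u * δ w)          ∎)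
        where
        q = Sh μ (Sh ν (indicator w))

        q-constant : ∀ u w → q u ≈ q w
        q-constant = connected {q} (M-fixed⇒constant-along-edges λ u →
          ≈-trans (Sh≋𝟎⇒eigen (killed (indicator w)) u) (*-identityˡ (q u)))

        -- The constant value of `q` is found by pairing with `𝟏`, where each shift acts as a
        -- scalar. With 1 - μ = θ₁ and 1 - ν = θ₂ this is the origin of the formula for t.
        avg : q u * total ≈ (1# - μ) * (1# - ν) * δ w
        avg = begin
          q u * total                                    ≈⟨ *-congˡ ⟪𝟏,𝟏⟫ ⟨
          q u * ⟪ 𝟏 , 𝟏 ⟫                                ≈⟨ ⟪⟫-scaleʳ (q u) 𝟏 𝟏 ⟨
          ⟪ 𝟏 , (λ _ → q u * 1#) ⟫                       ≈⟨ ⟪⟫-cong {𝟏} (λ _ → ≈-refl) (λ z → ≈-trans (*-identityʳ _) (q-constant u z)) ⟩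
          ⟪ 𝟏 , q ⟫                                      ≈⟨ ⟪𝟏,Sh⟫ μ (Sh ν (indicator w)) ⟩
          (1# - μ) * ⟪ 𝟏 , Sh ν (indicator w) ⟫          ≈⟨ *-congˡ (⟪𝟏,Sh⟫ ν (indicator w)) ⟩
          (1# - μ) * ((1# - ν) * ⟪ 𝟏 , indicator w ⟫)    ≈⟨ *-assoc _ _ _ ⟨
          (1# - μ) * (1# - ν) * ⟪ 𝟏 , indicator w ⟫      ≈⟨ *-congˡ (⟪𝟏,indicator⟫ w) ⟩
          (1# - μ) * (1# - ν) * δ w                      ∎

    -- From the quadratic identity to the spectrum.

    module FromQuadraticIdentity (μ ν t : ℝ) (identity : QuadraticIdentity μ ν t)
      where

      private
        α² : Fin n → Fin n → ℝ
        α² u w = sum λ z → α u z * (δ⁻¹ z * α z w)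

        δ*M : ∀ f u → δ u * M f u ≈ sum λ w → α u w * f w
        δ*M f u = ≈-trans (*-congˡ (M-def f u))
          (≈-trans (≈-sym (*-assoc _ _ _)) (≈-trans (*-congʳ (δ*δ⁻¹≈1 u)) (*-identityˡ _)))

        δ*MM : ∀ f u → δ u * M (M f) u ≈ sum λ w → α² u w * f w
        δ*MM f u = begin
          δ u * M (M f) u
            ≈⟨ δ*M (M f) u ⟩
          sum (λ z → α u z * M f z)
            ≈⟨ sum-cong-≋ (λ z → *-congˡ (M-def f z)) ⟩
          sum (λ z → α u z * (δ⁻¹ z * sum (λ w → α z w * f w)))
            ≈⟨ sum-cong-≋ (λ z → *-assoc (α u z) (δ⁻¹ z) _) ⟨
          sum (λ z → α u z * δ⁻¹ z * sum (λ w → α z w * f w))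
            ≈⟨ sum-sum-assoc (λ z → α u z * δ⁻¹ z) α f ⟩
          sum (λ w → sum (λ z → α u z * δ⁻¹ z * α z w) * f w)
            ≈⟨ sum-cong-≋ (λ w → *-congʳ (sum-cong-≋ λ z → *-assoc (α u z) (δ⁻¹ z) (α z w))) ⟩
          sum (λ w → α² u w * f w) ∎

      -- The hypothesis `identity` gives the matrix entries; summing row `u` against `f` turns it
      -- into a statement on operators, with the common factor `δ u` cancelled at the end.
      Sh-Sh≈t⟪𝟏,f⟫ : ∀ f u → Sh μ (Sh ν f) u ≈ t * ⟪ 𝟏 , f ⟫
      Sh-Sh≈t⟪𝟏,f⟫ f u = *-cancelˡ (0<x⇒x≉0 (0<δ u)) (begin
        δ u * Sh μ (Sh ν f) u
          ≈⟨ *-congˡ (Sh-Sh μ ν f u) ⟩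
        δ u * (M (M f) u - (μ + ν) * M f u + μ * ν * f u)
          ≈⟨ solve 6 (λ d x y f m n → d :* (x :- (m :+ n) :* y :+ m :* n :* f)
               := :1 :* (:1 :* (d :* x) :+ (:- (m :+ n)) :* (d :* y)) :+ m :* n :* (d :* f)) ≈-refl (δ u) (M (M f) u) (M f u) (f u) μ ν ⟩
        1# * (1# * (δ u * M (M f) u) + - (μ + ν) * (δ u * M f u)) + μ * ν * (δ u * f u)
          ≈⟨ +-cong (*-congˡ (+-cong (*-congˡ (δ*MM f u)) (*-congˡ (δ*M f u)))) (*-congˡ (*-congˡ (≈-sym (sum-κ u f)))) ⟩
        1# * (1# * sum (λ w → α² u w * f w) + - (μ + ν) * sum (λ w → α u w * f w)) + μ * ν * (δ u * sum (λ w → κ u w * f w))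
          ≈⟨ +-cong (*-congˡ (≈-sym (sum-lin 1# (- (μ + ν)) (λ w → α² u w * f w) (λ w → α u w * f w))))
                    (*-congˡ (*-distribˡ-sum (δ u) (λ w → κ u w * f w))) ⟩
        1# * sum (λ w → 1# * (α² u w * f w) + - (μ + ν) * (α u w * f w)) + μ * ν * sum (λ w → δ u * (κ u w * f w))
          ≈⟨ sum-lin 1# (μ * ν) (λ w → 1# * (α² u w * f w) + - (μ + ν) * (α u w * f w)) (λ w → δ u * (κ u w * f w)) ⟨
        sum (λ w → 1# * (1# * (α² u w * f w) + - (μ + ν) * (α u w * f w)) + μ * ν * (δ u * (κ u w * f w)))
          ≈⟨ sum-cong-≋ (λ w → ≈-trans (solve 7 (λ s a d k f m n → :1 :* (:1 :* (s :* f) :+ (:- (m :+ n)) :* (a :* f)) :+ m :* n :* (d :* (k :* f))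
               := (s :- (m :+ n) :* a :+ m :* n :* (d :* k)) :* f) ≈-refl (α² u w) (α u w) (δ u) (κ u w) (f w) μ ν)
               (≈-trans (*-congʳ (identity u w)) (solve 4 (λ t d e f → t :* (d :* e) :* f := d :* t :* (e :* f)) ≈-refl t (δ u) (δ w) (f w)))) ⟩
        sum (λ w → δ u * t * (δ w * f w))
          ≈⟨ *-distribˡ-sum (δ u * t) (λ w → δ w * f w) ⟨
        δ u * t * sum (λ w → δ w * f w)
          ≈⟨ ≈-trans (*-congˡ (≈-sym (⟪𝟏,f⟫ f))) (*-assoc _ _ _) ⟩
        δ u * (t * ⟪ 𝟏 , f ⟫) ∎)

      module _ (u₀ : Fin n) (g : Vector) (⟪𝟏,g⟫≈0 : ⟪ 𝟏 , g ⟫ ≈ 0#)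
        (g-generic : ∀ μ → ∃ λ u → Sh μ g u ≉ 0#) where

        private
          killed : Sh μ (Sh ν g) ≋ 𝟎
          killed u = ≈-trans (Sh-Sh≈t⟪𝟏,f⟫ g u) (*-zero-≈ʳ ⟪𝟏,g⟫≈0)

        𝟏-eigenvalue : IsM-Eigenvalue 1#
        𝟏-eigenvalue = 𝟏 , (u₀ , 1≉0) , λ u → ≈-trans (M-𝟏 u) (≈-sym (*-identityˡ 1#))

        -- `Sh ν g` is nonzero by genericity, and the remaining factor `Sh μ` kills it.
        μ-eigenvalue : IsM-Eigenvalue μ
        μ-eigenvalue = Sh ν g , g-generic ν , Sh≋𝟎⇒eigen killed

        ν-eigenvalue : IsM-Eigenvalue ν
        ν-eigenvalue = Sh μ g , g-generic μ , Sh≋𝟎⇒eigen λ u → ≈-trans (Sh-comm ν μ g u) (killed u)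

        -- A double root would give (M - ν)² g = 0, and a self-adjoint operator whose square kills
        -- `g` already kills `g`, against genericity.
        μ≉ν : μ ≉ ν
        μ≉ν μ≈ν with g-generic ν
        ... | u , h = h (⟪f,f⟫≈0⇒f≋𝟎 (begin
          ⟪ Sh ν g , Sh ν g ⟫     ≈⟨ Sh-adjoint ν g (Sh ν g) ⟩
          ⟪ g , Sh ν (Sh ν g) ⟫   ≈⟨ ⟪⟫-𝟎ʳ g (λ w → ≈-trans (Sh-congˡ (≈-sym μ≈ν) w) (killed w)) ⟩
          0#                      ∎) u)

        M-spectrum : ∀ λ′ → IsM-Eigenvalue λ′ ⇔ (λ′ ≈ 1# ⊎ λ′ ≈ μ ⊎ λ′ ≈ ν)
        M-spectrum λ′ = mk⇔ to from
          where
          from : λ′ ≈ 1# ⊎ λ′ ≈ μ ⊎ λ′ ≈ ν → IsM-Eigenvalue λ′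
          from (inj₁ h)        = IsM-Eigenvalue-resp (≈-sym h) 𝟏-eigenvalue
          from (inj₂ (inj₁ h)) = IsM-Eigenvalue-resp (≈-sym h) μ-eigenvalue
          from (inj₂ (inj₂ h)) = IsM-Eigenvalue-resp (≈-sym h) ν-eigenvalue

          to : IsM-Eigenvalue λ′ → λ′ ≈ 1# ⊎ λ′ ≈ μ ⊎ λ′ ≈ ν
          to (f , (u , fu≉0) , eigen) with λ′ - 1# ≈? 0# | λ′ - μ ≈? 0# | λ′ - ν ≈? 0#
          ... | yes h | _     | _     = inj₁ (x-y≈0⇒x≈y h)
          ... | no _  | yes h | _     = inj₂ (inj₁ (x-y≈0⇒x≈y h))
          ... | no _  | no _  | yes h = inj₂ (inj₂ (x-y≈0⇒x≈y h))
          ... | no λ′≉1 | no λ′≉μ | no λ′≉ν = ⊥-elim (*-≉0 λ′≉ν (*-≉0 λ′≉μ fu≉0) (begin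
              (λ′ - ν) * ((λ′ - μ) * f u)   ≈⟨ Sh-Sh-eigen μ ν eigen u ⟨
              Sh μ (Sh ν f) u               ≈⟨ Sh-Sh≈t⟪𝟏,f⟫ f u ⟩
              t * ⟪ 𝟏 , f ⟫                 ≈⟨ *-zero-≈ʳ ⟪𝟏,f⟫≈0 ⟩
              0#                            ∎))
            where
            ⟪𝟏,f⟫≈0 : ⟪ 𝟏 , f ⟫ ≈ 0#
            -- Pairing with `𝟏` is invariant under `M`, so it also gets multiplied by `λ′`; as `λ′`
            -- is not 1, it is zero.
            ⟪𝟏,f⟫≈0 = x*y≈0⇒y≈0 λ′≉1 (begin
              (λ′ - 1#) * ⟪ 𝟏 , f ⟫              ≈⟨ solve 2 (λ l x → (l :- :1) :* x := l :* x :- x) ≈-refl λ′ ⟪ 𝟏 , f ⟫ ⟩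
              λ′ * ⟪ 𝟏 , f ⟫ - ⟪ 𝟏 , f ⟫         ≈⟨ +-congʳ (⟪⟫-scaleʳ λ′ 𝟏 f) ⟨
              ⟪ 𝟏 , (λ w → λ′ * f w) ⟫ - ⟪ 𝟏 , f ⟫ ≈⟨ x≈y⇒x-y≈0 (≈-trans (⟪⟫-cong {𝟏} (λ _ → ≈-refl) (λ w → ≈-sym (eigen w))) (⟪𝟏,M⟫ f)) ⟩
              0#                                 ∎)

  -- Adjacency matrices and the normalized Laplacian.

  module AdjacencyMatrix {n : ℕ} (G : Graph n) where
    open Graph G

    α : Fin n → Fin n → ℝ
    α u w = ι (does (adj? u w))

    δ : Fin n → ℝ
    δ u = fromℕ (valency u)

    α-sym : ∀ u w → α u w ≈ α w u
    α-sym u w with adj? u w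
    ... | yes a = ≈-sym (ι-true (adj? w u) (symm a))
    ... | no ¬a = ≈-sym (ι-false (adj? w u) (¬a ∘ symm))

    0≤α : ∀ u w → 0# ≤ α u w
    0≤α u w = 0≤ι (does (adj? u w))

    α-row : ∀ u → sum (α u) ≈ δ u
    α-row u = ≈-sym (∣tabulate∣≈sum (λ w → does (adj? u w)))

    αα-row : ∀ u w → sum (λ z → α u z * α z w) ≈ fromℕ ∣ neighbours u ∩ neighbours w ∣
    αα-row u w = ≈-sym (≈-trans (∣tabulate∩tabulate∣≈sum (λ z → does (adj? u z)) (λ z → does (adj? w z)))
      (sum-cong-≋ λ z → *-congˡ (α-sym w z)))

    α≉0⇒0<valency : ∀ u w → α u w ≉ 0# → 0 ℕ.< valency u
    α≉0⇒0<valency u w αuw≉0 with valency u in eq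
    ... | suc _ = ℕ.s≤s ℕ.z≤n
    ... | zero  = ⊥-elim (αuw≉0 (sum≈0⇒≈0 (0≤α u) (≈-trans (α-row u) (reflexive (≡.cong fromℕ eq))) w))

  module NormalizedLaplacian {n : ℕ} (G : Graph n)
    (0<valency : ∀ u → 0 ℕ.< Graph.valency G u) where
    open Graph G
    open AdjacencyMatrix G

    0<δ : ∀ u → 0# < δ u
    0<δ u = 0<fromℕ (0<valency u)

    weighting : Weighting n
    weighting = record
      { α = α ; δ = δ ; α-sym = α-sym ; 0≤α = 0≤α ; 0<δ = 0<δ ; α-row = α-row }

    open WeightedGraph weighting

    private
      s σ : Fin n → ℝ
      s u = √ (δ u)
      σ u = s u ⁻¹

      0<s : ∀ u → 0# < s u
      0<s u = 0<√ (0<δ u)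

      sσ≈1 : ∀ u → s u * σ u ≈ 1#
      sσ≈1 u = *-inverse (0<x⇒x≉0 (0<s u))

      σσ≈δ⁻¹ : ∀ u → σ u * σ u ≈ δ⁻¹ u
      σσ≈δ⁻¹ u = ≈-sym (⁻¹-unique (begin
        δ u * (σ u * σ u)           ≈⟨ *-congʳ (√-square (0<x⇒0≤x (0<δ u))) ⟨
        s u * s u * (σ u * σ u)     ≈⟨ solve 2 (λ s i → s :* s :* (i :* i) := (s :* i) :* (s :* i)) ≈-refl (s u) (σ u) ⟩
        (s u * σ u) * (s u * σ u)   ≈⟨ *-cong (sσ≈1 u) (sσ≈1 u) ⟩
        1# * 1#                     ≈⟨ *-identityˡ 1# ⟩
        1#                          ∎))

      √⁻¹≈σσ : ∀ u w → √ (δ u * δ w) ⁻¹ ≈ σ u * σ w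
      √⁻¹≈σσ u w = ⁻¹-unique (begin
        √ (δ u * δ w) * (σ u * σ w)   ≈⟨ *-congʳ (√-* (0<δ u) (0<δ w)) ⟩
        s u * s w * (σ u * σ w)       ≈⟨ solve 4 (λ s r i j → s :* r :* (i :* j) := (s :* i) :* (r :* j)) ≈-refl (s u) (s w) (σ u) (σ w) ⟩
        (s u * σ u) * (s w * σ w)     ≈⟨ *-cong (sσ≈1 u) (sσ≈1 w) ⟩
        1# * 1#                       ≈⟨ *-identityˡ 1# ⟩
        1#                            ∎)

      ℒ : Fin n → Fin n → ℝ
      ℒ = normalizedLaplacian R G

      diagonal≈1 : ∀ {m} → 0 ℕ.< m → diagonal R m ≈ 1#
      diagonal≈1 {suc m} _ = ≈-refl

      -- This is ℒ = I - δ^(-1/2) A δ^(-1/2). Positive valencies make the diagonal equal to 1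
      -- throughout, and the root of the product of two valencies splits by `√-*`.
      ℒ-entry : ∀ u w → ℒ u w ≈ κ u w - α u w * (σ u * σ w)
      ℒ-entry u w with u ≟ w | adj? u w
      ... | yes ≡.refl | yes a = ⊥-elim (irrefl ≡.refl a)
      ... | yes ≡.refl | no _  = ≈-trans (diagonal≈1 (0<valency u)) (solve 1 (λ x → :1 := :1 :- :0 :* x) ≈-refl _)
      ... | no _ | yes _ = ≈-trans (-‿cong (*-congˡ (√⁻¹≈σσ u w))) (solve 1 (λ x → :- (:1 :* x) := :0 :- :1 :* x) ≈-refl _)
      ... | no _ | no _  = solve 1 (λ x → :0 := :0 :- :0 :* x) ≈-refl (σ u * σ w)

      -- Multiplying row `u` by `σ u` produces a second factor `σ u` in front of the adjacency sum;
      -- together they are `δ⁻¹ u`, the factor in `M`.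
      ℒ-conjugate : ∀ z u → σ u * sum (λ w → ℒ u w * z w) ≈ σ u * z u - M (λ w → σ w * z w) u
      ℒ-conjugate z u = begin
        σ u * sum (λ w → ℒ u w * z w)
          ≈⟨ *-congˡ (sum-cong-≋ λ w → ≈-trans (*-congʳ (ℒ-entry u w))
               (solve 5 (λ k a p q z → (k :- a :* (p :* q)) :* z := :1 :* (k :* z) :+ (:- p) :* (a :* (q :* z))) ≈-refl (κ u w) (α u w) (σ u) (σ w) (z w))) ⟩
        σ u * sum (λ w → 1# * (κ u w * z w) + - σ u * (α u w * (σ w * z w)))
          ≈⟨ *-congˡ (sum-lin 1# (- σ u) (λ w → κ u w * z w) (λ w → α u w * (σ w * z w))) ⟩
        σ u * (1# * sum (λ w → κ u w * z w) + - σ u * S)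
          ≈⟨ *-congˡ (+-congʳ (*-congˡ (sum-κ u z))) ⟩
        σ u * (1# * z u + - σ u * S)
          ≈⟨ solve 3 (λ p z s → p :* (:1 :* z :+ (:- p) :* s) := p :* z :- (p :* p) :* s) ≈-refl (σ u) (z u) S ⟩
        σ u * z u - σ u * σ u * S
          ≈⟨ +-congˡ (-‿cong (≈-trans (*-congʳ (σσ≈δ⁻¹ u)) (≈-sym (M-def (λ w → σ w * z w) u)))) ⟩
        σ u * z u - M (λ w → σ w * z w) u ∎
        where S = sum (λ w → α u w * (σ w * z w))

      σ≉0 : ∀ u → σ u ≉ 0#
      σ≉0 u = 0<x⇒x≉0 (0<x⇒0<x⁻¹ (0<s u))

    ℒ⇒M-eigenvalue : ∀ {θ} → IsEigenvalue R ℒ θ → IsM-Eigenvalue (1# - θ)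
    ℒ⇒M-eigenvalue {θ} (z , (i , zi≉0) , eigen) =
      (λ u → σ u * z u) , (i , *-≉0 (σ≉0 i) zi≉0) , λ u →
        lc₂ {c = 1#} {c′ = - σ u} (ℒ-conjugate z u) (eigen u)
          (solve 5 (λ p z m l t → m :- (:1 :- t) :* (p :* z) := (:1 :* (p :* l :- (p :* z :- m)) :+ (:- p) :* (l :- t :* z)))
            ≈-refl (σ u) (z u) (M (λ w → σ w * z w) u) (sum (λ w → ℒ u w * z w)) θ)

    M⇒ℒ-eigenvalue : ∀ {θ} → IsM-Eigenvalue (1# - θ) → IsEigenvalue R ℒ θ
    M⇒ℒ-eigenvalue {θ} (f , (i , fi≉0) , eigen) = z , (i , *-≉0 (0<x⇒x≉0 (0<s i)) fi≉0) , λ u →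
      *-cancelˡ (σ≉0 u) (lc₂ {c = 1#} {c′ = - 1#} (ℒ-conjugate z u) (M-z u)
        (solve 5 (λ p z m l t → p :* l :- p :* (t :* z) := :1 :* (p :* l :- (p :* z :- m)) :+ (:- :1) :* (m :- (:1 :- t) :* (p :* z)))
          ≈-refl (σ u) (z u) (M (λ w → σ w * z w) u) (sum (λ w → ℒ u w * z w)) θ))
      where
      z : Fin n → ℝ
      z u = s u * f u

      σz≋f : (λ u → σ u * z u) ≋ f
      σz≋f u = lc₁ {c = f u} (sσ≈1 u) (solve 3 (λ s p f → p :* (s :* f) :- f := f :* (s :* p :- :1)) ≈-refl (s u) (σ u) (f u))

      M-z : ∀ u → M (λ w → σ w * z w) u ≈ (1# - θ) * (σ u * z u)
      M-z u = ≈-trans (M-cong σz≋f u) (≈-trans (eigen u) (*-congˡ (≈-sym (σz≋f u))))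

  -- N is the incidence matrix and A the adjacency matrix of the block graph.
  record QuasiSymmetricMatrices (v b : ℕ) : Set where
    field
      N : Fin v → Fin b → ℝ
      A : Fin b → Fin b → ℝ
      k ƛ r x y a c d : ℝ
      N-row   : ∀ P → sum (N P) ≈ r
      N-col   : ∀ B → sum (λ P → N P B) ≈ k
      NNᵀ     : ∀ P Q → sum (λ B → N P B * N Q B) ≈ ƛ + (r - ƛ) * κ P Q
      NᵀN     : ∀ B B′ → sum (λ P → N P B * N P B′) ≈ x + (y - x) * A B B′ + (k - x) * κ B B′
      A-row   : ∀ B → sum (A B) ≈ a
      A-sym   : ∀ B B′ → A B B′ ≈ A B′ B
      A²      : ∀ B B′ → sum (λ Z → A B Z * A Z B′) ≈ d + (c - d) * A B B′ + (a - d) * κ B B′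
      A-diag  : ∀ B → A B B ≈ 0#
      A-cases : ∀ {B B′} → B ≢ B′ → A B B′ ≈ 0# ⊎ A B B′ ≈ 1#
      N-cases : ∀ P B → N P B ≈ 0# ⊎ N P B ≈ 1#
      y-x≉0   : y - x ≉ 0#
      k≉0     : k ≉ 0#
      0≤r-ƛ   : 0# ≤ r - ƛ
      incident-point   : ∀ B → ∃ λ P → N P B ≈ 1#
      nonadjacent-pair : ∃₂ λ B B′ → A B B′ ≈ 0# × κ B B′ ≈ 0#
      adjacent-pair    : ∃₂ λ B B′ → A B B′ ≈ 1# × κ B B′ ≈ 0#
      P₀ P₁   : Fin v
      P₀≢P₁   : P₀ ≢ P₁
      B₀      : Fin b
      P₀∉B₀   : N P₀ B₀ ≈ 0#
      P₁∈B₀   : N P₁ B₀ ≈ 1#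

  -- Matrix algebra of the point-block graph.

  module PointBlockMatrix {v b : ℕ} (matrices : QuasiSymmetricMatrices v b) where
    open QuasiSymmetricMatrices matrices

    PB : Set
    PB = Fin v ⊎ Fin b

    -- The adjacency matrix in block form: J - I on points, N and its transpose for incidence, A on
    -- blocks.
    β : PB → PB → ℝ
    β (inj₁ P) (inj₁ Q)  = 1# - κ P Q
    β (inj₁ P) (inj₂ B)  = N P B
    β (inj₂ B) (inj₁ P)  = N P B
    β (inj₂ B) (inj₂ B′) = A B B′

    β-points : ∀ {P Q} → P ≢ Q → β (inj₁ P) (inj₁ Q) ≈ 1#
    β-points P≢Q = ≈-trans (+-congˡ (-‿cong (κ-≢ P≢Q))) (solve 0 (:1 :- :0 := :1) ≈-refl)

    -- Guarantees that no valency is zero: a point is adjacent to `P₁`, or to `P₀` if it is `P₁`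
    -- itself, and a block to one of its points.
    neighbour : ∀ s → ∃ λ t → β s t ≉ 0#
    neighbour (inj₁ P) with P ≟ P₁
    ... | yes ≡.refl = inj₁ P₀ , x≈1⇒x≉0 (β-points (P₀≢P₁ ∘ ≡.sym))
    ... | no P≢P₁    = inj₁ P₁ , x≈1⇒x≉0 (β-points P≢P₁)
    neighbour (inj₂ B) = inj₁ (proj₁ (incident-point B)) , x≈1⇒x≉0 (proj₂ (incident-point B))

    d₁ d₂ i₁ i₂ j : ℝ
    d₁ = fromℕ v - 1# + r
    d₂ = k + a
    i₁ = d₁ ⁻¹
    i₂ = d₂ ⁻¹
    j  = (y - x) ⁻¹

    deg deg⁻¹ : PB → ℝ
    deg   = [ const d₁ , const d₂ ]′
    deg⁻¹ = [ const i₁ , const i₂ ]′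

    κPB : PB → PB → ℝ
    κPB (inj₁ P) (inj₁ Q)  = κ P Q
    κPB (inj₁ _) (inj₂ _)  = 0#
    κPB (inj₂ _) (inj₁ _)  = 0#
    κPB (inj₂ B) (inj₂ B′) = κ B B′

    κPB-refl : ∀ s → κPB s s ≈ 1#
    κPB-refl (inj₁ P) = κ-refl P
    κPB-refl (inj₂ B) = κ-refl B

    κPB-≢ : ∀ {s t} → s ≢ t → κPB s t ≈ 0#
    κPB-≢ {inj₁ _} {inj₁ _} s≢t = κ-≢ (s≢t ∘ ≡.cong inj₁)
    κPB-≢ {inj₁ _} {inj₂ _} _   = ≈-refl
    κPB-≢ {inj₂ _} {inj₁ _} _   = ≈-refl
    κPB-≢ {inj₂ _} {inj₂ _} s≢t = κ-≢ (s≢t ∘ ≡.cong inj₂)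

    κ-splitAt : ∀ u w → κ u w ≈ κPB (splitAt v u) (splitAt v w)
    κ-splitAt u w with u ≟ w
    ... | yes ≡.refl = ≈-sym (κPB-refl (splitAt v u))
    ... | no u≢w     = ≈-sym (κPB-≢ {splitAt v u} {splitAt v w} λ eq → u≢w
      (≡.trans (≡.sym (join-splitAt v b u)) (≡.trans (≡.cong (join v b) eq) (join-splitAt v b w))))

    sum-1-κ : ∀ {n} (i : Fin n) f → sum (λ z → (1# - κ i z) * f z) ≈ sum f - f i
    sum-1-κ i f = begin
      sum (λ z → (1# - κ i z) * f z)              ≈⟨ sum-cong-≋ (λ z → solve 2 (λ k f → (:1 :- k) :* f := :1 :* f :+ (:- :1) :* (k :* f)) ≈-refl (κ i z) (f z)) ⟩
      sum (λ z → 1# * f z + - 1# * (κ i z * f z)) ≈⟨ sum-lin 1# (- 1#) f (λ z → κ i z * f z) ⟩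
      1# * sum f + - 1# * sum (λ z → κ i z * f z) ≈⟨ +-congˡ (*-congˡ (sum-κ i f)) ⟩
      1# * sum f + - 1# * f i                     ≈⟨ solve 2 (λ s f → :1 :* s :+ (:- :1) :* f := s :- f) ≈-refl (sum f) (f i) ⟩
      sum f - f i                                 ∎

    sum-affine : ∀ {n} c e l (f g h : Fin n → ℝ) →
      sum (λ z → (c * f z + e * g z) + l * h z) ≈ (c * sum f + e * sum g) + l * sum h
    sum-affine c e l f g h = begin
      sum (λ z → (c * f z + e * g z) + l * h z)        ≈⟨ sum-cong-≋ (λ z → +-congʳ (≈-sym (*-identityˡ (c * f z + e * g z)))) ⟩
      sum (λ z → 1# * (c * f z + e * g z) + l * h z)   ≈⟨ sum-lin 1# l (λ z → c * f z + e * g z) h ⟩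
      1# * sum (λ z → c * f z + e * g z) + l * sum h   ≈⟨ +-congʳ (≈-trans (*-identityˡ _) (sum-lin c e f g)) ⟩
      (c * sum f + e * sum g) + l * sum h              ∎

    sum-κʳ : ∀ {n} (i : Fin n) f → sum (λ z → f z * κ z i) ≈ f i
    sum-κʳ i f = ≈-trans (sum-cong-≋ λ z → ≈-trans (*-comm _ _) (*-congʳ (κ-sym z i))) (sum-κ i f)

    NNᵀ-apply : ∀ p P → sum (λ B → N P B * sum (λ Q → N Q B * p Q)) ≈ ƛ * sum p + (r - ƛ) * p P
    NNᵀ-apply p P = begin
      sum (λ B → N P B * sum (λ Q → N Q B * p Q))
        ≈⟨ sum-sum-assoc (N P) (λ B Q → N Q B) p ⟩
      sum (λ Q → sum (λ B → N P B * N Q B) * p Q)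
        ≈⟨ sum-cong-≋ (λ Q → ≈-trans (*-congʳ (NNᵀ P Q))
             (solve 4 (λ l m k p → (l :+ m :* k) :* p := l :* p :+ m :* (k :* p)) ≈-refl ƛ (r - ƛ) (κ P Q) (p Q))) ⟩
      sum (λ Q → ƛ * p Q + (r - ƛ) * (κ P Q * p Q))
        ≈⟨ sum-lin ƛ (r - ƛ) p (λ Q → κ P Q * p Q) ⟩
      ƛ * sum p + (r - ƛ) * sum (λ Q → κ P Q * p Q)
        ≈⟨ +-congˡ (*-congˡ (sum-κ P p)) ⟩
      ƛ * sum p + (r - ƛ) * p P ∎

    NᵀN-apply : ∀ g B → sum (λ P → N P B * sum (λ B′ → N P B′ * g B′)) ≈
                x * sum g + (y - x) * sum (λ B′ → A B B′ * g B′) + (k - x) * g B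
    NᵀN-apply g B = begin
      sum (λ P → N P B * sum (λ B′ → N P B′ * g B′))
        ≈⟨ sum-sum-assoc (λ P → N P B) N g ⟩
      sum (λ B′ → sum (λ P → N P B * N P B′) * g B′)
        ≈⟨ sum-cong-≋ (λ B′ → ≈-trans (*-congʳ (NᵀN B B′))
             (solve 6 (λ x m a n k g → (x :+ m :* a :+ n :* k) :* g := x :* g :+ m :* (a :* g) :+ n :* (k :* g))
               ≈-refl x (y - x) (A B B′) (k - x) (κ B B′) (g B′))) ⟩
      sum (λ B′ → x * g B′ + (y - x) * (A B B′ * g B′) + (k - x) * (κ B B′ * g B′))
        ≈⟨ sum-affine x (y - x) (k - x) g (λ B′ → A B B′ * g B′) (λ B′ → κ B B′ * g B′) ⟩
      x * sum g + (y - x) * sum (λ B′ → A B B′ * g B′) + (k - x) * sum (λ B′ → κ B B′ * g B′)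
        ≈⟨ +-congˡ (*-congˡ (sum-κ B g)) ⟩
      x * sum g + (y - x) * sum (λ B′ → A B B′ * g B′) + (k - x) * g B ∎

    -- `NᵀN` solved for `A`, which is possible because x ≠ y. Adjacency of blocks is thereby reduced
    -- to incidence.
    A-apply : ∀ g B → sum (λ B′ → A B B′ * g B′) ≈
              j * (sum (λ P → N P B * sum (λ B′ → N P B′ * g B′)) - x * sum g - (k - x) * g B)
    A-apply g B = lc₂ {c = j} {c′ = - sum (λ B′ → A B B′ * g B′)} (≈-sym (NᵀN-apply g B)) (*-inverse y-x≉0)
      (solve 7 (λ s j n x t m z → s :- j :* (n :- x :* t :- m) := j :* ((x :* t :+ z :* s :+ m) :- n) :+ (:- s) :* (z :* j :- :1))
        ≈-refl (sum (λ B′ → A B B′ * g B′)) j (sum (λ P → N P B * sum (λ B′ → N P B′ * g B′))) x (sum g) ((k - x) * g B) (y - x))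

    sum-Nᵀ : ∀ p → sum (λ B → sum (λ Q → N Q B * p Q)) ≈ r * sum p
    sum-Nᵀ p = begin
      sum (λ B → sum (λ Q → N Q B * p Q))   ≈⟨ ∑-comm (λ B Q → N Q B * p Q) ⟩
      sum (λ Q → sum (λ B → N Q B * p Q))   ≈⟨ sum-cong-≋ (λ Q → ≈-trans (≈-sym (*-distribʳ-sum (p Q) (N Q))) (*-congʳ (N-row Q))) ⟩
      sum (λ Q → r * p Q)                   ≈⟨ *-distribˡ-sum r p ⟨
      r * sum p                             ∎

    -- The block graph eigenvalue ρ₁ = (r - λ - k + x)/(y - x): up to constants, `A` acts as this
    -- scalar on the image of Nᵀ.
    ρ : ℝ
    ρ = j * (r - ƛ - (k - x))

    -- By associativity (NᵀN)Nᵀ = Nᵀ(NNᵀ) = Nᵀ(λJ + (r - λ)I), so `A` maps the image of Nᵀ into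
    -- itself up to constants. The entries of ANᵀ count the blocks through a point that meet a given
    -- block in y points.
    ANᵀ-apply : ∀ p B → sum (λ B′ → A B B′ * sum (λ Q → N Q B′ * p Q)) ≈
                j * (ƛ * k - x * r) * sum p + ρ * sum (λ Q → N Q B * p Q)
    ANᵀ-apply p B = begin
      sum (λ B′ → A B B′ * g B′)
        ≈⟨ A-apply g B ⟩
      j * (sum (λ P → N P B * sum (λ B′ → N P B′ * g B′)) - x * sum g - (k - x) * g B)
        ≈⟨ *-congˡ (+-congʳ (+-cong (≈-trans (sum-cong-≋ λ P → ≈-trans (*-congˡ (NNᵀ-apply p P))
               (solve 5 (λ n l s m p → n :* (l :* s :+ m :* p) := (l :* s) :* n :+ m :* (n :* p)) ≈-refl (N P B) ƛ (sum p) (r - ƛ) (p P)))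
             (sum-lin (ƛ * sum p) (r - ƛ) (λ P → N P B) (λ P → N P B * p P))) (-‿cong (*-congˡ (sum-Nᵀ p))))) ⟩
      j * (ƛ * sum p * sum (λ P → N P B) + (r - ƛ) * g B - x * (r * sum p) - (k - x) * g B)
        ≈⟨ *-congˡ (+-congʳ (+-congʳ (+-congʳ (*-congˡ (N-col B))))) ⟩
      j * (ƛ * sum p * k + (r - ƛ) * g B - x * (r * sum p) - (k - x) * g B)
        ≈⟨ solve 7 (λ j l s k r g x → j :* (l :* s :* k :+ (r :- l) :* g :- x :* (r :* s) :- (k :- x) :* g)
             := j :* (l :* k :- x :* r) :* s :+ j :* (r :- l :- (k :- x)) :* g) ≈-refl j ƛ (sum p) k r (g B) x ⟩
      j * (ƛ * k - x * r) * sum p + ρ * g B ∎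
      where
      g : Fin b → ℝ
      g B = sum (λ Q → N Q B * p Q)

    -- The matrix A δ⁻¹ A of the whole graph. The inverse weight is constant on points and on
    -- blocks, so it is pulled out of the sum over each kind of intermediate vertex.
    β² : PB → PB → ℝ
    β² s t = i₁ * sum (λ P → β s (inj₁ P) * β (inj₁ P) t) + i₂ * sum (λ B → β s (inj₂ B) * β (inj₂ B) t)

    β-sym : ∀ s t → β s t ≈ β t s
    β-sym (inj₁ P) (inj₁ Q)  = +-congˡ (-‿cong (κ-sym P Q))
    β-sym (inj₁ _) (inj₂ _)  = ≈-refl
    β-sym (inj₂ _) (inj₁ _)  = ≈-refl
    β-sym (inj₂ B) (inj₂ B′) = A-sym B B′

    β²-sym : ∀ s t → β² s t ≈ β² t s
    β²-sym s t = +-cong (*-congˡ (sum-cong-≋ λ P → flip (inj₁ P))) (*-congˡ (sum-cong-≋ λ B → flip (inj₂ B)))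
      where
      flip : ∀ z → β s z * β z t ≈ β t z * β z s
      flip z = ≈-trans (*-comm _ _) (*-cong (β-sym z t) (β-sym s z))

    -- Through points the walk contributes (J - I)² = (v - 2)J + I, through blocks NNᵀ.
    β²-points : ∀ P Q → β² (inj₁ P) (inj₁ Q) ≈ i₁ * (fromℕ v - 2# + κ P Q) + i₂ * (ƛ + (r - ƛ) * κ P Q)
    β²-points P Q = +-cong (*-congˡ (begin
      sum (λ Z → (1# - κ P Z) * (1# - κ Z Q))
        ≈⟨ sum-1-κ P (λ Z → 1# - κ Z Q) ⟩
      sum (λ Z → 1# - κ Z Q) - (1# - κ P Q)
        ≈⟨ +-congʳ (sum-cong-≋ λ Z → ≈-trans (+-congˡ (-‿cong (κ-sym Z Q))) (≈-sym (*-identityʳ _))) ⟩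
      sum (λ Z → (1# - κ Q Z) * 1#) - (1# - κ P Q)
        ≈⟨ +-congʳ (sum-1-κ Q (const 1#)) ⟩
      sum {v} (const 1#) - 1# - (1# - κ P Q)
        ≈⟨ +-congʳ (+-congʳ (sum-const {v} 1#)) ⟩
      fromℕ v * 1# - 1# - (1# - κ P Q)
        ≈⟨ solve 2 (λ v k → v :* :1 :- :1 :- (:1 :- k) := v :- :2 :+ k) ≈-refl (fromℕ v) (κ P Q) ⟩
      fromℕ v - 2# + κ P Q ∎)) (*-congˡ (NNᵀ P Q))

    β²-blocks : ∀ B B′ → β² (inj₂ B) (inj₂ B′) ≈
      i₁ * (x + (y - x) * A B B′ + (k - x) * κ B B′) + i₂ * (d + (c - d) * A B B′ + (a - d) * κ B B′)
    β²-blocks B B′ = +-cong (*-congˡ (NᵀN B B′)) (*-congˡ (A² B B′))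

    -- Through points the contribution is (J - I)N = kJ - N. Through blocks it is NA, the transpose
    -- of ANᵀ, read off by feeding the indicator of `P` to `ANᵀ-apply`.
    β²-point-block : ∀ P B → β² (inj₁ P) (inj₂ B) ≈
      i₁ * (k - N P B) + i₂ * (j * (ƛ * k - x * r) + ρ * N P B)
    β²-point-block P B = +-cong
      (*-congˡ (≈-trans (sum-1-κ P (λ Q → N Q B)) (+-congʳ (N-col B))))
      (*-congˡ (begin
        sum (λ B′ → N P B′ * A B′ B)
          ≈⟨ sum-cong-≋ (λ B′ → ≈-trans (*-comm _ _) (*-cong (A-sym B′ B) (≈-sym (sum-κʳ P (λ Q → N Q B′))))) ⟩
        sum (λ B′ → A B B′ * sum (λ Q → N Q B′ * κ Q P))
          ≈⟨ ANᵀ-apply (λ Q → κ Q P) B ⟩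
        j * (ƛ * k - x * r) * sum (λ Q → κ Q P) + ρ * sum (λ Q → N Q B * κ Q P)
          ≈⟨ +-cong (*-congˡ (≈-trans (sum-cong-≋ λ Q → ≈-sym (*-identityˡ (κ Q P))) (sum-κʳ P (const 1#)))) (*-congˡ (sum-κʳ P (λ Q → N Q B))) ⟩
        j * (ƛ * k - x * r) * 1# + ρ * N P B
          ≈⟨ +-congʳ (*-identityʳ _) ⟩
        j * (ƛ * k - x * r) + ρ * N P B ∎))

    Entry : ℝ → ℝ → ℝ → PB → PB → Set
    Entry μ ν t s s′ = β² s s′ - (μ + ν) * β s s′ + μ * ν * (deg s * κPB s s′) ≈ t * (deg s * deg s′)

    -- The seven equations as matrix entries.

    module Equations (d₂≉0 : d₂ ≉ 0#) (θ₁ θ₂ : ℝ) where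

      μ ν τ : ℝ
      μ = 1# - θ₁
      ν = 1# - θ₂
      τ = (θ₁ * θ₂) / (fromℕ v * d₁ + fromℕ b * d₂)

      Equation : Set
      Equation = DesignEquations R (fromℕ v) (fromℕ b) k ƛ r x y a c d θ₁ θ₂

      -- An entry depends on its position only through the values of `κ`, `N` and `A`, which become
      -- parameters here and in the next two definitions. Their possible values 0 and 1 give two,
      -- two and three cases: the seven equations.
      PointsEntry : ℝ → Set
      PointsEntry κ₀ = i₁ * (fromℕ v - 2# + κ₀) + i₂ * (ƛ + (r - ƛ) * κ₀) - (μ + ν) * (1# - κ₀) + μ * ν * (d₁ * κ₀) ≈ τ * (d₁ * d₁)

      PointBlockEntry : ℝ → Set
      PointBlockEntry N₀ = i₁ * (k - N₀) + i₂ * (j * (ƛ * k - x * r) + ρ * N₀) - (μ + ν) * N₀ + μ * ν * (d₁ * 0#) ≈ τ * (d₁ * d₂)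

      BlocksEntry : ℝ → ℝ → Set
      BlocksEntry A₀ κ₀ = i₁ * (x + (y - x) * A₀ + (k - x) * κ₀) + i₂ * (d + (c - d) * A₀ + (a - d) * κ₀)
        - (μ + ν) * A₀ + μ * ν * (d₂ * κ₀) ≈ τ * (d₂ * d₂)

      pointsEntry : ∀ {κ₀} P Q → κ P Q ≈ κ₀ → Entry μ ν τ (inj₁ P) (inj₁ Q) ⇔ PointsEntry κ₀
      pointsEntry {κ₀} P Q h = mk⇔ (≈-trans (≈-sym lhs)) (≈-trans lhs)
        where
        lhs = +-cong (+-cong
          (≈-trans (β²-points P Q) (+-cong (*-congˡ (+-congˡ h)) (*-congˡ (+-congˡ (*-congˡ h)))))
          (-‿cong (*-congˡ (+-congˡ (-‿cong h))))) (*-congˡ (*-congˡ h))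

      pointBlockEntry : ∀ {N₀} P B → N P B ≈ N₀ → Entry μ ν τ (inj₁ P) (inj₂ B) ⇔ PointBlockEntry N₀
      pointBlockEntry P B h = mk⇔ (≈-trans (≈-sym lhs)) (≈-trans lhs)
        where
        lhs = +-congʳ (+-cong
          (≈-trans (β²-point-block P B) (+-cong (*-congˡ (+-congˡ (-‿cong h))) (*-congˡ (+-congˡ (*-congˡ h)))))
          (-‿cong (*-congˡ h)))

      blocksEntry : ∀ {A₀ κ₀} B B′ → A B B′ ≈ A₀ → κ B B′ ≈ κ₀ → Entry μ ν τ (inj₂ B) (inj₂ B′) ⇔ BlocksEntry A₀ κ₀
      blocksEntry B B′ h h′ = mk⇔ (≈-trans (≈-sym lhs)) (≈-trans lhs)
        where
        lhs = +-cong (+-cong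
          (≈-trans (β²-blocks B B′) (+-cong
            (*-congˡ (+-cong (+-congˡ (*-congˡ h)) (*-congˡ h′)))
            (*-congˡ (+-cong (+-congˡ (*-congˡ h)) (*-congˡ h′)))))
          (-‿cong (*-congˡ h))) (*-congˡ (*-congˡ h′))

      open Equivalence

      private
        -- The equations divide by the product (y - x)(k + a), whereas the entries contain the two
        -- inverses separately.
        [y-x]d₂⁻¹ : ((y - x) * d₂) ⁻¹ ≈ j * i₂
        [y-x]d₂⁻¹ = ⁻¹-unique (begin
          (y - x) * d₂ * (j * i₂)       ≈⟨ solve 4 (λ z d j i → z :* d :* (j :* i) := (z :* j) :* (d :* i)) ≈-refl (y - x) d₂ j i₂ ⟩
          (y - x) * j * (d₂ * i₂)       ≈⟨ *-cong (*-inverse y-x≉0) (*-inverse d₂≉0) ⟩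
          1# * 1#                       ≈⟨ *-identityˡ 1# ⟩
          1#                            ∎)

      -- One position of each kind is enough: `P₀`, `P₁`, `B₀` and the two given pairs of blocks
      -- realise all seven.
      entries⇒equations : (∀ s s′ → Entry μ ν τ s s′) → Equation
      entries⇒equations entry with nonadjacent-pair | adjacent-pair
      ... | B₁ , B₁′ , A₁ , κ₁ | B₂ , B₂′ , A₂ , κ₂ = record
        { point-point = lc₁ {c = 1#} (to (pointsEntry P₀ P₀ (κ-refl P₀)) (entry (inj₁ P₀) (inj₁ P₀)))
            (solve 9 (λ v r l i₁ i₂ p q t d → (v :- :1) :* i₁ :+ r :* i₂ :- (t :* (d :* d) :- (p :- :1) :* (q :- :1) :* d)
              := :1 :* (i₁ :* (v :- :2 :+ :1) :+ i₂ :* (l :+ (r :- l) :* :1) :- (:1 :- p :+ (:1 :- q)) :* (:1 :- :1) :+ (:1 :- p) :* (:1 :- q) :* (d :* :1) :- t :* (d :* d)))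
              ≈-refl (fromℕ v) r ƛ i₁ i₂ θ₁ θ₂ τ d₁)
        ; distinct-points = lc₁ {c = 1#} (to (pointsEntry P₀ P₁ (κ-≢ P₀≢P₁)) (entry (inj₁ P₀) (inj₁ P₁)))
            (solve 9 (λ v r l i₁ i₂ p q t d → (v :- :2) :* i₁ :+ l :* i₂ :- (t :* (d :* d) :+ :2 :- p :- q)
              := :1 :* (i₁ :* (v :- :2 :+ :0) :+ i₂ :* (l :+ (r :- l) :* :0) :- (:1 :- p :+ (:1 :- q)) :* (:1 :- :0) :+ (:1 :- p) :* (:1 :- q) :* (d :* :0) :- t :* (d :* d)))
              ≈-refl (fromℕ v) r ƛ i₁ i₂ θ₁ θ₂ τ d₁)
        ; block-block = lc₁ {c = 1#} (to (blocksEntry B₀ B₀ (A-diag B₀) (κ-refl B₀)) (entry (inj₂ B₀) (inj₂ B₀)))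
            (solve 12 (λ x y k i₁ i₂ a c d p q t e → k :* i₁ :+ a :* i₂ :- (t :* (e :* e) :- (p :- :1) :* (q :- :1) :* e)
              := :1 :* (i₁ :* (x :+ (y :- x) :* :0 :+ (k :- x) :* :1) :+ i₂ :* (d :+ (c :- d) :* :0 :+ (a :- d) :* :1)
                   :- (:1 :- p :+ (:1 :- q)) :* :0 :+ (:1 :- p) :* (:1 :- q) :* (e :* :1) :- t :* (e :* e)))
              ≈-refl x y k i₁ i₂ a c d θ₁ θ₂ τ d₂)
        ; nonadjacent-blocks = lc₁ {c = 1#} (to (blocksEntry B₁ B₁′ A₁ κ₁) (entry (inj₂ B₁) (inj₂ B₁′)))
            (solve 12 (λ x y k i₁ i₂ a c d p q t e → x :* i₁ :+ d :* i₂ :- t :* (e :* e)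
              := :1 :* (i₁ :* (x :+ (y :- x) :* :0 :+ (k :- x) :* :0) :+ i₂ :* (d :+ (c :- d) :* :0 :+ (a :- d) :* :0)
                   :- (:1 :- p :+ (:1 :- q)) :* :0 :+ (:1 :- p) :* (:1 :- q) :* (e :* :0) :- t :* (e :* e)))
              ≈-refl x y k i₁ i₂ a c d θ₁ θ₂ τ d₂)
        ; adjacent-blocks = lc₁ {c = 1#} (to (blocksEntry B₂ B₂′ A₂ κ₂) (entry (inj₂ B₂) (inj₂ B₂′)))
            (solve 12 (λ x y k i₁ i₂ a c d p q t e → y :* i₁ :+ c :* i₂ :- (t :* (e :* e) :+ :2 :- p :- q)
              := :1 :* (i₁ :* (x :+ (y :- x) :* :1 :+ (k :- x) :* :0) :+ i₂ :* (d :+ (c :- d) :* :1 :+ (a :- d) :* :0)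
                   :- (:1 :- p :+ (:1 :- q)) :* :1 :+ (:1 :- p) :* (:1 :- q) :* (e :* :0) :- t :* (e :* e)))
              ≈-refl x y k i₁ i₂ a c d θ₁ θ₂ τ d₂)
        ; nonincident = lc₂ {c = 1#} {c′ = ƛ * k - x * r} (to (pointBlockEntry P₀ B₀ P₀∉B₀) (entry (inj₁ P₀) (inj₂ B₀))) [y-x]d₂⁻¹
            (solve 14 (λ k l x r i₁ i₂ j h p q t d e ρ → k :* i₁ :+ (l :* k :- x :* r) :* h :- t :* d :* e
              := :1 :* (i₁ :* (k :- :0) :+ i₂ :* (j :* (l :* k :- x :* r) :+ ρ :* :0) :- (:1 :- p :+ (:1 :- q)) :* :0 :+ (:1 :- p) :* (:1 :- q) :* (d :* :0) :- t :* (d :* e))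
                :+ (l :* k :- x :* r) :* (h :- j :* i₂))
              ≈-refl k ƛ x r i₁ i₂ j (((y - x) * d₂) ⁻¹) θ₁ θ₂ τ d₁ d₂ ρ)
        -- Here `ρ` is written out, because the count for an incident pair is
        -- `j * (ƛ * k - x * r) + ρ`; for a nonincident pair `ρ` is multiplied by zero and can stay
        -- a variable.
        ; incident = lc₂ {c = 1#} {c′ = (ƛ - 1#) * (k - 1#) - (x - 1#) * (r - 1#)} (to (pointBlockEntry P₁ B₀ P₁∈B₀) (entry (inj₁ P₁) (inj₂ B₀))) [y-x]d₂⁻¹
            (solve 13 (λ k l x r i₁ i₂ j h p q t d e → (k :- :1) :* i₁ :+ ((l :- :1) :* (k :- :1) :- (x :- :1) :* (r :- :1)) :* h :- (t :* d :* e :+ :2 :- p :- q)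
              := :1 :* (i₁ :* (k :- :1) :+ i₂ :* (j :* (l :* k :- x :* r) :+ j :* (r :- l :- (k :- x)) :* :1) :- (:1 :- p :+ (:1 :- q)) :* :1 :+ (:1 :- p) :* (:1 :- q) :* (d :* :0) :- t :* (d :* e))
                :+ ((l :- :1) :* (k :- :1) :- (x :- :1) :* (r :- :1)) :* (h :- j :* i₂))
              ≈-refl k ƛ x r i₁ i₂ j (((y - x) * d₂) ⁻¹) θ₁ θ₂ τ d₁ d₂)
        }

      equations⇒pointEntries : Equation → ∀ P Q → Dec (P ≡ Q) → Entry μ ν τ (inj₁ P) (inj₁ Q)
      equations⇒pointEntries E P .P (yes ≡.refl) = from (pointsEntry P P (κ-refl P)) (lc₁ {c = 1#} (DesignEquations.point-point E)
            (solve 9 (λ v r l i₁ i₂ p q t d →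
              i₁ :* (v :- :2 :+ :1) :+ i₂ :* (l :+ (r :- l) :* :1) :- (:1 :- p :+ (:1 :- q)) :* (:1 :- :1) :+ (:1 :- p) :* (:1 :- q) :* (d :* :1) :- t :* (d :* d)
              := :1 :* ((v :- :1) :* i₁ :+ r :* i₂ :- (t :* (d :* d) :- (p :- :1) :* (q :- :1) :* d)))
              ≈-refl (fromℕ v) r ƛ i₁ i₂ θ₁ θ₂ τ d₁))
      equations⇒pointEntries E P Q (no P≢Q) = from (pointsEntry P Q (κ-≢ P≢Q)) (lc₁ {c = 1#} (DesignEquations.distinct-points E)
            (solve 9 (λ v r l i₁ i₂ p q t d →
              i₁ :* (v :- :2 :+ :0) :+ i₂ :* (l :+ (r :- l) :* :0) :- (:1 :- p :+ (:1 :- q)) :* (:1 :- :0) :+ (:1 :- p) :* (:1 :- q) :* (d :* :0) :- t :* (d :* d)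
              := :1 :* ((v :- :2) :* i₁ :+ l :* i₂ :- (t :* (d :* d) :+ :2 :- p :- q)))
              ≈-refl (fromℕ v) r ƛ i₁ i₂ θ₁ θ₂ τ d₁))

      equations⇒blockEntries : Equation → ∀ B B′ → Dec (B ≡ B′) → Entry μ ν τ (inj₂ B) (inj₂ B′)
      equations⇒blockEntries E B .B (yes ≡.refl) = from (blocksEntry B B (A-diag B) (κ-refl B)) (lc₁ {c = 1#} (DesignEquations.block-block E)
            (solve 12 (λ x y k i₁ i₂ a c d p q t e →
              i₁ :* (x :+ (y :- x) :* :0 :+ (k :- x) :* :1) :+ i₂ :* (d :+ (c :- d) :* :0 :+ (a :- d) :* :1)
                   :- (:1 :- p :+ (:1 :- q)) :* :0 :+ (:1 :- p) :* (:1 :- q) :* (e :* :1) :- t :* (e :* e)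
              := :1 :* (k :* i₁ :+ a :* i₂ :- (t :* (e :* e) :- (p :- :1) :* (q :- :1) :* e)))
              ≈-refl x y k i₁ i₂ a c d θ₁ θ₂ τ d₂))
      equations⇒blockEntries E B B′ (no B≢B′) with A-cases B≢B′
      ... | inj₁ h = from (blocksEntry B B′ h (κ-≢ B≢B′)) (lc₁ {c = 1#} (DesignEquations.nonadjacent-blocks E)
            (solve 12 (λ x y k i₁ i₂ a c d p q t e →
              i₁ :* (x :+ (y :- x) :* :0 :+ (k :- x) :* :0) :+ i₂ :* (d :+ (c :- d) :* :0 :+ (a :- d) :* :0)
                   :- (:1 :- p :+ (:1 :- q)) :* :0 :+ (:1 :- p) :* (:1 :- q) :* (e :* :0) :- t :* (e :* e)
              := :1 :* (x :* i₁ :+ d :* i₂ :- t :* (e :* e)))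
              ≈-refl x y k i₁ i₂ a c d θ₁ θ₂ τ d₂))
      ... | inj₂ h = from (blocksEntry B B′ h (κ-≢ B≢B′)) (lc₁ {c = 1#} (DesignEquations.adjacent-blocks E)
            (solve 12 (λ x y k i₁ i₂ a c d p q t e →
              i₁ :* (x :+ (y :- x) :* :1 :+ (k :- x) :* :0) :+ i₂ :* (d :+ (c :- d) :* :1 :+ (a :- d) :* :0)
                   :- (:1 :- p :+ (:1 :- q)) :* :1 :+ (:1 :- p) :* (:1 :- q) :* (e :* :0) :- t :* (e :* e)
              := :1 :* (y :* i₁ :+ c :* i₂ :- (t :* (e :* e) :+ :2 :- p :- q)))
              ≈-refl x y k i₁ i₂ a c d θ₁ θ₂ τ d₂))

      equations⇒entries : Equation → ∀ s s′ → Entry μ ν τ s s′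
      equations⇒entries E (inj₁ P) (inj₁ Q)  = equations⇒pointEntries E P Q (P ≟ Q)
      equations⇒entries E (inj₂ B) (inj₂ B′) = equations⇒blockEntries E B B′ (B ≟ B′)
      equations⇒entries E (inj₁ P) (inj₂ B) with N-cases P B
      ... | inj₁ h = from (pointBlockEntry P B h) (lc₂ {c = 1#} {c′ = - (ƛ * k - x * r)} (DesignEquations.nonincident E) [y-x]d₂⁻¹
            (solve 14 (λ k l x r i₁ i₂ j h p q t d e ρ →
              i₁ :* (k :- :0) :+ i₂ :* (j :* (l :* k :- x :* r) :+ ρ :* :0) :- (:1 :- p :+ (:1 :- q)) :* :0 :+ (:1 :- p) :* (:1 :- q) :* (d :* :0) :- t :* (d :* e)
              := :1 :* (k :* i₁ :+ (l :* k :- x :* r) :* h :- t :* d :* e) :+ (:- (l :* k :- x :* r)) :* (h :- j :* i₂))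
              ≈-refl k ƛ x r i₁ i₂ j (((y - x) * d₂) ⁻¹) θ₁ θ₂ τ d₁ d₂ ρ))
      ... | inj₂ h = from (pointBlockEntry P B h) (lc₂ {c = 1#} {c′ = - ((ƛ - 1#) * (k - 1#) - (x - 1#) * (r - 1#))} (DesignEquations.incident E) [y-x]d₂⁻¹
            (solve 13 (λ k l x r i₁ i₂ j h p q t d e →
              i₁ :* (k :- :1) :+ i₂ :* (j :* (l :* k :- x :* r) :+ j :* (r :- l :- (k :- x)) :* :1) :- (:1 :- p :+ (:1 :- q)) :* :1 :+ (:1 :- p) :* (:1 :- q) :* (d :* :0) :- t :* (d :* e)
              := :1 :* ((k :- :1) :* i₁ :+ ((l :- :1) :* (k :- :1) :- (x :- :1) :* (r :- :1)) :* h :- (t :* d :* e :+ :2 :- p :- q))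
                :+ (:- ((l :- :1) :* (k :- :1) :- (x :- :1) :* (r :- :1))) :* (h :- j :* i₂))
              ≈-refl k ƛ x r i₁ i₂ j (((y - x) * d₂) ⁻¹) θ₁ θ₂ τ d₁ d₂))
      -- The remaining case is the transpose of the previous one: `β²` is symmetric, and the term
      -- with `deg`, the only asymmetric one, is multiplied by zero.
      equations⇒entries E (inj₂ B) (inj₁ P) = begin
        β² (inj₂ B) (inj₁ P) - (μ + ν) * N P B + μ * ν * (d₂ * 0#)
          ≈⟨ +-cong (+-congʳ (β²-sym (inj₂ B) (inj₁ P))) (*-congˡ (≈-trans (zeroʳ d₂) (≈-sym (zeroʳ d₁)))) ⟩
        β² (inj₁ P) (inj₂ B) - (μ + ν) * N P B + μ * ν * (d₁ * 0#)
          ≈⟨ equations⇒entries E (inj₁ P) (inj₂ B) ⟩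
        τ * (d₁ * d₂)
          ≈⟨ *-congˡ (*-comm d₁ d₂) ⟩
        τ * (d₂ * d₁) ∎

    -- The operator `M` on vectors over points and blocks.

    module PointBlockSpectrum (W : Weighting (v ℕ.+ b))
      (α-splitAt : ∀ u w → Weighting.α W u w ≈ β (splitAt v u) (splitAt v w))
      where

      open Weighting W
      open WeightedGraph W

      sum-PB : (PB → ℝ) → ℝ
      sum-PB f = sum (f ∘ inj₁) + sum (f ∘ inj₂)

      deg-row : ∀ s → sum-PB (β s) ≈ deg s
      deg-row (inj₁ P) = +-cong (begin
        sum (λ Q → 1# - κ P Q)          ≈⟨ sum-cong-≋ (λ Q → *-identityʳ (1# - κ P Q)) ⟨
        sum (λ Q → (1# - κ P Q) * 1#)   ≈⟨ sum-1-κ P (const 1#) ⟩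
        sum {v} (const 1#) - 1#         ≈⟨ +-congʳ (≈-trans (sum-const {v} 1#) (*-identityʳ _)) ⟩
        fromℕ v - 1#                    ∎) (N-row P)
      deg-row (inj₂ B) = +-cong (N-col B) (A-row B)

      δ-splitAt : ∀ u → δ u ≈ deg (splitAt v u)
      δ-splitAt u = begin
        δ u                               ≈⟨ α-row u ⟨
        sum (α u)                         ≈⟨ sum-cong-≋ (α-splitAt u) ⟩
        sum (β (splitAt v u) ∘ splitAt v) ≈⟨ sum-splitAt v (β (splitAt v u)) ⟩
        sum-PB (β (splitAt v u))          ≈⟨ deg-row (splitAt v u) ⟩
        deg (splitAt v u)                 ∎

      δ⁻¹-splitAt : ∀ u → δ⁻¹ u ≈ deg⁻¹ (splitAt v u)
      δ⁻¹-splitAt u = ≈-trans (⁻¹-cong (δ-splitAt u)) (deg-inverse (splitAt v u))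
        where
        deg-inverse : ∀ s → deg s ⁻¹ ≈ deg⁻¹ s
        deg-inverse (inj₁ _) = ≈-refl
        deg-inverse (inj₂ _) = ≈-refl

      -- Identifies the denominator of `τ`.
      total≈ : total ≈ fromℕ v * d₁ + fromℕ b * d₂
      total≈ = begin
        sum δ                                   ≈⟨ sum-cong-≋ δ-splitAt ⟩
        sum (deg ∘ splitAt v)                   ≈⟨ sum-splitAt v deg ⟩
        sum {v} (const d₁) + sum {b} (const d₂) ≈⟨ +-cong (sum-const {v} d₁) (sum-const {b} d₂) ⟩
        fromℕ v * d₁ + fromℕ b * d₂             ∎

      α²-splitAt : ∀ u w → sum (λ z → α u z * (δ⁻¹ z * α z w)) ≈ β² (splitAt v u) (splitAt v w)
      α²-splitAt u w = begin
        sum (λ z → α u z * (δ⁻¹ z * α z w))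
          ≈⟨ sum-cong-≋ (λ z → *-cong (α-splitAt u z) (*-cong (δ⁻¹-splitAt z) (α-splitAt z w))) ⟩
        sum (f ∘ splitAt v)
          ≈⟨ sum-splitAt v f ⟩
        sum (λ P → β s (inj₁ P) * (i₁ * β (inj₁ P) t)) + sum (λ B → β s (inj₂ B) * (i₂ * β (inj₂ B) t))
          ≈⟨ +-cong (factor i₁ (λ P → β s (inj₁ P)) (λ P → β (inj₁ P) t)) (factor i₂ (λ B → β s (inj₂ B)) (λ B → β (inj₂ B) t)) ⟩
        β² s t ∎
        where
        s = splitAt v u
        t = splitAt v w

        f : PB → ℝ
        f z = β s z * (deg⁻¹ z * β z t)

        factor : ∀ {n} i (g h : Fin n → ℝ) → sum (λ z → g z * (i * h z)) ≈ i * sum (λ z → g z * h z)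
        factor i g h = ≈-trans (sum-cong-≋ λ z → solve 3 (λ g i h → g :* (i :* h) := i :* (g :* h)) ≈-refl (g z) i (h z))
          (≈-sym (*-distribˡ-sum i (λ z → g z * h z)))

      module _ {μ ν t : ℝ} where

        private
          lhs : ∀ u w → sum (λ z → α u z * (δ⁻¹ z * α z w)) - (μ + ν) * α u w + μ * ν * (δ u * κ u w) ≈
                β² (splitAt v u) (splitAt v w) - (μ + ν) * β (splitAt v u) (splitAt v w)
                  + μ * ν * (deg (splitAt v u) * κPB (splitAt v u) (splitAt v w))
          lhs u w = +-cong (+-cong (α²-splitAt u w) (-‿cong (*-congˡ (α-splitAt u w))))
            (*-congˡ (*-cong (δ-splitAt u) (κ-splitAt u w)))

          rhs : ∀ u w → t * (δ u * δ w) ≈ t * (deg (splitAt v u) * deg (splitAt v w))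
          rhs u w = *-congˡ (*-cong (δ-splitAt u) (δ-splitAt w))

        identity⇒entries : QuadraticIdentity μ ν t → ∀ s s′ → Entry μ ν t s s′
        identity⇒entries identity s s′ = ≡.subst₂ (Entry μ ν t) (splitAt-join v b s) (splitAt-join v b s′)
          (≈-trans (≈-sym (lhs (join v b s) (join v b s′)))
          (≈-trans (identity (join v b s) (join v b s′)) (rhs (join v b s) (join v b s′))))

        entries⇒identity : (∀ s s′ → Entry μ ν t s s′) → QuadraticIdentity μ ν t
        entries⇒identity entry u w = ≈-trans (lhs u w) (≈-trans (entry (splitAt v u) (splitAt v w)) (≈-sym (rhs u w)))

      vec : (Fin v → ℝ) → (Fin b → ℝ) → Vector
      vec p g u = [ p , g ]′ (splitAt v u)

      M-points : (Fin v → ℝ) → (Fin b → ℝ) → Fin v → ℝ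
      M-points p g P = i₁ * (sum p - p P + sum (λ B → N P B * g B))

      M-blocks : (Fin v → ℝ) → (Fin b → ℝ) → Fin b → ℝ
      M-blocks p g B = i₂ * (sum (λ Q → N Q B * p Q) + sum (λ B′ → A B B′ * g B′))

      M-vec : ∀ p g → M (vec p g) ≋ vec (M-points p g) (M-blocks p g)
      M-vec p g u = begin
        M (vec p g) u
          ≈⟨ M-def (vec p g) u ⟩
        δ⁻¹ u * sum (λ w → α u w * vec p g w)
          ≈⟨ *-cong (δ⁻¹-splitAt u) (≈-trans (sum-cong-≋ λ w → *-congʳ (α-splitAt u w)) (sum-splitAt v (λ z → β (splitAt v u) z * [ p , g ]′ z))) ⟩
        deg⁻¹ (splitAt v u) * sum-PB (λ z → β (splitAt v u) z * [ p , g ]′ z)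
          ≈⟨ cases (splitAt v u) ⟩
        vec (M-points p g) (M-blocks p g) u ∎
        where
        cases : ∀ s → deg⁻¹ s * sum-PB (λ z → β s z * [ p , g ]′ z) ≈ [ M-points p g , M-blocks p g ]′ s
        cases (inj₁ P) = *-congˡ (+-congʳ (sum-1-κ P p))
        cases (inj₂ B) = ≈-refl

      -- Annihilation of every vector by the cubic `K`.

      module _ (0≤i₁ : 0# ≤ i₁) (0≤i₂ : 0# ≤ i₂) (d₂≉0 : d₂ ≉ 0#)
        (μ ν : ℝ) (spectrum : ∀ λ′ → IsM-Eigenvalue λ′ → λ′ ≈ 1# ⊎ λ′ ≈ μ ⊎ λ′ ≈ ν) where
        open FromSpectrum μ ν spectrum

        private
          V₁ V₂ : Vector
          V₁ = vec (const 1#) (const 0#)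
          V₂ = vec (const 0#) (const 1#)

          Nᵀ : (Fin v → ℝ) → Fin b → ℝ
          Nᵀ p B = sum (λ Q → N Q B * p Q)

          sum-*0 : ∀ {n} (f : Fin n → ℝ) → sum (λ z → f z * 0#) ≈ 0#
          sum-*0 f = sum-zero λ z → zeroʳ (f z)

          sum-*1 : ∀ {n} (f : Fin n → ℝ) → sum (λ z → f z * 1#) ≈ sum f
          sum-*1 f = sum-cong-≋ λ z → *-identityʳ (f z)

          Sh-vec : ∀ λ′ {p : Fin v → ℝ} {g : Fin b → ℝ} {f : PB → ℝ} →
            (∀ P → M-points p g P - λ′ * p P ≈ f (inj₁ P)) →
            (∀ B → M-blocks p g B - λ′ * g B ≈ f (inj₂ B)) →
            ∀ u → Sh λ′ (vec p g) u ≈ f (splitAt v u)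
          Sh-vec λ′ {p} {g} {f} hp hg u = ≈-trans (Sh-def λ′ (vec p g) u) (≈-trans (+-congʳ (M-vec p g u)) (cases (splitAt v u)))
            where
            cases : ∀ s → [ M-points p g , M-blocks p g ]′ s - λ′ * [ p , g ]′ s ≈ f s
            cases (inj₁ P) = hp P
            cases (inj₂ B) = hg B

        killed-𝟎 : Killed 𝟎
        killed-𝟎 = Sh-𝟎 1# (Sh-𝟎 μ (Sh-𝟎 ν λ _ → ≈-refl))

        killed-𝟏 : Killed 𝟏
        killed-𝟏 = Killed-unSh 1# (Killed-cong (λ u → ≈-sym (begin
          Sh 1# 𝟏 u            ≈⟨ Sh-eigen 1# (λ w → ≈-trans (M-𝟏 w) (≈-sym (*-identityˡ 1#))) u ⟩
          (1# - 1#) * 1#       ≈⟨ solve 0 ((:1 :- :1) :* :1 := :0) ≈-refl ⟩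
          0#                   ∎)) killed-𝟎)

        -- Points and blocks form an equitable partition. Its 2×2 quotient has the eigenvalue 1 with
        -- eigenvector `𝟏`; `λ′` is the other eigenvalue, so `Sh λ′` sends `V₁` to a multiple of
        -- `𝟏`.
        killed-V₁ : Killed V₁
        killed-V₁ = Killed-unSh λ′ (Killed-cong
          (λ u → ≈-sym (Sh-vec λ′ {f = λ _ → k * i₂ * 1# + 0# * 1#}
            (λ P → begin
              i₁ * (sum {v} (const 1#) - 1# + sum (λ B → N P B * 0#)) - λ′ * 1#
                ≈⟨ +-congʳ (*-congˡ (+-cong (+-congʳ (sum-const {v} 1#)) (sum-*0 (N P)))) ⟩
              i₁ * (fromℕ v * 1# - 1# + 0#) - λ′ * 1#
                ≈⟨ solve 4 (λ i j v k → i :* (v :* :1 :- :1 :+ :0) :- ((v :- :1) :* i :- k :* j) :* :1 := k :* j :* :1 :+ :0 :* :1) ≈-refl i₁ i₂ (fromℕ v) k ⟩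
              k * i₂ * 1# + 0# * 1# ∎)
            (λ B → begin
              i₂ * (sum (λ Q → N Q B * 1#) + sum (λ B′ → A B B′ * 0#)) - λ′ * 0#
                ≈⟨ +-congʳ (*-congˡ (+-cong (≈-trans (sum-*1 (λ Q → N Q B)) (N-col B)) (sum-*0 (A B)))) ⟩
              i₂ * (k + 0#) - λ′ * 0#
                ≈⟨ solve 3 (λ j k l → j :* (k :+ :0) :- l :* :0 := k :* j :* :1 :+ :0 :* :1) ≈-refl i₂ k λ′ ⟩
              k * i₂ * 1# + 0# * 1# ∎) u))
          -- The coefficient `0#` turns the binary combination into a plain multiple of `𝟏`.
          (Killed-lin (k * i₂) 0# killed-𝟏 killed-𝟏))
          where
          λ′ = (fromℕ v - 1#) * i₁ - k * i₂

        killed-V₂ : Killed V₂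
        killed-V₂ = Killed-cong (λ u → cases (splitAt v u)) (Killed-lin 1# (- 1#) killed-𝟏 killed-V₁)
          where
          cases : ∀ s → 1# * 1# + - 1# * [ const 1# , const 0# ]′ s ≈ [ const 0# , const 1# ]′ s
          cases (inj₁ _) = solve 0 (:1 :* :1 :+ (:- :1) :* :1 := :0) ≈-refl
          cases (inj₂ _) = solve 0 (:1 :* :1 :+ (:- :1) :* :0 := :1) ≈-refl

        private
          -- On points `M` acts by `i₁` times J - I: the shift by `- i₁` removes the part -I, and J
          -- leaves a multiple of `V₁`.
          Sh-points : ∀ p u → Sh (- i₁) (vec p (const 0#)) u ≈
            i₂ * vec (const 0#) (Nᵀ p) u + i₁ * sum p * V₁ u
          Sh-points p = Sh-vec (- i₁) {f = λ s → i₂ * [ const 0# , Nᵀ p ]′ s + i₁ * sum p * [ const 1# , const 0# ]′ s}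
            (λ P → begin
              i₁ * (sum p - p P + sum (λ B → N P B * 0#)) - - i₁ * p P
                ≈⟨ +-congʳ (*-congˡ (+-congˡ (sum-*0 (N P)))) ⟩
              i₁ * (sum p - p P + 0#) - - i₁ * p P
                ≈⟨ solve 4 (λ i s p j → i :* (s :- p :+ :0) :- (:- i) :* p := j :* :0 :+ i :* s :* :1) ≈-refl i₁ (sum p) (p P) i₂ ⟩
              i₂ * 0# + i₁ * sum p * 1# ∎)
            (λ B → begin
              i₂ * (Nᵀ p B + sum (λ B′ → A B B′ * 0#)) - - i₁ * 0#
                ≈⟨ +-congʳ (*-congˡ (+-congˡ (sum-*0 (A B)))) ⟩
              i₂ * (Nᵀ p B + 0#) - - i₁ * 0#
                ≈⟨ solve 4 (λ i s n j → j :* (n :+ :0) :- (:- i) :* :0 := j :* n :+ i :* s :* :0) ≈-refl i₁ (sum p) (Nᵀ p B) i₂ ⟩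
              i₂ * Nᵀ p B + i₁ * sum p * 0# ∎)

          -- The way back in the plane: up to constants, NNᵀ returns (r - λ)p on the points and ANᵀ
          -- returns ρNᵀp on the blocks.
          Sh-Nᵀ : ∀ p u → Sh (ρ * i₂) (vec (const 0#) (Nᵀ p)) u ≈
            i₁ * (r - ƛ) * vec p (const 0#) u + (i₁ * ƛ * sum p * V₁ u + i₂ * (j * (ƛ * k - x * r)) * sum p * V₂ u)
          Sh-Nᵀ p = Sh-vec (ρ * i₂)
            {f = λ s → i₁ * (r - ƛ) * [ p , const 0# ]′ s +
              (i₁ * ƛ * sum p * [ const 1# , const 0# ]′ s + i₂ * (j * (ƛ * k - x * r)) * sum p * [ const 0# , const 1# ]′ s)}
            (λ P → begin
              i₁ * (sum {v} (const 0#) - 0# + sum (λ B → N P B * Nᵀ p B)) - ρ * i₂ * 0#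
                ≈⟨ +-congʳ (*-congˡ (+-cong (+-congʳ (sum-zero {v} λ _ → ≈-refl)) (NNᵀ-apply p P))) ⟩
              i₁ * (0# - 0# + (ƛ * sum p + (r - ƛ) * p P)) - ρ * i₂ * 0#
                ≈⟨ solve 7 (λ i l s m p n e → i :* (:0 :- :0 :+ (l :* s :+ m :* p)) :- n :* :0 := i :* m :* p :+ (i :* l :* s :* :1 :+ e :* s :* :0))
                     ≈-refl i₁ ƛ (sum p) (r - ƛ) (p P) (ρ * i₂) (i₂ * (j * (ƛ * k - x * r))) ⟩
              i₁ * (r - ƛ) * p P + (i₁ * ƛ * sum p * 1# + i₂ * (j * (ƛ * k - x * r)) * sum p * 0#) ∎)
            (λ B → begin
              i₂ * (sum (λ Q → N Q B * 0#) + sum (λ B′ → A B B′ * Nᵀ p B′)) - ρ * i₂ * Nᵀ p B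
                ≈⟨ +-congʳ (*-congˡ (+-cong (sum-*0 (λ Q → N Q B)) (ANᵀ-apply p B))) ⟩
              i₂ * (0# + (j * (ƛ * k - x * r) * sum p + ρ * Nᵀ p B)) - ρ * i₂ * Nᵀ p B
                ≈⟨ solve 7 (λ i e s ρ n m l → i :* (:0 :+ (e :* s :+ ρ :* n)) :- ρ :* i :* n := m :* :0 :+ (l :* s :* :0 :+ i :* e :* s :* :1))
                     ≈-refl i₂ (j * (ƛ * k - x * r)) (sum p) ρ (Nᵀ p B) (i₁ * (r - ƛ)) (i₁ * ƛ) ⟩
              i₁ * (r - ƛ) * 0# + (i₁ * ƛ * sum p * 0# + i₂ * (j * (ƛ * k - x * r)) * sum p * 1#) ∎)

          -- The factor `j * (x - k)` is the other block graph eigenvalue ρ₂. Shifting by it removes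
          -- `g` itself, so that only `Ng`, its image under Nᵀ and a constant on the blocks survive.
          Sh-blocks : ∀ g u → Sh (j * (x - k) * i₂) (vec (const 0#) g) u ≈
            i₁ * vec (λ P → sum (λ B → N P B * g B)) (const 0#) u
              + (i₂ * j * vec (const 0#) (Nᵀ (λ P → sum (λ B → N P B * g B))) u + - (i₂ * j * x * sum g) * V₂ u)
          Sh-blocks g = Sh-vec (j * (x - k) * i₂)
            {f = λ s → i₁ * [ Ng , const 0# ]′ s + (i₂ * j * [ const 0# , Nᵀ Ng ]′ s + - (i₂ * j * x * sum g) * [ const 0# , const 1# ]′ s)}
            (λ P → begin
              i₁ * (sum {v} (const 0#) - 0# + Ng P) - j * (x - k) * i₂ * 0#
                ≈⟨ +-congʳ (*-congˡ (+-congʳ (+-congʳ (sum-zero {v} λ _ → ≈-refl)))) ⟩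
              i₁ * (0# - 0# + Ng P) - j * (x - k) * i₂ * 0#
                ≈⟨ solve 5 (λ i n m e f → i :* (:0 :- :0 :+ n) :- m :* :0 := i :* n :+ (e :* :0 :+ f :* :0)) ≈-refl i₁ (Ng P) (j * (x - k) * i₂) (i₂ * j) (- (i₂ * j * x * sum g)) ⟩
              i₁ * Ng P + (i₂ * j * 0# + - (i₂ * j * x * sum g) * 0#) ∎)
            (λ B → begin
              i₂ * (sum (λ Q → N Q B * 0#) + sum (λ B′ → A B B′ * g B′)) - j * (x - k) * i₂ * g B
                ≈⟨ +-congʳ (*-congˡ (+-cong (sum-*0 (λ Q → N Q B)) (A-apply g B))) ⟩
              i₂ * (0# + j * (Nᵀ Ng B - x * sum g - (k - x) * g B)) - j * (x - k) * i₂ * g B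
                ≈⟨ solve 8 (λ i j n x s k g l → i :* (:0 :+ j :* (n :- x :* s :- (k :- x) :* g)) :- j :* (x :- k) :* i :* g
                     := l :* :0 :+ (i :* j :* n :+ (:- (i :* j :* x :* s)) :* :1)) ≈-refl i₂ j (Nᵀ Ng B) x (sum g) k (g B) i₁ ⟩
              i₁ * 0# + (i₂ * j * Nᵀ Ng B + - (i₂ * j * x * sum g) * 1#) ∎)
            where
            Ng : Fin v → ℝ
            Ng P = sum (λ B → N P B * g B)

        -- Modulo V₁ and V₂, M preserves the plane spanned by (p , 0) and (0 , Nᵀ p).
        killed-points : ∀ p → Killed (vec p (const 0#))
        killed-points p = Killed-plane {a = - i₁} {b = i₂} {c = i₁ * (r - ƛ)} {e = ρ * i₂} {g = vec (const 0#) (Nᵀ p)}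
          -- The product of the off-diagonal entries is `i₂ * (i₁ * (r - ƛ))`; its sign is the
          -- reason for requiring `0≤r-ƛ`.
          (0≤x∧0≤y⇒0≤x*y 0≤i₂ (0≤x∧0≤y⇒0≤x*y 0≤i₁ 0≤r-ƛ))
          (Killed-cong (λ u → ≈-sym (≈-trans (+-congʳ (Sh-points p u))
              (solve 3 (λ e f V → e :+ f :* V :- e := f :* V :+ :0 :* V) ≈-refl (i₂ * vec (const 0#) (Nᵀ p) u) (i₁ * sum p) (V₁ u))))
            (Killed-lin (i₁ * sum p) 0# killed-V₁ killed-V₁))
          (Killed-cong (λ u → ≈-sym (≈-trans (+-congʳ (Sh-Nᵀ p u))
              (solve 2 (λ e f → e :+ f :- e := f) ≈-refl (i₁ * (r - ƛ) * vec p (const 0#) u) _)))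
            (Killed-lin (i₁ * ƛ * sum p) (i₂ * (j * (ƛ * k - x * r)) * sum p) killed-V₁ killed-V₂))

        -- `Sh-points` solved for its term in Nᵀp, multiplying by `d₂` to undo `i₂`; everything else
        -- in it is already killed.
        killed-Nᵀ : ∀ p → Killed (vec (const 0#) (Nᵀ p))
        killed-Nᵀ p = Killed-cong (λ u → lc₂ {c = d₂} {c′ = vec (const 0#) (Nᵀ p) u} (Sh-points p u) (*-inverse d₂≉0)
            (solve 6 (λ d s f i w n → d :* s :+ (:- (d :* f)) :* w :- n := d :* (s :- (i :* n :+ f :* w)) :+ n :* (d :* i :- :1))
              ≈-refl d₂ (Sh (- i₁) (vec p (const 0#)) u) (i₁ * sum p) i₂ (V₁ u) (vec (const 0#) (Nᵀ p) u)))
          (Killed-lin d₂ (- (d₂ * (i₁ * sum p))) (Killed-Sh (- i₁) (killed-points p)) killed-V₁)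

        -- A single shift sends the block vector into the span of vectors already known to be
        -- killed.
        killed-blocks : ∀ g → Killed (vec (const 0#) g)
        killed-blocks g = Killed-unSh (j * (x - k) * i₂) (Killed-cong
          (λ u → ≈-sym (≈-trans (Sh-blocks g u) (+-congˡ (≈-sym (*-identityˡ _)))))
          (Killed-lin i₁ 1# (killed-points Ng)
            (Killed-lin (i₂ * j) (- (i₂ * j * x * sum g)) (killed-Nᵀ Ng) killed-V₂)))
          where
          Ng : Fin v → ℝ
          Ng P = sum (λ B → N P B * g B)

        killed : ∀ f → Killed f
        killed f = Killed-cong (λ u → ≈-trans (cases (splitAt v u)) (reflexive (≡.cong f (join-splitAt v b u))))
          (Killed-lin 1# 1# (killed-points (f ∘ (_↑ˡ b))) (killed-blocks (f ∘ (v ↑ʳ_))))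
          where
          cases : ∀ s → 1# * [ f ∘ (_↑ˡ b) , const 0# ]′ s + 1# * [ const 0# , f ∘ (v ↑ʳ_) ]′ s ≈ f (join v b s)
          cases (inj₁ P) = solve 1 (λ f → :1 :* f :+ :1 :* :0 := f) ≈-refl (f (P ↑ˡ b))
          cases (inj₂ B) = solve 1 (λ f → :1 :* :0 :+ :1 :* f := f) ≈-refl (f (v ↑ʳ B))

      δ-join : ∀ s → δ (join v b s) ≈ deg s
      δ-join s = ≈-trans (δ-splitAt (join v b s)) (reflexive (≡.cong deg (splitAt-join v b s)))

      -- The equivalence between the spectrum of `M` and the equations.

      module Characterisation (d₁≉d₂ : d₁ ≉ d₂) where

        private
          point : Fin v → Fin (v ℕ.+ b)
          point P = join v b (inj₁ P)

          block : Fin b → Fin (v ℕ.+ b)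
          block B = join v b (inj₂ B)

          α-join : ∀ s t → α (join v b s) (join v b t) ≈ β s t
          α-join s t = ≈-trans (α-splitAt (join v b s) (join v b t))
            (reflexive (≡.cong₂ β (splitAt-join v b s) (splitAt-join v b t)))

          join-injective : ∀ {s t} → join v b s ≡ join v b t → s ≡ t
          join-injective {s} {t} eq = ≡.trans (≡.sym (splitAt-join v b s)) (≡.trans (≡.cong (splitAt v) eq) (splitAt-join v b t))

          0<d₁ : 0# < d₁
          0<d₁ = <-respʳ-≈ (δ-join (inj₁ P₀)) (0<δ (point P₀))

          0<d₂ : 0# < d₂
          0<d₂ = <-respʳ-≈ (δ-join (inj₂ B₀)) (0<δ (block B₀))

          0≤i₁ : 0# ≤ i₁
          0≤i₁ = 0<x⇒0≤x (0<x⇒0<x⁻¹ 0<d₁)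

          0≤i₂ : 0# ≤ i₂
          0≤i₂ = 0<x⇒0≤x (0<x⇒0<x⁻¹ 0<d₂)

          0<total : 0# < total
          0<total = 0<sum 0<δ (point P₀)

        -- Every vertex is within distance two of `P₀`: points are mutually adjacent, and a block is
        -- reached through one of its points.
        connected : ∀ {f : Vector} → (∀ u w → α u w ≉ 0# → f u ≈ f w) → ∀ u w → f u ≈ f w
        connected {f} edge u w = ≈-trans (toBase u) (≈-sym (toBase w))
          where
          edge′ : ∀ s t → β s t ≉ 0# → f (join v b s) ≈ f (join v b t)
          edge′ s t β≉0 = edge _ _ λ α≈0 → β≉0 (≈-trans (≈-sym (α-join s t)) α≈0)

          base : ∀ s → f (join v b s) ≈ f (point P₀)
          base (inj₁ P) with P ≟ P₀
          ... | yes ≡.refl = ≈-refl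
          ... | no P≢P₀    = edge′ (inj₁ P) (inj₁ P₀) (x≈1⇒x≉0 (β-points P≢P₀))
          base (inj₂ B) with incident-point B
          ... | P , N≈1 = ≈-trans (edge′ (inj₂ B) (inj₁ P) (x≈1⇒x≉0 N≈1)) (base (inj₁ P))

          toBase : ∀ u → f u ≈ f (point P₀)
          toBase u = ≈-trans (reflexive (≡.cong f (≡.sym (join-splitAt v b u)))) (base (splitAt v u))

        module _ (θ₁ θ₂ : ℝ) where
          open Equations (0<x⇒x≉0 0<d₂) θ₁ θ₂ public

          spectrum⇒equations : (∀ λ′ → IsM-Eigenvalue λ′ → λ′ ≈ 1# ⊎ λ′ ≈ μ ⊎ λ′ ≈ ν) → Equation
          spectrum⇒equations spectrum = entries⇒equations (identity⇒entries identity)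
            where
            1-[1-θ]≈θ : ∀ θ → 1# - (1# - θ) ≈ θ
            1-[1-θ]≈θ = solve 1 (λ θ → :1 :- (:1 :- θ) := θ) ≈-refl

            identity : QuadraticIdentity μ ν τ
            identity u w = ≈-trans
              (FromSpectrum.quadraticIdentity μ ν spectrum 0<total
                (killed 0≤i₁ 0≤i₂ (0<x⇒x≉0 0<d₂) μ ν spectrum) connected u w)
              (*-congʳ (*-cong (*-cong (1-[1-θ]≈θ θ₁) (1-[1-θ]≈θ θ₂)) (⁻¹-cong total≈)))

          module FromEquations (equations : Equation) where

            private
              entry : ∀ s s′ → Entry μ ν τ s s′
              entry = equations⇒entries equations

              g : Vector
              g = balanced (point P₀) (block B₀)

              ⟪𝟏,g⟫≈0 : ⟪ 𝟏 , g ⟫ ≈ 0#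
              ⟪𝟏,g⟫≈0 = ⟪𝟏,balanced⟫≈0 (point P₀) (block B₀)

              g-generic : ∀ μ → ∃ λ u → Sh μ g u ≉ 0#
              -- `P₁` is a common neighbour of `P₀` and `B₀`: it is another point, and it is
              -- incident with `B₀`. The two valencies differ by `d₁≉d₂`.
              g-generic μ = point P₁ , Sh-balanced≉0
                (P₀≢P₁ ∘ inj₁-injective ∘ join-injective) (inj₂≢inj₁ ∘ join-injective)
                (≈-trans (α-join (inj₁ P₁) (inj₁ P₀)) (β-points (P₀≢P₁ ∘ ≡.sym)))
                (≈-trans (α-join (inj₁ P₁) (inj₂ B₀)) P₁∈B₀)
                (λ h → d₁≉d₂ (≈-trans (≈-sym (δ-join (inj₁ P₀))) (≈-trans h (δ-join (inj₂ B₀))))) μ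
                where
                inj₂≢inj₁ : inj₂ B₀ ≢ inj₁ P₁
                inj₂≢inj₁ ()

            open FromQuadraticIdentity μ ν τ (entries⇒identity entry)

            spectrum : ∀ λ′ → IsM-Eigenvalue λ′ ⇔ (λ′ ≈ 1# ⊎ λ′ ≈ μ ⊎ λ′ ≈ ν)
            spectrum = M-spectrum (point P₀) g ⟪𝟏,g⟫≈0 g-generic

            θ₁≉θ₂ : θ₁ ≉ θ₂
            θ₁≉θ₂ h = μ≉ν (point P₀) g ⟪𝟏,g⟫≈0 g-generic (+-congˡ (-‿cong h))

            -- At the nonincident pair `P₀`, `B₀` the identity reduces to `β²` = τd₁d₂. The `k`
            -- points of `B₀` are common neighbours of the pair and contribute `i₁ * k` to `β²`, and
            -- all other contributions are nonnegative.
            τ≉0 : τ ≉ 0#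
            τ≉0 τ≈0 = *-≉0 (0<x⇒x≉0 (0<x⇒0<x⁻¹ 0<d₁)) k≉0 (begin
              i₁ * k
                ≈⟨ *-congˡ (solve 1 (λ k → k := k :- :0) ≈-refl k) ⟩
              i₁ * (k - 0#)
                ≈⟨ *-congˡ (+-cong (N-col B₀) (-‿cong P₀∉B₀)) ⟨
              i₁ * (sum (λ Q → N Q B₀) - N P₀ B₀)
                ≈⟨ *-congˡ (sum-1-κ P₀ (λ Q → N Q B₀)) ⟨
              i₁ * sum (λ Q → β (inj₁ P₀) (inj₁ Q) * β (inj₁ Q) (inj₂ B₀))
                ≈⟨ x+y≈0⇒x≈0 (0≤x∧0≤y⇒0≤x*y 0≤i₁ (0≤sum λ Q → 0≤β*β (inj₁ Q)))
                              (0≤x∧0≤y⇒0≤x*y 0≤i₂ (0≤sum λ B → 0≤β*β (inj₂ B))) β²≈0 ⟩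
              0# ∎)
              where
              0≤β : ∀ s t → 0# ≤ β s t
              0≤β s t = 0≤-resp-≈ (α-join s t) (0≤α (join v b s) (join v b t))

              0≤β*β : ∀ z → 0# ≤ β (inj₁ P₀) z * β z (inj₂ B₀)
              0≤β*β z = 0≤x∧0≤y⇒0≤x*y (0≤β (inj₁ P₀) z) (0≤β z (inj₂ B₀))

              β²≈0 : β² (inj₁ P₀) (inj₂ B₀) ≈ 0#
              β²≈0 = begin
                β² (inj₁ P₀) (inj₂ B₀)
                  ≈⟨ solve 4 (λ s m n d → s := s :- m :* :0 :+ n :* (d :* :0)) ≈-refl (β² (inj₁ P₀) (inj₂ B₀)) (μ + ν) (μ * ν) d₁ ⟩
                β² (inj₁ P₀) (inj₂ B₀) - (μ + ν) * 0# + μ * ν * (d₁ * 0#)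
                  ≈⟨ +-congʳ (+-congˡ (-‿cong (*-congˡ P₀∉B₀))) ⟨
                β² (inj₁ P₀) (inj₂ B₀) - (μ + ν) * N P₀ B₀ + μ * ν * (d₁ * 0#)
                  ≈⟨ entry (inj₁ P₀) (inj₂ B₀) ⟩
                τ * (d₁ * d₂)
                  ≈⟨ *-zero-≈ˡ τ≈0 ⟩
                0# ∎

            0≉θ₁ : 0# ≉ θ₁
            0≉θ₁ h = τ≉0 (*-zero-≈ˡ (*-zero-≈ˡ (≈-sym h)))

            0≉θ₂ : 0# ≉ θ₂
            0≉θ₂ h = τ≉0 (*-zero-≈ˡ (*-zero-≈ʳ (≈-sym h)))

  -- The matrices of a quasi-symmetric design.

  module DesignMatrix
    {v b k ƛ r x y a c d : ℕ} (D : Design v b k ƛ)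
    (replication : HasReplicationNumber D r) (quasiSymmetric : IsQuasiSymmetric D x y)
    (stronglyRegular : IsStronglyRegular (blockGraph D y) a c d) where

    open Design D
    open IsQuasiSymmetric quasiSymmetric
    open IsStronglyRegular stronglyRegular
    module Γ₂ = Graph (blockGraph D y)

    open AdjacencyMatrix (blockGraph D y) public using ()
      renaming (α to A; α-sym to A-sym; αα-row to AA-row; α-row to A-valency)

    N : Fin v → Fin b → ℝ
    N P B = ι (does (P ∈? block B))

    N≈ι-lookup : ∀ P B → N P B ≈ ι (lookup (block B) P)
    N≈ι-lookup P B = reflexive (≡.cong ι (does-∈? P (block B)))

    N-row : ∀ P → sum (N P) ≈ fromℕ r
    N-row P = ≈-trans (≈-sym (∣tabulate∣≈sum (λ B → does (P ∈? block B)))) (reflexive (≡.cong fromℕ (replication P)))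

    N-col : ∀ B → sum (λ P → N P B) ≈ fromℕ k
    N-col B = begin
      sum (λ P → N P B)                    ≈⟨ sum-cong-≋ (λ P → N≈ι-lookup P B) ⟩
      sum (λ P → ι (lookup (block B) P))   ≈⟨ ∣∣≈sum (block B) ⟨
      fromℕ ∣ block B ∣                    ≡⟨ ≡.cong fromℕ (blockSize B) ⟩
      fromℕ k                              ∎

    NNᵀ : ∀ P Q → sum (λ B → N P B * N Q B) ≈ fromℕ ƛ + (fromℕ r - fromℕ ƛ) * κ P Q
    NNᵀ P Q = cases (P ≟ Q)
      where
      cases : Dec (P ≡ Q) → sum (λ B → N P B * N Q B) ≈ fromℕ ƛ + (fromℕ r - fromℕ ƛ) * κ P Q
      cases (yes ≡.refl) = begin
        sum (λ B → N P B * N P B)                  ≈⟨ sum-cong-≋ (λ B → ι-idem (does (P ∈? block B))) ⟩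
        sum (N P)                                  ≈⟨ N-row P ⟩
        fromℕ r                                    ≈⟨ solve 2 (λ r l → r := l :+ (r :- l) :* :1) ≈-refl (fromℕ r) (fromℕ ƛ) ⟩
        fromℕ ƛ + (fromℕ r - fromℕ ƛ) * 1#         ≈⟨ +-congˡ (*-congˡ (κ-refl P)) ⟨
        fromℕ ƛ + (fromℕ r - fromℕ ƛ) * κ P P      ∎
      cases (no P≢Q) = begin
        sum (λ B → N P B * N Q B)                  ≈⟨ ∣tabulate∩tabulate∣≈sum (λ B → does (P ∈? block B)) (λ B → does (Q ∈? block B)) ⟨
        fromℕ ∣ blocksThrough P ∩ blocksThrough Q ∣ ≡⟨ ≡.cong fromℕ (balanced P≢Q) ⟩
        fromℕ ƛ                                    ≈⟨ solve 2 (λ r l → l := l :+ (r :- l) :* :0) ≈-refl (fromℕ r) (fromℕ ƛ) ⟩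
        fromℕ ƛ + (fromℕ r - fromℕ ƛ) * 0#         ≈⟨ +-congˡ (*-congˡ (κ-≢ P≢Q)) ⟨
        fromℕ ƛ + (fromℕ r - fromℕ ƛ) * κ P Q      ∎

    meet≈sum : ∀ B B′ → sum (λ P → N P B * N P B′) ≈ fromℕ (meet B B′)
    meet≈sum B B′ = ≈-trans (sum-cong-≋ λ P → *-cong (N≈ι-lookup P B) (N≈ι-lookup P B′)) (≈-sym (∣∩∣≈sum (block B) (block B′)))

    A-diag : ∀ B → A B B ≈ 0#
    A-diag B = ι-false (Γ₂.adj? B B) (Γ₂.irrefl ≡.refl)

    A-x : ∀ {B B′} → meet B B′ ≡ x → A B B′ ≈ 0#
    A-x {B} {B′} eq = ι-false (Γ₂.adj? B B′) λ (_ , eq′) → x≢y (≡.trans (≡.sym eq) eq′)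

    A-y : ∀ {B B′} → B ≢ B′ → meet B B′ ≡ y → A B B′ ≈ 1#
    A-y {B} {B′} B≢B′ eq = ι-true (Γ₂.adj? B B′) (B≢B′ , eq)

    A-cases : ∀ {B B′} → B ≢ B′ → A B B′ ≈ 0# ⊎ A B B′ ≈ 1#
    A-cases B≢B′ with meets B≢B′
    ... | inj₁ eq = inj₁ (A-x eq)
    ... | inj₂ eq = inj₂ (A-y B≢B′ eq)

    private
      -- The entry of p J + (q − p) A + (s − p) I, given A and I.
      combination : ∀ {p q s A₀ A₁ κ₀ κ₁ z} → A₁ ≈ A₀ → κ₁ ≈ κ₀ → z ≈ p + (q - p) * A₀ + (s - p) * κ₀ →
                    z ≈ p + (q - p) * A₁ + (s - p) * κ₁
      combination hA hκ h = ≈-trans h (≈-sym (+-cong (+-congˡ (*-congˡ hA)) (*-congˡ hκ)))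

      diagonal-combination : ∀ p q s → s ≈ p + (q - p) * 0# + (s - p) * 1#
      diagonal-combination = solve 3 (λ p q s → s := p :+ (q :- p) :* :0 :+ (s :- p) :* :1) ≈-refl

      zero-combination : ∀ p q s → p ≈ p + (q - p) * 0# + (s - p) * 0#
      zero-combination = solve 3 (λ p q s → p := p :+ (q :- p) :* :0 :+ (s :- p) :* :0) ≈-refl

      one-combination : ∀ p q s → q ≈ p + (q - p) * 1# + (s - p) * 0#
      one-combination = solve 3 (λ p q s → q := p :+ (q :- p) :* :1 :+ (s :- p) :* :0) ≈-refl

    NᵀN : ∀ B B′ → sum (λ P → N P B * N P B′) ≈
          fromℕ x + (fromℕ y - fromℕ x) * A B B′ + (fromℕ k - fromℕ x) * κ B B′
    NᵀN B B′ = cases (B ≟ B′)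
      where
      cases : Dec (B ≡ B′) → sum (λ P → N P B * N P B′) ≈
              fromℕ x + (fromℕ y - fromℕ x) * A B B′ + (fromℕ k - fromℕ x) * κ B B′
      cases (yes ≡.refl) = combination (A-diag B) (κ-refl B) (begin
        sum (λ P → N P B * N P B)   ≈⟨ sum-cong-≋ (λ P → ι-idem (does (P ∈? block B))) ⟩
        sum (λ P → N P B)           ≈⟨ N-col B ⟩
        fromℕ k                     ≈⟨ diagonal-combination (fromℕ x) (fromℕ y) (fromℕ k) ⟩
        _                           ∎)
      cases (no B≢B′) with meets B≢B′
      ... | inj₁ eq = combination (A-x eq) (κ-≢ B≢B′) (≈-trans (meet≈sum B B′)
                        (≈-trans (reflexive (≡.cong fromℕ eq)) (zero-combination (fromℕ x) (fromℕ y) (fromℕ k))))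
      ... | inj₂ eq = combination (A-y B≢B′ eq) (κ-≢ B≢B′) (≈-trans (meet≈sum B B′)
                        (≈-trans (reflexive (≡.cong fromℕ eq)) (one-combination (fromℕ x) (fromℕ y) (fromℕ k))))

    A-row : ∀ B → sum (A B) ≈ fromℕ a
    A-row B = ≈-trans (A-valency B) (reflexive (≡.cong fromℕ (regular B)))

    A² : ∀ B B′ → sum (λ Z → A B Z * A Z B′) ≈
         fromℕ d + (fromℕ c - fromℕ d) * A B B′ + (fromℕ a - fromℕ d) * κ B B′
    A² B B′ = cases (B ≟ B′) (Γ₂.adj? B B′)
      where
      cases : Dec (B ≡ B′) → Dec (Γ₂.Adj B B′) → sum (λ Z → A B Z * A Z B′) ≈
              fromℕ d + (fromℕ c - fromℕ d) * A B B′ + (fromℕ a - fromℕ d) * κ B B′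
      cases (yes ≡.refl) _ = combination (A-diag B) (κ-refl B) (begin
        sum (λ Z → A B Z * A Z B)   ≈⟨ sum-cong-≋ (λ Z → ≈-trans (*-congˡ (A-sym Z B)) (ι-idem (does (Γ₂.adj? B Z)))) ⟩
        sum (A B)                   ≈⟨ A-row B ⟩
        fromℕ a                     ≈⟨ diagonal-combination (fromℕ d) (fromℕ c) (fromℕ a) ⟩
        _                           ∎)
      cases (no B≢B′) (yes adj) = combination (ι-true (Γ₂.adj? B B′) adj) (κ-≢ B≢B′) (≈-trans (AA-row B B′)
        (≈-trans (reflexive (≡.cong fromℕ (adjacent adj))) (one-combination (fromℕ d) (fromℕ c) (fromℕ a))))
      cases (no B≢B′) (no ¬adj) = combination (ι-false (Γ₂.adj? B B′) ¬adj) (κ-≢ B≢B′) (≈-trans (AA-row B B′)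
        (≈-trans (reflexive (≡.cong fromℕ (nonadjacent B≢B′ ¬adj))) (zero-combination (fromℕ d) (fromℕ c) (fromℕ a))))

    y-x≉0 : fromℕ y - fromℕ x ≉ 0#
    y-x≉0 h = x≢y (≡.sym (fromℕ-injective (x-y≈0⇒x≈y h)))

    N-cases : ∀ P B → N P B ≈ 0# ⊎ N P B ≈ 1#
    N-cases P B with does (P ∈? block B)
    ... | true  = inj₂ ≈-refl
    ... | false = inj₁ ≈-refl

    k≉0 : fromℕ k ≉ 0#
    k≉0 = 0<x⇒x≉0 (0<fromℕ (ℕ.≤-trans (ℕ.s≤s ℕ.z≤n) 2≤k))

    incident-point : ∀ B → ∃ λ P → N P B ≈ 1#
    incident-point B with sum≉0⇒∃≉0 (λ h → k≉0 (≈-trans (≈-sym (N-col B)) h))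
    ... | P , N≉0 with N-cases P B
    ... | inj₁ N≈0 = ⊥-elim (N≉0 N≈0)
    ... | inj₂ N≈1 = P , N≈1

    -- A column of `N` consisting of ones would sum to `v`, but it sums to `k`, which is smaller.
    nonincident-point : ∀ B → ∃ λ P → N P B ≈ 0#
    nonincident-point B with any? (λ P → N P B ≈? 0#)
    ... | yes p = p
    ... | no ¬p = ⊥-elim (ℕ.<⇒≢ k<v (fromℕ-injective (begin
        fromℕ k                 ≈⟨ N-col B ⟨
        sum (λ P → N P B)       ≈⟨ sum-cong-≋ one ⟩
        sum {v} (const 1#)      ≈⟨ sum-const {v} 1# ⟩
        fromℕ v * 1#            ≈⟨ *-identityʳ _ ⟩
        fromℕ v                 ∎)))
      where
      one : ∀ P → N P B ≈ 1#
      one P with N-cases P B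
      ... | inj₁ N≈0 = ⊥-elim (¬p (P , N≈0))
      ... | inj₂ N≈1 = N≈1

    -- Any block would serve; `x-occurs` is a ready source of one.
    B₀ : Fin b
    B₀ = proj₁ x-occurs

    P₀ P₁ : Fin v
    P₀ = proj₁ (nonincident-point B₀)
    P₁ = proj₁ (incident-point B₀)

    P₀∉B₀ : N P₀ B₀ ≈ 0#
    P₀∉B₀ = proj₂ (nonincident-point B₀)

    P₁∈B₀ : N P₁ B₀ ≈ 1#
    P₁∈B₀ = proj₂ (incident-point B₀)

    P₀≢P₁ : P₀ ≢ P₁
    P₀≢P₁ eq = 1≉0 (≈-trans (≈-sym P₁∈B₀) (≈-trans (reflexive (≡.cong (λ P → N P B₀) (≡.sym eq))) P₀∉B₀))

    -- The blocks through two points, `ƛ` in number, are among the `r` blocks through the first.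
    0≤r-ƛ : 0# ≤ fromℕ r - fromℕ ƛ
    0≤r-ƛ = 0≤fromℕ-∸ (≡.subst₂ ℕ._≤_ (balanced P₀≢P₁) (replication P₀)
      (∣p∩q∣≤∣p∣ (blocksThrough P₀) (blocksThrough P₁)))

    matrices : QuasiSymmetricMatrices v b
    matrices = record
      { N = N ; A = A
      ; k = fromℕ k ; ƛ = fromℕ ƛ ; r = fromℕ r ; x = fromℕ x ; y = fromℕ y
      ; a = fromℕ a ; c = fromℕ c ; d = fromℕ d
      ; N-row = N-row ; N-col = N-col ; NNᵀ = NNᵀ ; NᵀN = NᵀN
      ; A-row = A-row ; A-sym = A-sym ; A² = A² ; A-diag = A-diag ; A-cases = A-cases ; N-cases = N-cases
      ; y-x≉0 = y-x≉0 ; k≉0 = k≉0 ; 0≤r-ƛ = 0≤r-ƛ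
      ; incident-point = incident-point
      ; nonadjacent-pair = let B , B′ , B≢B′ , eq = x-occurs in B , B′ , A-x eq , κ-≢ B≢B′
      ; adjacent-pair    = let B , B′ , B≢B′ , eq = y-occurs in B , B′ , A-y B≢B′ eq , κ-≢ B≢B′
      ; P₀ = P₀ ; P₁ = P₁ ; P₀≢P₁ = P₀≢P₁ ; B₀ = B₀ ; P₀∉B₀ = P₀∉B₀ ; P₁∈B₀ = P₁∈B₀
      }

  -- From the graph and its ℒ-eigenvalues to `M`, and back.

  module PointBlockGraph
    {v b k ƛ r x y a c d : ℕ} (D : Design v b k ƛ)
    (replication : HasReplicationNumber D r) (quasiSymmetric : IsQuasiSymmetric D x y)
    (stronglyRegular : IsStronglyRegular (blockGraph D y) a c d)
    (valencyPartition : IsValencyPartition (pointBlockGraph D (blockGraph D y)) (isPoint v))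
    where

    open DesignMatrix D replication quasiSymmetric stronglyRegular using (matrices)
    open QuasiSymmetricMatrices matrices using (P₀; B₀)
    open PointBlockMatrix matrices

    Γ : Graph (v ℕ.+ b)
    Γ = pointBlockGraph D (blockGraph D y)

    open AdjacencyMatrix Γ
    open Graph Γ using (valency)

    α-PB : ∀ s t → ι (does (pbAdj? D (blockGraph D y) s t)) ≈ β s t
    α-PB (inj₁ P) (inj₁ Q) with P ≟ Q
    ... | yes _ = solve 0 (:0 := :1 :- :1) ≈-refl
    ... | no _  = solve 0 (:1 := :1 :- :0) ≈-refl
    α-PB (inj₁ P) (inj₂ B)  = ≈-refl
    α-PB (inj₂ B) (inj₁ P)  = ≈-refl
    α-PB (inj₂ B) (inj₂ B′) = ≈-refl

    α-splitAt : ∀ u w → α u w ≈ β (splitAt v u) (splitAt v w)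
    α-splitAt u w = α-PB (splitAt v u) (splitAt v w)

    -- Comes before any spectral statement, since forming the weighting requires positive weights.
    0<valency : ∀ u → 0 ℕ.< valency u
    0<valency u with neighbour (splitAt v u)
    ... | t , β≉0 = α≉0⇒0<valency u (join v b t) λ α≈0 → β≉0 (begin
      β (splitAt v u) t                           ≡⟨ ≡.cong (β (splitAt v u)) (splitAt-join v b t) ⟨
      β (splitAt v u) (splitAt v (join v b t))    ≈⟨ α-splitAt u (join v b t) ⟨
      α u (join v b t)                            ≈⟨ α≈0 ⟩
      0#                                          ∎)

    open NormalizedLaplacian Γ 0<valency
    open WeightedGraph weighting using (IsM-Eigenvalue; IsM-Eigenvalue-resp)
    open PointBlockSpectrum weighting α-splitAt

    isPoint-join : ∀ s → isPoint v (join v b s) ≡ [ const true , const false ]′ s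
    isPoint-join s = ≡.cong [ const true , const false ]′ (splitAt-join v b s)

    -- Equal valencies would give a point and a block the same label in the valency partition.
    valency-point≢valency-block : ∀ P B → valency (join v b (inj₁ P)) ≢ valency (join v b (inj₂ B))
    valency-point≢valency-block P B eq = true≢false (≡.trans (≡.sym (isPoint-join (inj₁ P)))
      (≡.trans (Equivalence.to (valencyPartition (join v b (inj₁ P)) (join v b (inj₂ B))) eq) (isPoint-join (inj₂ B))))
      where
      true≢false : true ≢ false
      true≢false ()

    d₁≉d₂ : d₁ ≉ d₂
    d₁≉d₂ d₁≈d₂ = valency-point≢valency-block P₀ B₀
      (fromℕ-injective {valency (join v b (inj₁ P₀))} {valency (join v b (inj₂ B₀))}
        (≈-trans (δ-join (inj₁ P₀)) (≈-trans d₁≈d₂ (≈-sym (δ-join (inj₂ B₀))))))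

    open Characterisation d₁≉d₂

    p≈1-q⇒1-p≈q : ∀ {p q} → p ≈ 1# - q → 1# - p ≈ q
    p≈1-q⇒1-p≈q {p} {q} h = lc₁ {c = - 1#} h (solve 2 (λ p q → :1 :- p :- q := (:- :1) :* (p :- (:1 :- q))) ≈-refl p q)

    1-p≈1-q⇒p≈q : ∀ {p q} → 1# - p ≈ 1# - q → p ≈ q
    1-p≈1-q⇒p≈q {p} {q} h = lc₁ {c = - 1#} h (solve 2 (λ p q → p :- q := (:- :1) :* (:1 :- p :- (:1 :- q))) ≈-refl p q)

    1-0≈1 : 1# - 0# ≈ 1#
    1-0≈1 = solve 0 (:1 :- :0 := :1) ≈-refl

    1-[1-p]≈p : ∀ p → 1# - (1# - p) ≈ p
    1-[1-p]≈p p = p≈1-q⇒1-p≈q ≈-refl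

    eigenvalues⇒equations : ∀ θ₁ θ₂ → HasThreeDistinctℒ-Eigenvalues R Γ 0# θ₁ θ₂ → Equation θ₁ θ₂
    eigenvalues⇒equations θ₁ θ₂ (_ , _ , _ , spec) = spectrum⇒equations θ₁ θ₂ M-spec
      where
      ℒ-eigenvalue : ∀ λ′ → IsM-Eigenvalue λ′ → IsEigenvalue R (normalizedLaplacian R Γ) (1# - λ′)
      ℒ-eigenvalue λ′ h = M⇒ℒ-eigenvalue {1# - λ′} (IsM-Eigenvalue-resp {λ′} {1# - (1# - λ′)} (≈-sym (1-[1-p]≈p λ′)) h)

      M-spec : ∀ λ′ → IsM-Eigenvalue λ′ → λ′ ≈ 1# ⊎ λ′ ≈ 1# - θ₁ ⊎ λ′ ≈ 1# - θ₂
      M-spec λ′ h = Sum.map (λ eq → ≈-trans (flip eq) 1-0≈1) (Sum.map flip flip)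
        (Equivalence.to (spec (1# - λ′)) (ℒ-eigenvalue λ′ h))
        where
        flip : ∀ {θ} → 1# - λ′ ≈ θ → λ′ ≈ 1# - θ
        flip eq = ≈-sym (p≈1-q⇒1-p≈q (≈-sym eq))

    equations⇒eigenvalues : ∀ θ₁ θ₂ → Equation θ₁ θ₂ → HasThreeDistinctℒ-Eigenvalues R Γ 0# θ₁ θ₂
    equations⇒eigenvalues θ₁ θ₂ equations = 0≉θ₁ , 0≉θ₂ , θ₁≉θ₂ , λ θ → mk⇔ (to θ) (from θ)
      where
      open FromEquations θ₁ θ₂ equations

      to : ∀ θ → IsEigenvalue R (normalizedLaplacian R Γ) θ → θ ≈ 0# ⊎ θ ≈ θ₁ ⊎ θ ≈ θ₂
      to θ h = Sum.map (λ eq → 1-p≈1-q⇒p≈q (≈-trans eq (≈-sym 1-0≈1))) (Sum.map 1-p≈1-q⇒p≈q 1-p≈1-q⇒p≈q)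
        (Equivalence.to (spectrum (1# - θ)) (ℒ⇒M-eigenvalue {θ} h))

      from : ∀ θ → θ ≈ 0# ⊎ θ ≈ θ₁ ⊎ θ ≈ θ₂ → IsEigenvalue R (normalizedLaplacian R Γ) θ
      from θ h = M⇒ℒ-eigenvalue {θ} (Equivalence.from (spectrum (1# - θ))
        (Sum.map (λ eq → ≈-trans (+-congˡ (-‿cong eq)) 1-0≈1) (Sum.map (λ eq → +-congˡ (-‿cong eq)) (λ eq → +-congˡ (-‿cong eq))) h))

proposition5 :
    (R : Reals) → let open Reals R in
    ∀ {v b k ƛ r x y a c d : ℕ} (D : Design v b k ƛ) →
    HasReplicationNumber D r →
    IsQuasiSymmetric D x y →
    IsStronglyRegular (blockGraph D y) a c d →
    let Γ = pointBlockGraph D (blockGraph D y) in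
    IsBiregular Γ →
    IsValencyPartition Γ (isPoint v) →
    (θ₁ θ₂ : ℝ) →
    HasThreeDistinctℒ-Eigenvalues R Γ 0# θ₁ θ₂
      ⇔ DesignEquations R (fromℕ v) (fromℕ b) (fromℕ k) (fromℕ ƛ) (fromℕ r)
          (fromℕ x) (fromℕ y) (fromℕ a) (fromℕ c) (fromℕ d) θ₁ θ₂
proposition5 R D replication quasiSymmetric stronglyRegular _ valencyPartition θ₁ θ₂ = mk⇔
  (eigenvalues⇒equations R D replication quasiSymmetric stronglyRegular valencyPartition θ₁ θ₂)
  (equations⇒eigenvalues R D replication quasiSymmetric stronglyRegular valencyPartition θ₁ θ₂)
  where open OverReals.PointBlockGraph
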